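{- Let $A$ and $B$ be elongated ribbons of the same size. Then $\mathrm{supp}_F(A) \supseteq \mathrm{supp}_F(B)$ if and only if $\mathrm{rows}_k(A) \preceq \mathrm{rows}_k(B)$ for all $k\ge 1$.
   Context: A composition of $n$ is a sequence of positive integers with sum $n$; a partition is a weakly decreasing composition. Compositions $\alpha=(\alpha_1,\dots,\alpha_k)$ of $n$ correspond bijectively to subsets of $[n-1]=\{1,\dots,n-1\}$ via $S(\alpha)=\{\alpha_1,\alpha_1+\alpha_2,\dots,\alpha_1+\cdots+\alpha_{k-1}\}$. Young diagrams are left-justified with row $1$ at the top; a skew shape $\lambda/\mu$ is the Young diagram of $\lambda$ with the boxes of $\mu\subseteq\lambda$ removed from its top-left. The size of a skew shape is its number of boxes. A ribbon is a skew shape in which every pair of adjacent rows overlap in exactly one column. A ribbon is elongated if all its rows have length at least two. A standard Young tableau (SYT) of a skew shape $A$ with $n$ boxes is a filling of the boxes by $1,\dots,n$, each used once, increasing left to right along rows and down columns. Its descent set is the set of $i$ such that $i+1$ appears in a strictly lower row than $i$, and its descent composition is the composition of $n$ corresponding to its descent set. The monomial quasisymmetric functions are $M_\alpha=\sum_{i_1<\cdots<i_k}x_{i_1}^{\alpha_1}\cdots x_{i_k}^{\alpha_k}$, and the fundamental quasisymmetric functions are $F_\alpha=\sum_{S(\alpha)\subseteq S(\beta)\subseteq[n-1]}M_\beta$ for $\alpha$ of size $n$. The skew Schur function is $s_A=\sum_T F_{\mathrm{comp}(T)}$, the sum being over all SYT $T$ of shape $A$, where $\mathrm{comp}(T)$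 is the descent composition of $T$. The $F$-support $\mathrm{supp}_F(A)$ is the set of compositions $\alpha$ such that $F_\alpha$ has positive coefficient in $s_A$ (equivalently, such that some SYT of shape $A$ has descent composition $\alpha$). For a skew shape $A$ with $r$ rows and $1\le i\le r-k+1$, let $\mathrm{overlap}_k(i)$ be the number of columns occupied in common by rows $i,i+1,\dots,i+k-1$; $\mathrm{rows}_k(A)$ is the partition obtained by sorting $(\mathrm{overlap}_k(1),\dots,\mathrm{overlap}_k(r-k+1))$ into weakly decreasing order and omitting zeros (so it is the empty partition if there are no nonzero overlaps). Dominance order, for partitions possibly of different sizes: $\lambda=(\lambda_1,\dots,\lambda_r)\preceq\mu=(\mu_1,\dots,\mu_s)$ if $\lambda_1+\cdots+\lambda_k\le\mu_1+\cdots+\mu_k$ for all $k=1,\dots,r$, where $\mu_i=0$ for $i>s$. -}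

module Defs where

open import Data.Bool using (if_then_else_)
open import Data.Fin as Fin using (Fin; toℕ)
open import Data.Fin.Properties using (all?; any?)
open import Data.Integer as ℤ using (ℤ; 0ℤ; 1ℤ)
open import Data.List
  using (List; []; _∷_; [_]; _++_; map; concatMap; filter; foldr; length; lookup; take;
         upTo; applyUpTo; allFin; cartesianProductWith; zipWith)
open import Data.List.Membership.DecPropositional using (_∈?_)
open import Data.List.Membership.Propositional using (_∈_)
open import Data.List.Properties using (≡-dec)
open import Data.List.Relation.Binary.Permutation.Propositional using (↭-sym)
open import Data.List.Relation.Binary.Permutation.Propositional.Properties using (All-resp-↭)
open import Data.List.Relation.Binary.Subset.DecPropositional using (_⊆?_)
open import Data.List.Relation.Unary.All as All using (All)
open import Data.List.Relation.Unary.All.Properties using (all-filter)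
open import Data.List.Relation.Unary.Linked using (Linked)
open import Data.List.Sort using (sort; sort-↭; sort-↗)
open import Data.Nat using (ℕ; zero; suc; _+_; _∸_; _≤_; _<_; _≥_; _≟_; _<?_)
open import Data.Nat.ListAction using (sum)
open import Data.Nat.Properties using (≤-decTotalOrder)
open import Data.Product using (_×_; _,_; proj₁; proj₂; ∃-syntax; Σ-syntax)
open import Data.Vec as Vec using (Vec)
open import Level using (0ℓ)
open import Relation.Binary.Bundles using (DecTotalOrder)
import Relation.Binary.Construct.Flip.EqAndOrd as Flip
open import Relation.Binary.PropositionalEquality using (_≡_)
open import Relation.Nullary using (Dec; does; _×-dec_; _→-dec_)

------------------------------------------------------------------------
-- Compositions and partitions

-- A composition is a list of positive integers; `compositions n` lists those
-- with sum n, each exactly once.  Every composition of n + 1 arises uniquely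
-- from one of n by prepending a part 1 or by enlarging the first part.

enlarge : List ℕ → List (List ℕ)
enlarge []      = []
enlarge (a ∷ α) = [ suc a ∷ α ]

compositions : ℕ → List (List ℕ)
compositions zero    = [ [] ]
compositions (suc n) = concatMap (λ α → (1 ∷ α) ∷ enlarge α) (compositions n)

-- The subset S(α) of {1, …, n-1}, as an increasing list.

S : List ℕ → List ℕ
S []          = []
S (a ∷ [])    = []
S (a ∷ b ∷ α) = a ∷ map (a +_) (S (b ∷ α))

-- The inverse of S: the composition of n whose set is the given increasing
-- list of elements of {1, …, n-1}.

fromSet : ℕ → List ℕ → List ℕ
fromSet zero      ds = []
fromSet n@(suc _) ds = zipWith _∸_ (ds ++ [ n ]) (0 ∷ ds)

record Partition : Set where
  field
    parts      : List ℕ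
    positive   : All (0 <_) parts
    decreasing : Linked _≥_ parts

open Partition public

-- The i-th entry counting from 0, and 0 past the end.

nth : List ℕ → ℕ → ℕ
nth []       _       = 0
nth (a ∷ _)  zero    = a
nth (_ ∷ as) (suc i) = nth as i

part : Partition → ℕ → ℕ
part λ′ = nth (parts λ′)

-- Dominance, also between partitions of different sizes; `take k` of a shorter
-- list is the whole list, which amounts to padding by zeros.

infix 4 _⪯_

_⪯_ : Partition → Partition → Set
λ′ ⪯ μ′ = ∀ k → 1 ≤ k → k ≤ length (parts λ′) →
          sum (take k (parts λ′)) ≤ sum (take k (parts μ′))

≥-decTotalOrder : DecTotalOrder 0ℓ 0ℓ 0ℓ
≥-decTotalOrder = Flip.decTotalOrder ≤-decTotalOrder

sortedNonzero : List ℕ → Partition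
sortedNonzero as = record
  { parts      = sort ≥-decTotalOrder nonzero
  ; positive   = All-resp-↭ (↭-sym (sort-↭ ≥-decTotalOrder nonzero)) (all-filter (0 <?_) as)
  ; decreasing = sort-↗ ≥-decTotalOrder nonzero
  }
  where
  nonzero : List ℕ
  nonzero = filter (0 <?_) as

------------------------------------------------------------------------
-- Skew shapes.  Rows and columns are numbered from 0, with row 0 at the top.

record SkewShape : Set where
  field
    outer     : Partition
    inner     : Partition
    contained : ∀ i → part inner i ≤ part outer i

  numRows : ℕ
  numRows = length (parts outer)

  -- The columns occupied by row i: inner_i, …, outer_i - 1.
  columns : ℕ → List ℕ
  columns i = applyUpTo (part inner i +_) (part outer i ∸ part inner i)

  boxes : List (ℕ × ℕ)
  boxes = concatMap (λ i → map (i ,_) (columns i)) (upTo numRows)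

  size : ℕ
  size = length boxes

open SkewShape public

-- `overlaps A k i` is the number of columns common to rows i, …, i + k - 1
-- (for k ≥ 1); every occupied column is less than the length of the top row
-- of the outer partition.

overlaps : SkewShape → ℕ → ℕ → ℕ
overlaps A k i =
  length (filter (λ c → All.all? (λ j → _∈?_ _≟_ c (columns A (i + j))) (upTo k))
                 (upTo (part (outer A) 0)))

rows : ℕ → SkewShape → Partition
rows k A = sortedNonzero (map (overlaps A k) (upTo (suc (numRows A) ∸ k)))

IsRibbon : SkewShape → Set
IsRibbon A = ∀ i → suc i < numRows A → overlaps A 2 i ≡ 1

IsElongated : SkewShape → Set
IsElongated A = ∀ i → i < numRows A → 2 ≤ length (columns A i)

------------------------------------------------------------------------
-- Standard Young tableaux

-- A filling of the boxes of A by elements of {1, …, n}, where n = size A: the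
-- entries are listed in the order of `boxes A`, and an entry e is stored as
-- the element e - 1 of Fin n.

Filling : SkewShape → Set
Filling A = Vec (Fin (size A)) (size A)

module _ (A : SkewShape) where

  row col : Fin (size A) → ℕ
  row p = proj₁ (lookup (boxes A) p)
  col p = proj₂ (lookup (boxes A) p)

  entry : Filling A → Fin (size A) → ℕ
  entry T p = suc (toℕ (Vec.lookup T p))

  IsSYT : Filling A → Set
  IsSYT T = (∀ p q → entry T p ≡ entry T q → p ≡ q)
          × (∀ p q → row p ≡ row q → col p < col q → entry T p < entry T q)
          × (∀ p q → col p ≡ col q → row p < row q → entry T p < entry T q)

  isSYT? : ∀ T → Dec (IsSYT T)
  isSYT? T =
    all? (λ p → all? λ q → (entry T p ≟ entry T q) →-dec (p Fin.≟ q))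
    ×-dec
    all? (λ p → all? λ q →
      (row p ≟ row q) →-dec (col p <? col q) →-dec (entry T p <? entry T q))
    ×-dec
    all? (λ p → all? λ q →
      (col p ≟ col q) →-dec (row p <? row q) →-dec (entry T p <? entry T q))

  IsDescent : Filling A → ℕ → Set
  IsDescent T i = ∃[ p ] ∃[ q ] entry T p ≡ i × entry T q ≡ suc i × row p < row q

  isDescent? : ∀ T i → Dec (IsDescent T i)
  isDescent? T i =
    any? λ p → any? λ q → (entry T p ≟ i) ×-dec (entry T q ≟ suc i) ×-dec (row p <? row q)

  descents : Filling A → List ℕ
  descents T = filter (isDescent? T) (applyUpTo suc (size A ∸ 1))

  comp : Filling A → List ℕ
  comp T = fromSet (size A) (descents T)

allVecs : ∀ {X : Set} → List X → (m : ℕ) → List (Vec X m)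
allVecs xs zero    = [ Vec.[] ]
allVecs xs (suc m) = cartesianProductWith Vec._∷_ xs (allVecs xs m)

SYTs : (A : SkewShape) → List (Filling A)
SYTs A = filter (isSYT? A) (allVecs (allFin (size A)) (size A))

------------------------------------------------------------------------
-- Quasisymmetric functions

-- Formal power series in x₁, x₂, … with integer coefficients: the list
-- e₁ ∷ … ∷ eₘ ∷ [] stands for the monomial x₁^e₁ ⋯ xₘ^eₘ, and a series is
-- given by its coefficients.  The series below are insensitive to trailing
-- zeros in the exponent list.

Series : Set
Series = List ℕ → ℤ

infix 4 _≈_

_≈_ : Series → Series → Set
f ≈ g = ∀ e → f e ≡ g e

infixr 7 _·_

_·_ : ℤ → Series → Series
(c · f) e = c ℤ.* f e

∑ : {X : Set} → List X → (X → Series) → Series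
∑ xs f e = foldr ℤ._+_ 0ℤ (map (λ x → f x e) xs)

-- For a composition α, a monomial has the form x_{i₁}^α₁ ⋯ x_{iₖ}^αₖ with
-- i₁ < ⋯ < iₖ exactly when its nonzero exponents, in order, are α; the indices
-- are then unique, so each such monomial has coefficient 1 in M α.

M : List ℕ → Series
M α e = if does (≡-dec _≟_ (filter (0 <?_) e) α) then 1ℤ else 0ℤ

F : List ℕ → Series
F α = ∑ (filter (λ β → _⊆?_ _≟_ (S α) (S β)) (compositions (sum α))) M

s : SkewShape → Series
s A = ∑ (SYTs A) (λ T → F (comp A T))

-- The coefficients of s A in the basis of the F β are those of the (unique)
-- expansion of s A as a linear combination of them.

suppF : SkewShape → List ℕ → Set
suppF A α = α ∈ compositions (size A)
          × Σ[ c ∈ (List ℕ → ℤ) ]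
              (s A ≈ ∑ (compositions (size A)) (λ β → c β · F β)) × 0ℤ ℤ.< c α

{-# OPTIONS --safe #-}

-- A tableau of ribbon shape is encoded by the word w that sends each entry to
-- its row.  Such words have prescribed letter counts (the row lengths) and, for
-- each i, some letter i before some letter i + 1; descents of the tableau are
-- strict ascents of w.  By linear independence of the F_α, the F-support
-- consists of the ascent patterns of these words.  For elongated ribbons, the
-- conditions on rows_k say that A and B have equally many rows and that the
-- sorted row lengths of A are dominated by those of B.
--
-- If the supports are nested, two words for B are transferred to A.  One is a
-- concatenation of increasing blocks, the j-th block consisting of the rows of
-- length > j.  In the word of A with the same ascents each letter occurs at most
-- once per block, so Σ min(b_i, t) ≤ Σ min(a_i, t) for all t.  The other word
-- has a single ascent, before which the word of A must have used all letters
-- but the last.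
--
-- Conversely, a dominated sequence of row lengths arises by repeatedly
-- redistributing (x, y) between adjacent rows without decreasing the minimum.
-- On words, such a step changes letters i + 1 into i (or, after reversing and
-- complementing, the other way) one at a time.  The obstruction are the letters
-- i + 1 directly preceded by i, of which there are at most as many as letters i;
-- among the others a suitable one can be changed, except in one configuration,
-- where two further letters i + 1 and i + 2 have to be exchanged as well.

module Submission where

open import Defs
open import Data.Nat using (ℕ; _≤_)
open import Function.Bundles using (_⇔_)
open import Relation.Binary.PropositionalEquality using (_≡_)
open import Relation.Unary using (_⊇_)

open import Data.Nat
open import Data.Nat.Induction using (<-rec; <-wellFounded)
open import Data.Nat.ListAction using (sum)
open import Data.Nat.ListAction.Properties using (sum-++; sum-↭)
open import Data.Nat.Properties
open import Data.Integer as ℤ using (ℤ; 0ℤ; 1ℤ)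
import Data.Integer.Properties as ℤ
open import Algebra.Properties.AbelianGroup ℤ.+-0-abelianGroup using (∙-cancelˡ; ∙-cancelʳ)
open import Algebra.Properties.CommutativeMonoid.Sum +-0-commutativeMonoid
  using (sum-permute; sum-cong-≗) renaming (sum to ∑Fin)
open import Algebra.Properties.CommutativeSemigroup +-commutativeSemigroup
  using () renaming (interchange to +-interchange)
open import Algebra.Properties.CommutativeSemigroup ℤ.+-commutativeSemigroup using (interchange)
open import Data.Bool using (if_then_else_)
open import Data.Fin as Fin using (Fin; toℕ; fromℕ<)
open import Data.Fin.Permutation using (permutation)
open import Data.Fin.Properties
  using (any?; toℕ<n; toℕ-fromℕ<; fromℕ<-toℕ; toℕ-injective; punchOut-injective; injective⇒≤)
open import Data.List
  using (List; []; _∷_; [_]; _++_; length; take; map; concatMap; filter; foldr; lookup; replicate;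
         upTo; applyUpTo; allFin; zipWith)
open import Data.List.Membership.DecPropositional using (_∈?_)
open import Data.List.Membership.Propositional using (_∈_)
open import Data.List.Membership.Propositional.Properties
open import Data.List.Properties hiding (sum-++)
open import Data.List.Relation.Binary.Permutation.Propositional as Perm using (_↭_; ↭-sym)
open import Data.List.Relation.Binary.Permutation.Propositional.Properties
  using (All-resp-↭; ↭-length; ↭-empty-inv; map⁺)
open import Data.List.Relation.Binary.Subset.DecPropositional using (_⊆?_)
open import Data.List.Relation.Binary.Subset.Propositional using (_⊆_)
open import Data.List.Relation.Unary.All as All using (All; []; _∷_)
import Data.List.Relation.Unary.All.Properties as All
open import Data.List.Relation.Unary.AllPairs as AllPairs using (AllPairs; []; _∷_)
import Data.List.Relation.Unary.AllPairs.Properties as AllPairs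
open import Data.List.Relation.Unary.Any as Any using (Any; here; there)
import Data.List.Relation.Unary.Any.Properties as Any
open import Data.List.Relation.Unary.Linked using (Linked; []; [-]; _∷_)
open import Data.List.Relation.Unary.Linked.Properties using (Linked⇒AllPairs)
open import Data.List.Relation.Unary.Unique.Propositional using (Unique)
import Data.List.Relation.Unary.Unique.Propositional.Properties as Unique
open import Data.List.Sort using (sort-↭)
open import Data.Product using (_×_; _,_; proj₁; proj₂; ∃-syntax)
open import Data.Sum using (_⊎_; inj₁; inj₂)
open import Data.Unit using (⊤; tt)
open import Data.Vec as Vec using (Vec)
open import Data.Vec.Properties using (lookup∘tabulate)
open import Function using (_∘_; id; flip; Injective; mk⇔)
open import Induction.WellFounded using (Acc; acc)
open import Relation.Binary.Construct.Closure.ReflexiveTransitive using (Star; ε; _◅_; _◅◅_; gmap)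
open import Relation.Binary.Definitions using (tri<; tri≈; tri>)
open import Relation.Binary.PropositionalEquality hiding ([_])
open import Relation.Nullary using (Dec; yes; no; ¬_; does; contradiction; ¬?; _×-dec_)
open import Relation.Nullary.Decidable using (dec-true; dec-false)
open import Relation.Unary using (Decidable)

-- Sums over initial segments of ℕ

-- Lowering a letter `y` to `x` is difficult because ascents are local but links are not: the `y`
-- removed may be the only one after an `x`, or the only one before a `z = y + 1`. Rows of length at
-- least two provide the room. The new row lengths are again at least two, so a `y` that still has
-- to be lowered has at least two companions, and the first and the last `y` can guard the links. A
-- second `z` is likewise available when the exchange takes the last one away. The same hypothesis
-- keeps a column from meeting three rows, so that a word needs only one link for each pair of
-- adjacent rows. For the other implication, the sums Σ min(b_i, t) are the partial sums of the
-- conjugate partition. Instead of conjugating, one subtracts them from the common size; the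
-- resulting excesses Σ max(b_i - t, 0) bound the partial sums of the row lengths directly. Rows are
-- compared from two sides: equal sizes and `rows 1` give A at least as many rows as B, and
-- `rows 2`, which consists of r - 1 ones, gives the converse up to the ambiguity between r = 0 and
-- r = 1.

∑< : ℕ → (ℕ → ℕ) → ℕ
∑< zero    f = 0
∑< (suc n) f = f 0 + ∑< n (f ∘ suc)

∑<-cong : ∀ n {f g : ℕ → ℕ} → (∀ p → p < n → f p ≡ g p) → ∑< n f ≡ ∑< n g
∑<-cong zero    f≡g = refl
∑<-cong (suc n) f≡g = cong₂ _+_ (f≡g 0 z<s) (∑<-cong n λ p p<n → f≡g (suc p) (s<s p<n))

∑<-mono : ∀ n {f g : ℕ → ℕ} → (∀ p → p < n → f p ≤ g p) → ∑< n f ≤ ∑< n g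
∑<-mono zero    f≤g = z≤n
∑<-mono (suc n) f≤g = +-mono-≤ (f≤g 0 z<s) (∑<-mono n λ p p<n → f≤g (suc p) (s<s p<n))

∑<-distrib-+ : ∀ n f g → ∑< n (λ p → f p + g p) ≡ ∑< n f + ∑< n g
∑<-distrib-+ zero    f g = refl
∑<-distrib-+ (suc n) f g =
  trans (cong (f 0 + g 0 +_) (∑<-distrib-+ n (f ∘ suc) (g ∘ suc))) (+-interchange (f 0) (g 0) _ _)

∑<-zero : ∀ n → ∑< n (λ _ → 0) ≡ 0
∑<-zero zero    = refl
∑<-zero (suc n) = ∑<-zero n

∑<-swap : ∀ m n (f : ℕ → ℕ → ℕ) →
          ∑< m (λ i → ∑< n (f i)) ≡ ∑< n (λ j → ∑< m (λ i → f i j))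
∑<-swap zero    n f = sym (∑<-zero n)
∑<-swap (suc m) n f =
  trans (cong (∑< n (f 0) +_) (∑<-swap m n (f ∘ suc)))
        (sym (∑<-distrib-+ n (f 0) (λ j → ∑< m (λ i → f (suc i) j))))

∑<-+ : ∀ m n f → ∑< (m + n) f ≡ ∑< m f + ∑< n (λ p → f (m + p))
∑<-+ zero    n f = refl
∑<-+ (suc m) n f = trans (cong (f 0 +_) (∑<-+ m n (f ∘ suc))) (sym (+-assoc (f 0) _ _))

∑<-last : ∀ n f → ∑< (suc n) f ≡ ∑< n f + f n
∑<-last n f = begin
  ∑< (suc n) f                  ≡⟨ cong (λ k → ∑< k f) (+-comm 1 n) ⟩
  ∑< (n + 1) f                  ≡⟨ ∑<-+ n 1 f ⟩
  ∑< n f + (f (n + 0) + 0)      ≡⟨ cong (∑< n f +_) (+-identityʳ _) ⟩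
  ∑< n f + f (n + 0)            ≡⟨ cong (λ k → ∑< n f + f k) (+-identityʳ n) ⟩
  ∑< n f + f n                  ∎
  where open ≡-Reasoning

∑<-reverse : ∀ n f → ∑< n (λ p → f (n ∸ suc p)) ≡ ∑< n f
∑<-reverse zero    f = refl
∑<-reverse (suc n) f =
  trans (cong (f n +_) (∑<-reverse n f)) (trans (+-comm (f n) _) (sym (∑<-last n f)))

-- Each side receives the term that the other sum contains, so that no truncated subtraction is
-- involved.
∑<-replace : ∀ n {f g : ℕ → ℕ} p → p < n → (∀ k → k < n → k ≢ p → f k ≡ g k) →
             ∑< n f + g p ≡ ∑< n g + f p
∑<-replace (suc n) {f} {g} zero p<n f≡g = begin
  f 0 + ∑< n (f ∘ suc) + g 0   ≡⟨ cong (λ s → f 0 + s + g 0) (∑<-cong n λ k k<n → f≡g (suc k) (s<s k<n) λ ()) ⟩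
  f 0 + ∑< n (g ∘ suc) + g 0   ≡⟨ +-comm _ (g 0) ⟩
  g 0 + (f 0 + ∑< n (g ∘ suc)) ≡⟨ cong (g 0 +_) (+-comm (f 0) _) ⟩
  g 0 + (∑< n (g ∘ suc) + f 0) ≡⟨ sym (+-assoc (g 0) _ (f 0)) ⟩
  g 0 + ∑< n (g ∘ suc) + f 0   ∎
  where open ≡-Reasoning
∑<-replace (suc n) {f} {g} (suc p) p<n f≡g = begin
  f 0 + ∑< n (f ∘ suc) + g (suc p)   ≡⟨ +-assoc (f 0) _ _ ⟩
  f 0 + (∑< n (f ∘ suc) + g (suc p)) ≡⟨ cong₂ _+_ (f≡g 0 z<s λ ())
                                         (∑<-replace n p (s<s⁻¹ p<n) λ k k<n k≢p → f≡g (suc k) (s<s k<n) (k≢p ∘ suc-injective)) ⟩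
  g 0 + (∑< n (g ∘ suc) + f (suc p)) ≡⟨ sym (+-assoc (g 0) _ _) ⟩
  g 0 + ∑< n (g ∘ suc) + f (suc p)   ∎
  where open ≡-Reasoning

term≤∑< : ∀ n f p → p < n → f p ≤ ∑< n f
term≤∑< (suc n) f zero    p<n = m≤m+n _ _
term≤∑< (suc n) f (suc p) p<n = ≤-trans (term≤∑< n (f ∘ suc) p (s<s⁻¹ p<n)) (m≤n+m _ _)

-- Letter counts and changes of a single letter

δ : ℕ → ℕ → ℕ
δ a b = if does (a ≟ b) then 1 else 0

δ-≡ : ∀ {a b} → a ≡ b → δ a b ≡ 1
δ-≡ {a} {b} a≡b = cong (if_then 1 else 0) (dec-true (a ≟ b) a≡b)

δ-≢ : ∀ {a b} → a ≢ b → δ a b ≡ 0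
δ-≢ {a} {b} a≢b = cong (if_then 1 else 0) (dec-false (a ≟ b) a≢b)

δ-refl : ∀ a → δ a a ≡ 1
δ-refl a = δ-≡ {a} refl

δ≤1 : ∀ a b → δ a b ≤ 1
δ≤1 a b with a ≟ b
... | yes a≡b = ≤-reflexive (δ-≡ a≡b)
... | no  a≢b = ≤-trans (≤-reflexive (δ-≢ a≢b)) z≤n

∑<-δ : ∀ n p → p < n → ∑< n (λ q → δ q p) ≡ 1
∑<-δ n p p<n = begin
  ∑< n (λ q → δ q p)     ≡⟨ sym (+-identityʳ _) ⟩
  ∑< n (λ q → δ q p) + 0 ≡⟨ ∑<-replace n {g = λ _ → 0} p p<n (λ k _ k≢p → δ-≢ k≢p) ⟩
  ∑< n (λ _ → 0) + δ p p ≡⟨ cong₂ _+_ (∑<-zero n) (δ-refl p) ⟩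
  1                      ∎
  where open ≡-Reasoning

cnt : (ℕ → ℕ) → ℕ → ℕ → ℕ
cnt w v n = ∑< n (λ p → δ (w p) v)

abstract
  cnt-pos : ∀ w v n → 0 < cnt w v n → ∃[ p ] p < n × w p ≡ v
  cnt-pos w v (suc n) pos with w 0 ≟ v
  ... | yes w0≡v = 0 , z<s , w0≡v
  ... | no w0≢v with cnt-pos (w ∘ suc) v n (subst (λ d → 0 < d + cnt (w ∘ suc) v n) (δ-≢ w0≢v) pos)
  ...   | p , p<n , eq = suc p , s<s p<n , eq

cnt-pos⁻ : ∀ w v n p → p < n → w p ≡ v → 0 < cnt w v n
cnt-pos⁻ w v n p p<n eq = subst (_≤ cnt w v n) (δ-≡ eq) (term≤∑< n (λ q → δ (w q) v) p p<n)

infixl 8 _[_≔_]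
_[_≔_] : (ℕ → ℕ) → ℕ → ℕ → (ℕ → ℕ)
(w [ p ≔ v ]) k = if does (k ≟ p) then v else w k

≔-here : ∀ w p v → (w [ p ≔ v ]) p ≡ v
≔-here w p v = cong (if_then v else w p) (dec-true (p ≟ p) refl)

≔-there : ∀ w {p k} v → k ≢ p → (w [ p ≔ v ]) k ≡ w k
≔-there w {p} {k} v k≢p = cong (if_then v else w k) (dec-false (k ≟ p) k≢p)

cnt-≔ : ∀ w n p v u → p < n → cnt (w [ p ≔ v ]) u n + δ (w p) u ≡ cnt w u n + δ v u
cnt-≔ w n p v u p<n =
  trans (∑<-replace n p p<n (λ k _ k≢p → cong (λ a → δ a u) (≔-there w v k≢p)))
        (cong (λ a → cnt w u n + δ a u) (≔-here w p v))

cnt-≔-other : ∀ w n p v u → p < n → w p ≢ u → v ≢ u → cnt (w [ p ≔ v ]) u n ≡ cnt w u n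
cnt-≔-other w n p v u p<n wp≢u v≢u = begin
  cnt (w [ p ≔ v ]) u n              ≡⟨ sym (+-identityʳ _) ⟩
  cnt (w [ p ≔ v ]) u n + 0          ≡⟨ cong (cnt (w [ p ≔ v ]) u n +_) (sym (δ-≢ wp≢u)) ⟩
  cnt (w [ p ≔ v ]) u n + δ (w p) u  ≡⟨ cnt-≔ w n p v u p<n ⟩
  cnt w u n + δ v u                  ≡⟨ cong (cnt w u n +_) (δ-≢ v≢u) ⟩
  cnt w u n + 0                      ≡⟨ +-identityʳ _ ⟩
  cnt w u n                          ∎
  where open ≡-Reasoning

cnt-≔-old : ∀ w n p v u → p < n → w p ≡ u → v ≢ u → suc (cnt (w [ p ≔ v ]) u n) ≡ cnt w u n
cnt-≔-old w n p v u p<n wp≡u v≢u = begin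
  1 + cnt (w [ p ≔ v ]) u n          ≡⟨ +-comm 1 _ ⟩
  cnt (w [ p ≔ v ]) u n + 1          ≡⟨ cong (cnt (w [ p ≔ v ]) u n +_) (sym (δ-≡ wp≡u)) ⟩
  cnt (w [ p ≔ v ]) u n + δ (w p) u  ≡⟨ cnt-≔ w n p v u p<n ⟩
  cnt w u n + δ v u                  ≡⟨ cong (cnt w u n +_) (δ-≢ v≢u) ⟩
  cnt w u n + 0                      ≡⟨ +-identityʳ _ ⟩
  cnt w u n                          ∎
  where open ≡-Reasoning

cnt-≔-new : ∀ w n p v → p < n → w p ≢ v → cnt (w [ p ≔ v ]) v n ≡ suc (cnt w v n)
cnt-≔-new w n p v p<n wp≢v = begin
  cnt (w [ p ≔ v ]) v n              ≡⟨ sym (+-identityʳ _) ⟩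
  cnt (w [ p ≔ v ]) v n + 0          ≡⟨ cong (cnt (w [ p ≔ v ]) v n +_) (sym (δ-≢ wp≢v)) ⟩
  cnt (w [ p ≔ v ]) v n + δ (w p) v  ≡⟨ cnt-≔ w n p v v p<n ⟩
  cnt w v n + δ v v                  ≡⟨ cong (cnt w v n +_) (δ-refl v) ⟩
  cnt w v n + 1                      ≡⟨ +-comm _ 1 ⟩
  suc (cnt w v n)                    ∎
  where open ≡-Reasoning

-- Extremal elements of decidable sets of positions

module _ {P : ℕ → Set} (P? : Decidable P) where

  abstract
    greatest : ∀ n → (∃[ p ] p < n × P p) →
               ∃[ g ] g < n × P g × (∀ q → q < n → P q → q ≤ g)
    greatest (suc n) (p , p<1+n , Pp) with P? n
    ... | yes Pn = n , ≤-refl , Pn , λ q q<1+n _ → s≤s⁻¹ q<1+n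
    ... | no ¬Pn with greatest n (p , ≤∧≢⇒< (s≤s⁻¹ p<1+n) (λ { refl → ¬Pn Pp }) , Pp)
    ...   | g , g<n , Pg , max = g , m<n⇒m<1+n g<n , Pg ,
              λ q q<1+n Pq → max q (≤∧≢⇒< (s≤s⁻¹ q<1+n) (λ { refl → ¬Pn Pq })) Pq

    least : ∀ p → P p → ∃[ m ] m ≤ p × P m × (∀ q → P q → m ≤ q)
    least p = <-rec (λ p → P p → ∃[ m ] m ≤ p × P m × (∀ q → P q → m ≤ q)) step p
      where
      step : ∀ p → (∀ {q} → q < p → P q → ∃[ m ] m ≤ q × P m × (∀ q → P q → m ≤ q)) →
             P p → ∃[ m ] m ≤ p × P m × (∀ q → P q → m ≤ q)
      step p rec Pp with anyUpTo? P? p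
      ... | no ¬∃ = p , ≤-refl , Pp , λ q Pq → ≮⇒≥ λ q<p → ¬∃ (q , q<p , Pq)
      ... | yes (q , q<p , Pq) with rec q<p Pq
      ...   | m , m≤q , Pm , min = m , ≤-trans m≤q (<⇒≤ q<p) , Pm , min

-- Words of ribbon tableaux

SameAsc : ℕ → (ℕ → ℕ) → (ℕ → ℕ) → Set
SameAsc n w w′ = ∀ p → suc p < n →
  (w p < w (suc p) → w′ p < w′ (suc p)) × (w′ p < w′ (suc p) → w p < w (suc p))

sameAsc-trans : ∀ {n w w′ w″} → SameAsc n w w′ → SameAsc n w′ w″ → SameAsc n w w″
sameAsc-trans s t p p<n =
  proj₁ (t p p<n) ∘ proj₁ (s p p<n) , proj₂ (s p p<n) ∘ proj₂ (t p p<n)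

Before : ℕ → (ℕ → ℕ) → ℕ → ℕ → Set
Before n w x y = ∃[ p ] ∃[ q ] p < q × q < n × w p ≡ x × w q ≡ y

-- The letter w p is the row, counted from the top, of the entry p + 1 of a
-- tableau; `linked` says that the column shared by rows i and i + 1 increases.
record RibbonWord (r n : ℕ) (w : ℕ → ℕ) : Set where
  field
    bounded : ∀ p → p < n → w p < r
    linked  : ∀ i → suc i < r → Before n w i (suc i)

open RibbonWord public

-- An occurrence of suc x directly preceded by x is forced: lowering it to x
-- would destroy an ascent.
PrevNot : (ℕ → ℕ) → ℕ → ℕ → Set
PrevNot w x zero    = ⊤
PrevNot w x (suc k) = w k ≢ x

prevNot? : ∀ w x → Decidable (PrevNot w x)
prevNot? w x zero    = yes tt
prevNot? w x (suc k) = ¬? (w k ≟ x)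

sameAsc-≔ : ∀ w n p v →
  (∀ k → suc k ≡ p → (w k < w p → w k < v) × (w k < v → w k < w p)) →
  (suc p < n → (w p < w (suc p) → v < w (suc p)) × (v < w (suc p) → w p < w (suc p))) →
  SameAsc n w (w [ p ≔ v ])
sameAsc-≔ w n p v prev next k k<n with k ≟ p | suc k ≟ p
... | yes refl | _
  rewrite ≔-here w k v | ≔-there w {k} {suc k} v 1+n≢n = next k<n
... | no k≢p | yes refl
  rewrite ≔-here w (suc k) v | ≔-there w {suc k} {k} v k≢p = prev k refl
... | no k≢p | no 1+k≢p
  rewrite ≔-there w {p} {k} v k≢p | ≔-there w {p} {suc k} v 1+k≢p = id , id

-- Only the comparisons with the two neighbours are at stake. A left neighbour distinguishes `suc x`
-- from `x` only if it equals `x`, a right neighbour only if it equals `suc x`.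
sameAsc-lower : ∀ w n p x → w p ≡ suc x → PrevNot w x p → (suc p < n → w (suc p) ≢ suc x) →
                SameAsc n w (w [ p ≔ x ])
sameAsc-lower w n p x wp≡ prev next = sameAsc-≔ w n p x
  (λ { k refl → (λ lt → ≤∧≢⇒< (s≤s⁻¹ (subst (w k <_) wp≡ lt)) prev)
              , (λ lt → subst (w k <_) (sym wp≡) (m<n⇒m<1+n lt)) })
  (λ p<n → (λ lt → <-trans ≤-refl (subst (_< w (suc p)) wp≡ lt))
         , (λ lt → subst (_< w (suc p)) (sym wp≡) (≤∧≢⇒< lt (next p<n ∘ sym))))

sameAsc-raise : ∀ w n p y → w p ≡ y → PrevNot w y p → (suc p < n → w (suc p) ≢ suc y) →
                SameAsc n w (w [ p ≔ suc y ])
sameAsc-raise w n p y wp≡ prev next = sameAsc-≔ w n p (suc y)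
  (λ { k refl → (λ lt → m<n⇒m<1+n (subst (w k <_) wp≡ lt))
              , (λ lt → subst (w k <_) (sym wp≡) (≤∧≢⇒< (s≤s⁻¹ lt) prev)) })
  (λ p<n → (λ lt → ≤∧≢⇒< (subst (_< w (suc p)) wp≡ lt) (next p<n ∘ sym))
         , (λ lt → subst (_< w (suc p)) (sym wp≡) (<-trans ≤-refl lt)))

-- Forced and free letters, and lowering one letter

forcedAt : (ℕ → ℕ) → ℕ → ℕ → ℕ
forcedAt w x zero    = 0
forcedAt w x (suc k) = δ (w k) x * δ (w (suc k)) (suc x)

forced : (ℕ → ℕ) → ℕ → ℕ → ℕ
forced w x n = ∑< n (forcedAt w x)

forcedAt≤upper : ∀ w x q → forcedAt w x q ≤ δ (w q) (suc x)
forcedAt≤upper w x zero    = z≤n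
forcedAt≤upper w x (suc k) =
  ≤-trans (*-monoˡ-≤ _ (δ≤1 (w k) x)) (≤-reflexive (*-identityˡ _))

-- A letter `x` has only one right neighbour, so it forces at most one `suc x`.
forced≤lower : ∀ w x n → forced w x n ≤ cnt w x n
forced≤lower w x zero    = z≤n
forced≤lower w x (suc m) = begin
  ∑< m (λ k → δ (w k) x * δ (w (suc k)) (suc x))
    ≤⟨ ∑<-mono m (λ k _ → ≤-trans (*-monoʳ-≤ (δ (w k) x) (δ≤1 (w (suc k)) (suc x)))
                                  (≤-reflexive (*-identityʳ _))) ⟩
  cnt w x m                  ≤⟨ m≤m+n _ _ ⟩
  cnt w x m + δ (w m) x      ≡⟨ ∑<-last m (λ k → δ (w k) x) ⟨
  cnt w x (suc m)            ∎
  where open ≤-Reasoning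

Free : (ℕ → ℕ) → ℕ → ℕ → Set
Free w x q = w q ≡ suc x × PrevNot w x q

free? : ∀ w x → Decidable (Free w x)
free? w x q = (w q ≟ suc x) ×-dec prevNot? w x q

forcedAt-1 : ∀ w x q → w q ≡ suc x → ¬ PrevNot w x q → forcedAt w x q ≡ 1
forcedAt-1 w x zero    eq ¬prev = contradiction tt ¬prev
forcedAt-1 w x (suc k) eq ¬prev with w k ≟ x
... | yes wk≡x = cong₂ _*_ (δ-≡ wk≡x) (δ-≡ eq)
... | no  wk≢x = contradiction wk≢x ¬prev

upper≤forcedAt : ∀ w x q → (w q ≡ suc x → ¬ PrevNot w x q) → δ (w q) (suc x) ≤ forcedAt w x q
upper≤forcedAt w x q ¬free with w q ≟ suc x
... | yes eq = ≤-reflexive (trans (δ-≡ eq) (sym (forcedAt-1 w x q eq (¬free eq))))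
... | no neq = ≤-trans (≤-reflexive (δ-≢ neq)) z≤n

abstract
  free-exists : ∀ w x n → forced w x n < cnt w (suc x) n → ∃[ q ] q < n × Free w x q
  free-exists w x n lt with anyUpTo? (free? w x) n
  ... | yes found = found
  ... | no none = contradiction lt (≤⇒≯ (∑<-mono n λ q q<n →
                    upper≤forcedAt w x q λ eq prev → none (q , q<n , eq , prev)))

abstract
  -- Otherwise all occurrences of `v` lie in {f, l}, and their number is at most 2.
  third-occurrence : ∀ w v n f l → 3 ≤ cnt w v n →
    (∀ q → q < n → w q ≡ v → f ≤ q) → (∀ q → q < n → w q ≡ v → q ≤ l) → f < n → l < n →
    ∃[ m ] f < m × m < l × w m ≡ v
  third-occurrence w v n f l 3≤ first last f<n l<n
    with anyUpTo? (λ m → (f <? m) ×-dec (w m ≟ v)) l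
  ... | yes (m , m<l , f<m , eq) = m , f<m , m<l , eq
  ... | no none = contradiction 3≤ (<⇒≱ (s≤s (begin
    cnt w v n                             ≤⟨ ∑<-mono n pointwise ⟩
    ∑< n (λ q → δ q f + δ q l)            ≡⟨ ∑<-distrib-+ n (λ q → δ q f) (λ q → δ q l) ⟩
    ∑< n (λ q → δ q f) + ∑< n (λ q → δ q l) ≡⟨ cong₂ _+_ (∑<-δ n f f<n) (∑<-δ n l l<n) ⟩
    2                                     ∎)))
    where
    open ≤-Reasoning
    pointwise : ∀ q → q < n → δ (w q) v ≤ δ q f + δ q l
    pointwise q q<n with w q ≟ v
    ... | no neq = ≤-trans (≤-reflexive (δ-≢ neq)) z≤n
    ... | yes eq with q ≟ f | q ≟ l
    ...   | yes q≡f | _       = ≤-trans (δ≤1 (w q) v) (≤-trans (≤-reflexive (sym (δ-≡ q≡f))) (m≤m+n _ _))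
    ...   | no _    | yes q≡l = ≤-trans (δ≤1 (w q) v) (≤-trans (≤-reflexive (sym (δ-≡ q≡l))) (m≤n+m _ _))
    ...   | no q≢f  | no q≢l  = contradiction
            (q , ≤∧≢⇒< (last q q<n eq) q≢l , ≤∧≢⇒< (first q q<n eq) (q≢f ∘ sym) , eq) none

-- The field `forced-≤` is what allows iteration: the number of forced letters stays below the
-- target for the count of `suc x`.
record Lowered (r n : ℕ) (w : ℕ → ℕ) (x : ℕ) (w′ : ℕ → ℕ) : Set where
  field
    same      : SameAsc n w w′
    word      : RibbonWord r n w′
    cnt-upper : suc (cnt w′ (suc x) n) ≡ cnt w (suc x) n
    cnt-lower : cnt w′ x n ≡ suc (cnt w x n)
    cnt-other : ∀ v → v ≢ x → v ≢ suc x → cnt w′ v n ≡ cnt w v n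
    forced-≤  : forced w′ x n ≤ forced w x n

-- A pair ending in `p` loses its upper letter, and the new `x` at `p` starts no pair because
-- `suc x` does not follow.
forced-lower : ∀ w x n p → w p ≡ suc x → (suc p < n → w (suc p) ≢ suc x) →
               forced (w [ p ≔ x ]) x n ≤ forced w x n
forced-lower w x n p wp≡ next = ∑<-mono n pointwise
  where
  pointwise : ∀ q → q < n → forcedAt (w [ p ≔ x ]) x q ≤ forcedAt w x q
  pointwise zero    q<n = z≤n
  pointwise (suc k) q<n with suc k ≟ p
  ... | yes refl rewrite ≔-here w (suc k) x | δ-≢ {x} {suc x} (1+n≢n ∘ sym)
                       | *-zeroʳ (δ ((w [ suc k ≔ x ]) k) x) = z≤n
  ... | no 1+k≢p with k ≟ p
  ...   | yes refl rewrite ≔-there w {k} {suc k} x 1+k≢p | δ-≢ (next q<n)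
                         | *-zeroʳ (δ ((w [ k ≔ x ]) k) x) = z≤n
  ...   | no k≢p rewrite ≔-there w {p} {k} x k≢p | ≔-there w {p} {suc k} x 1+k≢p = ≤-refl

module _ {r n : ℕ} {w : ℕ → ℕ} (W : RibbonWord r n w) {x : ℕ} (y<r : suc x < r) where

  private
    y z : ℕ
    y = suc x
    z = suc y

  -- Only the links from `x` to `y` and from `y` to `z` can break. The witnesses of any other link
  -- carry letters different from `y`, hence avoid `p`.
  lower-one : ∀ p → p < n → w p ≡ y → PrevNot w x p → (suc p < n → w (suc p) ≢ y) →
              Before n (w [ p ≔ x ]) x y → (z < r → Before n (w [ p ≔ x ]) y z) →
              Lowered r n w x (w [ p ≔ x ])
  lower-one p p<n wp≡y prev next xy yz = record
    { same      = sameAsc-lower w n p x wp≡y prev next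
    ; word      = record { bounded = bounded′ ; linked = linked′ }
    ; cnt-upper = cnt-≔-old w n p x y p<n wp≡y (1+n≢n ∘ sym)
    ; cnt-lower = cnt-≔-new w n p x p<n (λ eq → 1+n≢n (trans (sym wp≡y) eq))
    ; cnt-other = λ v v≢x v≢y → cnt-≔-other w n p x v p<n (λ eq → v≢y (trans (sym eq) wp≡y)) (v≢x ∘ sym)
    ; forced-≤  = forced-lower w x n p wp≡y next
    }
    where
    w′ = w [ p ≔ x ]
    bounded′ : ∀ q → q < n → w′ q < r
    bounded′ q q<n with q ≟ p
    ... | yes refl = subst (_< r) (sym (≔-here w q x)) (<-trans ≤-refl y<r)
    ... | no q≢p   = subst (_< r) (sym (≔-there w x q≢p)) (bounded W q q<n)
    linked′ : ∀ i → suc i < r → Before n w′ i (suc i)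
    linked′ i 1+i<r with i ≟ x | i ≟ y
    ... | yes refl | _ = xy
    ... | no _ | yes refl = yz 1+i<r
    ... | no i≢x | no i≢y with linked W i 1+i<r
    ...   | a , b , a<b , b<n , wa , wb = a , b , a<b , b<n
            , trans (≔-there w x (λ { refl → i≢y (trans (sym wa) wp≡y) })) wa
            , trans (≔-there w x (λ { refl → i≢x (suc-injective (trans (sym wb) wp≡y)) })) wb

  private
    keep-z : ∀ {p} a b → w p ≡ y → a ≢ p → a < b → b < n → w a ≡ y → w b ≡ z →
             Before n (w [ p ≔ x ]) y z
    keep-z a b wp a≢p a<b b<n wa wb = a , b , a<b , b<n , trans (≔-there w x a≢p) wa
      , trans (≔-there w x (λ { refl → 1+n≢n (trans (sym wb) wp) })) wb

  module _ (three : 3 ≤ cnt w y n) (twice : ∀ v → v < r → 2 ≤ cnt w v n)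
           (unforced : forced w x n < cnt w y n) where

    private
      is-y? : Decidable (λ p → p < n × w p ≡ y)
      is-y? p = (p <? n) ×-dec (w p ≟ y)

      some-y : ∃[ p ] p < n × w p ≡ y
      some-y = cnt-pos w y n (≤-trans (s≤s z≤n) three)

      first-y : ∃[ f ] f ≤ _ × (f < n × w f ≡ y) × (∀ q → (q < n × w q ≡ y) → f ≤ q)
      first-y = least is-y? (proj₁ some-y) (proj₂ some-y)

      f : ℕ
      f = proj₁ first-y
      f<n : f < n
      f<n = proj₁ (proj₁ (proj₂ (proj₂ first-y)))
      wf : w f ≡ y
      wf = proj₂ (proj₁ (proj₂ (proj₂ first-y)))
      f-min : ∀ q → q < n → w q ≡ y → f ≤ q
      f-min q q<n wq = proj₂ (proj₂ (proj₂ first-y)) q (q<n , wq)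

      last-y : ∃[ l ] l < n × w l ≡ y × (∀ q → q < n → w q ≡ y → q ≤ l)
      last-y = greatest (λ p → w p ≟ y) n some-y

      l : ℕ
      l = proj₁ last-y
      l<n : l < n
      l<n = proj₁ (proj₂ last-y)
      wl : w l ≡ y
      wl = proj₁ (proj₂ (proj₂ last-y))
      l-max : ∀ q → q < n → w q ≡ y → q ≤ l
      l-max = proj₂ (proj₂ (proj₂ last-y))

      middle-y : ∃[ m ] f < m × m < l × w m ≡ y
      middle-y = third-occurrence w y n f l three f-min l-max f<n l<n

      f<l : f < l
      f<l = <-trans (proj₁ (proj₂ middle-y)) (proj₁ (proj₂ (proj₂ middle-y)))

      -- The first `y` can replace the `y` of any link to `z`, since it stands no later.
      keep-f : ∀ {p} → w p ≡ y → f < p → z < r → Before n (w [ p ≔ x ]) y z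
      keep-f wp f<p z<r with linked W y z<r
      ... | a , b , a<b , b<n , wa , wb =
        keep-z f b wp (<⇒≢ f<p) (≤-<-trans (f-min a (<-trans a<b b<n) wa) a<b) b<n wf wb

      -- The letter just lowered and the last `y` form the new link from `x` to `y`.
      lower-strict : ∀ p → p < l → w p ≡ y → PrevNot w x p → (suc p < n → w (suc p) ≢ y) →
                     (z < r → Before n (w [ p ≔ x ]) y z) → Lowered r n w x (w [ p ≔ x ])
      lower-strict p p<l wp prev next yz = lower-one p (<-trans p<l l<n) wp prev next
        (p , l , p<l , l<n , ≔-here w p x , trans (≔-there w x (<⇒≢ p<l ∘ sym)) wl) yz

      -- The last `y` can be lowered if some earlier `y` has an `x` anywhere before it. If none has,
      -- the last `y` before `l` is free as well and is lowered instead, with `l` completing the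
      -- link.
      lower-last-free : PrevNot w x l → ∃[ w′ ] Lowered r n w x w′
      lower-last-free prev-l with anyUpTo? (λ v → (w v ≟ y) ×-dec anyUpTo? (λ u → w u ≟ x) v) l
      ... | yes (v , v<l , wv , u , u<v , wu) =
        _ , lower-one l l<n wl prev-l (λ l+1<n eq → 1+n≰n (l-max (suc l) l+1<n eq))
              (u , v , u<v , <-trans v<l l<n
                , trans (≔-there w x (<⇒≢ (<-trans u<v v<l))) wu
                , trans (≔-there w x (<⇒≢ v<l)) wv)
              (keep-f wl f<l)
      ... | no none = _ , lower-strict g g<l wg prev-g next-g (keep-f wg f<g)
        where
        last′ : ∃[ g ] g < l × w g ≡ y × (∀ q → q < l → w q ≡ y → q ≤ g)
        last′ = greatest (λ p → w p ≟ y) l (f , f<l , wf)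
        g = proj₁ last′
        g<l = proj₁ (proj₂ last′)
        wg = proj₁ (proj₂ (proj₂ last′))
        f<g : f < g
        f<g = let m , f<m , m<l , wm = middle-y in
              <-≤-trans f<m (proj₂ (proj₂ (proj₂ last′)) m m<l wm)
        prev-g : PrevNot w x g
        prev-g with g | g<l | wg
        ... | zero  | _ | _ = tt
        ... | suc k | lt | eq = λ wk≡x → none (suc k , lt , eq , k , ≤-refl , wk≡x)
        next-g : suc g < n → w (suc g) ≢ y
        next-g _ eq with m≤n⇒m<n∨m≡n g<l
        ... | inj₁ g+1<l = 1+n≰n (proj₂ (proj₂ (proj₂ last′)) (suc g) g+1<l eq)
        -- If `l` directly followed `g`, the `x` of the original link would lie before `l`, and not
        -- at `g`, where the letter is `y`. So it would precede `g`, against `none`.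
        ... | inj₂ g+1≡l with linked W x y<r
        ...   | u , v , u<v , v<n , wu , wv with m≤n⇒m<n∨m≡n (l-max v v<n wv)
        ...     | inj₁ v<l = none (v , v<l , wv , u , u<v , wu)
        ...     | inj₂ refl with m≤n⇒m<n∨m≡n (s≤s⁻¹ (subst (u <_) (sym g+1≡l) u<v))
        ...       | inj₁ u<g  = none (g , g<l , wg , u , u<g , wu)
        ...       | inj₂ refl = 1+n≢n (trans (sym wg) wu)

      -- All occurrences of y but the first are forced, and only the first one
      -- precedes the last z: the three letters y … z … y become x … y … z.
      module Exchange (prev-f : PrevNot w x f) (next-f : suc f < n → w (suc f) ≢ y)
        (others : ∀ q → q < n → q ≢ f → w q ≡ y → ¬ PrevNot w x q)
        (z<r : z < r)
        (P : ℕ) (P<n : P < n) (wP : w P ≡ z) (P-max : ∀ q → q < n → w q ≡ z → q ≤ P)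
        (only-f : ∀ q → q < P → w q ≡ y → q ≡ f) where

        z≢x : z ≢ x
        z≢x ()

        f<P : f < P
        f<P with linked W y z<r
        ... | a , b , a<b , b<n , wa , wb =
          ≤-<-trans (f-min a (<-trans a<b b<n) wa) (<-≤-trans a<b (P-max b b<n wb))

        P<l : P < l
        P<l with <-cmp P l
        ... | tri< lt _ _   = lt
        ... | tri≈ _ refl _ = contradiction (trans (sym wP) wl) 1+n≢n
        ... | tri> _ _ l<P  = contradiction (only-f l l<P wl) (<⇒≢ f<l ∘ sym)

        w₁ w₂ w₃ : ℕ → ℕ
        w₁ = w [ f ≔ x ]
        w₂ = w₁ [ P ≔ y ]
        w₃ = w₂ [ l ≔ z ]

        w₁P : w₁ P ≡ z
        w₁P = trans (≔-there w x (<⇒≢ f<P ∘ sym)) wP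
        w₁l : w₁ l ≡ y
        w₁l = trans (≔-there w x (<⇒≢ f<l ∘ sym)) wl
        w₂l : w₂ l ≡ y
        w₂l = trans (≔-there w₁ y (<⇒≢ P<l ∘ sym)) w₁l

        w₃f : w₃ f ≡ x
        w₃f = trans (≔-there w₂ z (<⇒≢ f<l)) (trans (≔-there w₁ y (<⇒≢ f<P)) (≔-here w f x))
        w₃P : w₃ P ≡ y
        w₃P = trans (≔-there w₂ z (<⇒≢ P<l)) (≔-here w₁ P y)
        w₃l : w₃ l ≡ z
        w₃l = ≔-here w₂ l z
        w₃-else : ∀ q → q ≢ f → q ≢ P → q ≢ l → w₃ q ≡ w q
        w₃-else q q≢f q≢P q≢l =
          trans (≔-there w₂ z q≢l) (trans (≔-there w₁ y q≢P) (≔-there w x q≢f))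

        w₁-y : ∀ q → w₁ q ≡ y → q ≢ f
        w₁-y q eq refl = 1+n≢n (sym (trans (sym (≔-here w f x)) eq))

        same₁ : SameAsc n w w₁
        same₁ = sameAsc-lower w n f x wf prev-f next-f

        prev₂ : ∀ k → k < P → w₁ k ≢ y
        prev₂ k k<P eq = w₁-y k eq (only-f k k<P (trans (sym (≔-there w x (w₁-y k eq))) eq))

        no-z-after : ∀ q → P < q → q < n → w₁ q ≢ z
        no-z-after q P<q q<n eq = <⇒≱ P<q (P-max q q<n
          (trans (sym (≔-there w x (λ { refl → <-asym f<P P<q }))) eq))

        -- After the first change no `y` is left before `P`, and no `z` follows `P`; hence neither
        -- neighbour of `P` is critical.
        same₂ : SameAsc n w₁ w₂
        same₂ = sameAsc-lower w₁ n P y w₁P (prev P prev₂) (λ p<n → no-z-after (suc P) ≤-refl p<n)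
          where
          prev : ∀ q → (∀ k → k < q → w₁ k ≢ y) → PrevNot w₁ y q
          prev zero    _ = tt
          prev (suc k) h = h k ≤-refl

        prev-l : ∀ q → PrevNot w y q → ¬ PrevNot w x q → PrevNot w₂ y q
        prev-l zero    _ ¬p = contradiction tt ¬p
        prev-l (suc k) ky ¬p eq with k ≟ P | k ≟ f
        ... | yes refl | _ = ¬p λ wk≡x → z≢x (trans (sym wP) wk≡x)
        ... | no k≢P | yes refl = ¬p λ wk≡x → 1+n≢n (trans (sym wf) wk≡x)
        ... | no k≢P | no k≢f = ky (trans (sym (trans (≔-there w₁ y k≢P) (≔-there w x k≢f))) eq)

        prev-ly : ∀ q → ¬ PrevNot w x q → PrevNot w y q
        prev-ly zero    _ = tt
        prev-ly (suc k) ¬p wk≡y = ¬p λ wk≡x → 1+n≢n (trans (sym wk≡y) wk≡x)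

        -- The letter at `l` is forced, so its left neighbour is an `x`, which the two earlier
        -- changes do not touch; to the right of `l` there is no `z`.
        same₃ : SameAsc n w₂ w₃
        same₃ = sameAsc-raise w₂ n l y w₂l (prev-l l (prev-ly l forced-l) forced-l)
          λ p<n eq → no-z-after (suc l) (m<n⇒m<1+n P<l) p<n
            (trans (sym (≔-there w₁ {P} y (λ { refl → 1+n≰n (<⇒≤ P<l) }))) eq)
          where
          forced-l : ¬ PrevNot w x l
          forced-l = others l l<n (<⇒≢ f<l ∘ sym) wl

        cnt₁ : ∀ v → v ≢ x → v ≢ y → cnt w₁ v n ≡ cnt w v n
        cnt₁ v v≢x v≢y = cnt-≔-other w n f x v f<n (λ eq → v≢y (trans (sym eq) wf)) (v≢x ∘ sym)

        cnt₁-y : suc (cnt w₁ y n) ≡ cnt w y n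
        cnt₁-y = cnt-≔-old w n f x y f<n wf (1+n≢n ∘ sym)

        cnt₁₃ : ∀ v → cnt w₃ v n ≡ cnt w₁ v n
        cnt₁₃ v with v ≟ y | v ≟ z
        ... | yes refl | yes ()
        ... | yes refl | no _ = suc-injective (trans (cnt-≔-old w₂ n l z y l<n w₂l 1+n≢n)
                (cnt-≔-new w₁ n P y P<n (λ eq → 1+n≢n (trans (sym w₁P) eq))))
        ... | no _ | yes refl = trans (cnt-≔-new w₂ n l z l<n (λ eq → 1+n≢n (trans (sym eq) w₂l)))
                (cnt-≔-old w₁ n P y z P<n w₁P (1+n≢n ∘ sym))
        ... | no v≢y | no v≢z = trans
                (cnt-≔-other w₂ n l z v l<n (λ eq → v≢y (trans (sym eq) w₂l)) (v≢z ∘ sym))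
                (cnt-≔-other w₁ n P y v P<n (λ eq → v≢z (trans (sym eq) w₁P)) (v≢y ∘ sym))

        bounded₃ : ∀ q → q < n → w₃ q < r
        bounded₃ q q<n with q ≟ f | q ≟ P | q ≟ l
        ... | yes refl | _ | _ = subst (_< r) (sym w₃f) (<-trans ≤-refl y<r)
        ... | no _ | yes refl | _ = subst (_< r) (sym w₃P) y<r
        ... | no _ | no _ | yes refl = subst (_< r) (sym w₃l) z<r
        ... | no a | no b | no c = subst (_< r) (sym (w₃-else q a b c)) (bounded W q q<n)

        -- The `z` at `P` may have been the witness for the link to `suc z`. Since `P` is the last
        -- `z`, this other one stands before it and takes over that link.
        other-z : ∃[ u ] u < P × w u ≡ z
        other-z with anyUpTo? (λ u → w u ≟ z) P
        ... | yes found = found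
        ... | no none = contradiction (twice z z<r) (<⇒≱ (s≤s (begin
              cnt w z n           ≤⟨ ∑<-mono n pointwise ⟩
              ∑< n (λ q → δ q P)  ≡⟨ ∑<-δ n P P<n ⟩
              1                   ∎)))
          where
          open ≤-Reasoning
          pointwise : ∀ q → q < n → δ (w q) z ≤ δ q P
          pointwise q q<n with q ≟ P
          ... | yes q≡P = ≤-trans (δ≤1 (w q) z) (≤-reflexive (sym (δ-≡ q≡P)))
          ... | no q≢P = ≤-trans (≤-reflexive (δ-≢ λ eq →
                  none (q , ≤∧≢⇒< (P-max q q<n eq) q≢P , eq))) z≤n

        linked₃ : ∀ i → suc i < r → Before n w₃ i (suc i)
        linked₃ i 1+i<r with i ≟ x | i ≟ y
        ... | yes refl | _ = f , P , f<P , P<n , w₃f , w₃P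
        ... | no _ | yes refl = P , l , P<l , l<n , w₃P , w₃l
        ... | no i≢x | no i≢y with linked W i 1+i<r
        ...   | a , b , a<b , b<n , wa , wb with a ≟ P
        ...     | no a≢P = a , b , a<b , b<n , keep-a , keep-b
          where
          keep-a = trans (w₃-else a (λ { refl → i≢y (trans (sym wa) wf) }) a≢P
                                    (λ { refl → i≢y (trans (sym wa) wl) })) wa
          keep-b = trans (w₃-else b (λ { refl → i≢x (suc-injective (trans (sym wb) wf)) })
                                    (λ { refl → i≢y (suc-injective (trans (sym wb) wP)) })
                                    (λ { refl → i≢x (suc-injective (trans (sym wb) wl)) })) wb
        ...     | yes refl with other-z
        ...       | u , u<P , wu = u , b , <-trans u<P a<b , b<n
                  , trans (w₃-else u (λ { refl → 1+n≢n (trans (sym wu) wf) }) (<⇒≢ u<P)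
                                     (λ { refl → 1+n≢n (trans (sym wu) wl) })) (trans wu (trans (sym wP) wa))
                  , trans (w₃-else b (λ { refl → i≢x (suc-injective (trans (sym wb) wf)) })
                                     (<⇒≢ a<b ∘ sym)
                                     (λ { refl → i≢x (suc-injective (trans (sym wb) wl)) })) wb

        result : Lowered r n w x w₃
        result = record
          { same      = sameAsc-trans {n} {w} {w₁} {w₃} same₁ (sameAsc-trans {n} {w₁} {w₂} {w₃} same₂ same₃)
          ; word      = record { bounded = bounded₃ ; linked = linked₃ }
          ; cnt-upper = trans (cong suc (cnt₁₃ y)) cnt₁-y
          ; cnt-lower = trans (cnt₁₃ x) (cnt-≔-new w n f x f<n (λ eq → 1+n≢n (trans (sym wf) eq)))
          ; cnt-other = λ v v≢x v≢y → trans (cnt₁₃ v) (cnt₁ v v≢x v≢y)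
          -- Each `y` of `w₁` was already forced in `w`, because `f` carried the only free one.
          ; forced-≤  = begin
              forced w₃ x n ≤⟨ ∑<-mono n (λ q _ → forcedAt≤upper w₃ x q) ⟩
              cnt w₃ y n    ≡⟨ cnt₁₃ y ⟩
              cnt w₁ y n    ≤⟨ ∑<-mono n pointwise ⟩
              forced w x n  ∎
          }
          where
          open ≤-Reasoning
          pointwise : ∀ q → q < n → δ (w₁ q) y ≤ forcedAt w x q
          pointwise q q<n with q ≟ f
          ... | yes refl = ≤-trans (≤-reflexive (δ-≢ λ eq → w₁-y q eq refl)) z≤n
          ... | no q≢f rewrite ≔-there w x q≢f =
                upper≤forcedAt w x q λ eq → others q q<n q≢f eq

    -- Let `p` be the greatest free position. No `y` follows it directly, because that `y`, preceded
    -- by a `y`, would be free too. Strictly between `f` and `l` the position `p` can be lowered at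
    -- once; `p = l` is `lower-last-free`, and for `p = f` the link to `z` has to be rescued.
    lower-step : ∃[ w′ ] Lowered r n w x w′
    lower-step with greatest (free? w x) n (free-exists w x n unforced)
    ... | p , p<n , (wp , prev) , p-max with m≤n⇒m<n∨m≡n (l-max p p<n wp)
    ...   | inj₂ refl = lower-last-free prev
    ...   | inj₁ p<l with m≤n⇒m<n∨m≡n (f-min p p<n wp)
    ...     | inj₁ f<p = _ , lower-strict p p<l wp prev next (keep-f wp f<p)
      where
      next : suc p < n → w (suc p) ≢ y
      next p+1<n eq = 1+n≰n (p-max (suc p) p+1<n (eq , λ wp≡x → 1+n≢n (trans (sym wp) wp≡x)))
    ...     | inj₂ refl = last-case
      where
      next : suc f < n → w (suc f) ≢ y
      next p+1<n eq = 1+n≰n (p-max (suc f) p+1<n (eq , λ wp≡x → 1+n≢n (trans (sym wp) wp≡x)))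
      others : ∀ q → q < n → q ≢ f → w q ≡ y → ¬ PrevNot w x q
      others q q<n q≢f wq prev-q = q≢f (≤-antisym (p-max q q<n (wq , prev-q)) (f-min q q<n wq))
      last-case : ∃[ w′ ] Lowered r n w x w′
      last-case with z <? r
      ... | no z≮r = _ , lower-strict f p<l wf prev next (λ z<r → contradiction z<r z≮r)
      ... | yes z<r with greatest (λ q → w q ≟ z) n (cnt-pos w z n (≤-trans (s≤s z≤n) (twice z z<r)))
      ...   | P , P<n , wP , P-max with anyUpTo? (λ q → (w q ≟ y) ×-dec ¬? (q ≟ f)) P
      ...     | yes (q , q<P , wq , q≢f) = _ , lower-strict f p<l wf prev next
                  (λ _ → keep-z q P wf q≢f q<P P<n wq wP)
      ...     | no none = _ , Exchange.result prev next others z<r P P<n wP P-max only-f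
        where
        only-f : ∀ q → q < P → w q ≡ y → q ≡ f
        only-f q q<P wq with q ≟ f
        ... | yes eq = eq
        ... | no neq = contradiction (q , q<P , wq , neq) none

Twice : ℕ → ℕ → (ℕ → ℕ) → Set
Twice r n w = ∀ v → v < r → 2 ≤ cnt w v n

record Redistributed (r n : ℕ) (w : ℕ → ℕ) (x c d : ℕ) (w′ : ℕ → ℕ) : Set where
  field
    same      : SameAsc n w w′
    word      : RibbonWord r n w′
    cnt-lower : cnt w′ x n ≡ c
    cnt-upper : cnt w′ (suc x) n ≡ d
    cnt-other : ∀ v → v < r → v ≢ x → v ≢ suc x → cnt w′ v n ≡ cnt w v n

-- Before each step the count of `suc x` exceeds `d`. Hence it is at least 3 and larger than the
-- number of forced letters, as `lower-step` requires.
lower-by : ∀ {r n x d} k {w} → RibbonWord r n w → Twice r n w → suc x < r → 2 ≤ d →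
           forced w x n ≤ d → cnt w (suc x) n ≡ k + d →
           ∃[ w′ ] Redistributed r n w x (k + cnt w x n) d w′
lower-by zero {w} W twice y<r 2≤d forced≤d eq = w , record
  { same = λ _ _ → id , id ; word = W ; cnt-lower = refl ; cnt-upper = eq ; cnt-other = λ _ _ _ _ → refl }
lower-by {r} {n} {x} {d} (suc k) {w} W twice y<r 2≤d forced≤d eq
  with lower-step W y<r
         (≤-trans (s≤s (≤-trans 2≤d (m≤n+m d k))) (≤-reflexive (sym eq))) twice
         (≤-trans (s≤s (≤-trans forced≤d (m≤n+m d k))) (≤-reflexive (sym eq)))
... | w₁ , L with lower-by k (L.word) twice₁ y<r 2≤d (≤-trans L.forced-≤ forced≤d) cnt₁
  where
  module L = Lowered L
  cnt₁ : cnt w₁ (suc x) n ≡ k + d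
  cnt₁ = suc-injective (trans L.cnt-upper eq)
  twice₁ : Twice r n w₁
  twice₁ v v<r with v ≟ x | v ≟ suc x
  ... | yes refl | _ = ≤-trans (twice v v<r) (≤-trans (n≤1+n _) (≤-reflexive (sym L.cnt-lower)))
  ... | no _ | yes refl = ≤-trans 2≤d (≤-trans (m≤n+m d k) (≤-reflexive (sym cnt₁)))
  ... | no v≢x | no v≢y = ≤-trans (twice v v<r) (≤-reflexive (sym (L.cnt-other v v≢x v≢y)))
... | w₂ , R = w₂ , record
  { same      = sameAsc-trans {n} {w} {w₁} {w₂} L.same R.same
  ; word      = R.word
  ; cnt-lower = trans R.cnt-lower (trans (cong (k +_) L.cnt-lower) (+-suc k _))
  ; cnt-upper = R.cnt-upper
  ; cnt-other = λ v v<r v≢x v≢y → trans (R.cnt-other v v<r v≢x v≢y) (L.cnt-other v v≢x v≢y)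
  }
  where
  module L = Lowered L
  module R = Redistributed R

-- Reversal, complementation and redistribution

mirror : ℕ → ℕ → ℕ
mirror n p = n ∸ suc p

suc-mirror : ∀ {n p} → p < n → suc (mirror n p) ≡ n ∸ p
suc-mirror p<n = sym (+-∸-assoc 1 p<n)

mirror-involutive : ∀ {n p} → p < n → mirror n (mirror n p) ≡ p
mirror-involutive {n} p<n = trans (cong (n ∸_) (suc-mirror p<n)) (m∸[m∸n]≡n (<⇒≤ p<n))

mirror-< : ∀ {n p} → p < n → mirror n p < n
mirror-< {n} {p} p<n = subst (_≤ n) (sym (suc-mirror p<n)) (m∸n≤m n p)

mirror-anti : ∀ {n p q} → p < q → q < n → mirror n q < mirror n p
mirror-anti p<q q<n = ∸-monoʳ-< (s<s p<q) q<n

mirror-anti⁻ : ∀ {n p q} → p < n → q < n → mirror n q < mirror n p → p < q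
mirror-anti⁻ {n} p<n q<n lt =
  subst₂ _<_ (mirror-involutive p<n) (mirror-involutive q<n) (mirror-anti lt (mirror-< p<n))

mirror-suc : ∀ {n p} → suc p < n → suc (mirror n (suc p)) ≡ mirror n p
mirror-suc = suc-mirror

-- Reversal together with complementation of the letters exchanges the roles of
-- the letters x and x + 1, so that lowering letters is enough.
rotate : ℕ → ℕ → (ℕ → ℕ) → (ℕ → ℕ)
rotate r n w p = mirror r (w (mirror n p))

module _ {r n : ℕ} {w : ℕ → ℕ} (W : RibbonWord r n w) where

  rotate-word : RibbonWord r n (rotate r n w)
  rotate-word = record { bounded = bounded′ ; linked = linked′ }
    where
    bounded′ : ∀ p → p < n → rotate r n w p < r
    bounded′ p p<n = mirror-< (bounded W (mirror n p) (mirror-< p<n))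
    linked′ : ∀ i → suc i < r → Before n (rotate r n w) i (suc i)
    linked′ i 1+i<r with linked W (mirror r (suc i)) (subst (_< r) (sym (mirror-suc 1+i<r)) (mirror-< (<-trans ≤-refl 1+i<r)))
    ... | a , b , a<b , b<n , wa , wb = mirror n b , mirror n a , mirror-anti a<b b<n , mirror-< a<n
          , trans (cong (mirror r) (trans (cong w (mirror-involutive b<n)) (trans wb (mirror-suc 1+i<r))))
                  (mirror-involutive (<-trans ≤-refl 1+i<r))
          , trans (cong (mirror r) (trans (cong w (mirror-involutive a<n)) wa)) (mirror-involutive 1+i<r)
      where
      a<n = <-trans a<b b<n

  cnt-rotate : ∀ v → v < r → cnt (rotate r n w) v n ≡ cnt w (mirror r v) n
  cnt-rotate v v<r = trans (∑<-reverse n (λ q → δ (mirror r (w q)) v)) (∑<-cong n pointwise)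
    where
    pointwise : ∀ q → q < n → δ (mirror r (w q)) v ≡ δ (w q) (mirror r v)
    pointwise q q<n with w q ≟ mirror r v
    ... | yes eq = trans (δ-≡ (trans (cong (mirror r) eq) (mirror-involutive v<r))) (sym (δ-≡ eq))
    ... | no neq = trans (δ-≢ λ eq → neq (trans (sym (mirror-involutive (bounded W q q<n))) (cong (mirror r) eq)))
                         (sym (δ-≢ neq))

  -- Reversal exchanges the two letters compared and complementation reverses their order, so
  -- ascents remain ascents, at mirrored positions.
  rotate-asc : ∀ p → suc p < n →
    (w p < w (suc p) → rotate r n w (mirror n (suc p)) < rotate r n w (suc (mirror n (suc p)))) ×
    (rotate r n w (mirror n (suc p)) < rotate r n w (suc (mirror n (suc p))) → w p < w (suc p))
  rotate-asc p 1+p<n =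
      (λ lt → subst₂ _<_ (sym at-q) (sym at-1+q) (mirror-anti lt (bounded W (suc p) 1+p<n)))
    , (λ lt → mirror-anti⁻ (bounded W p p<n) (bounded W (suc p) 1+p<n) (subst₂ _<_ at-q at-1+q lt))
    where
    p<n = <-trans ≤-refl 1+p<n
    at-q : rotate r n w (mirror n (suc p)) ≡ mirror r (w (suc p))
    at-q = cong (mirror r ∘ w) (mirror-involutive 1+p<n)
    at-1+q : rotate r n w (suc (mirror n (suc p))) ≡ mirror r (w p)
    at-1+q = cong (mirror r ∘ w) (trans (cong (mirror n) (mirror-suc 1+p<n)) (mirror-involutive p<n))

sameAsc-rotate : ∀ {r n w w′} → RibbonWord r n w → RibbonWord r n w′ →
                 SameAsc n (rotate r n w) w′ → SameAsc n w (rotate r n w′)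
sameAsc-rotate {r} {n} {w} {w′} W W′ s p 1+p<n =
  (λ lt → to (proj₁ mid (proj₁ (rotate-asc W p 1+p<n) lt))) ,
  (λ lt → proj₂ (rotate-asc W p 1+p<n) (proj₂ mid (from lt)))
  where
  q = mirror n (suc p)
  1+q<n : suc q < n
  1+q<n = subst (_< n) (sym (mirror-suc 1+p<n)) (mirror-< (<-trans ≤-refl 1+p<n))
  mid = s q 1+q<n
  at-p : rotate r n w′ p ≡ mirror r (w′ (suc q))
  at-p = cong (mirror r ∘ w′) (sym (mirror-suc 1+p<n))
  to : w′ q < w′ (suc q) → rotate r n w′ p < rotate r n w′ (suc p)
  to lt = subst (_< mirror r (w′ q)) (sym at-p) (mirror-anti lt (bounded W′ (suc q) 1+q<n))
  from : rotate r n w′ p < rotate r n w′ (suc p) → w′ q < w′ (suc q)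
  from lt = mirror-anti⁻ (bounded W′ q (<-trans ≤-refl 1+q<n)) (bounded W′ (suc q) 1+q<n)
              (subst (_< mirror r (w′ q)) at-p lt)

c+d≡a+b⇒b≡[c∸a]+d : ∀ {c d a b} → c + d ≡ a + b → a ≤ c → b ≡ (c ∸ a) + d
c+d≡a+b⇒b≡[c∸a]+d {c} {d} {a} {b} eq a≤c = +-cancelˡ-≡ a _ _ (begin
  a + b              ≡⟨ sym eq ⟩
  c + d              ≡⟨ cong (_+ d) (sym (m+[n∸m]≡n a≤c)) ⟩
  a + (c ∸ a) + d    ≡⟨ +-assoc a _ d ⟩
  a + ((c ∸ a) + d)  ∎)
  where open ≡-Reasoning

-- Both demands of `lower-by` on `d` follow from `cnt w x n ≤ d`, since this count is at least 2 and
-- bounds the number of forced letters.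
lower-to : ∀ {r n x c d w} → RibbonWord r n w → Twice r n w → suc x < r →
           c + d ≡ cnt w x n + cnt w (suc x) n → cnt w x n ≤ c → cnt w x n ≤ d →
           ∃[ w′ ] Redistributed r n w x c d w′
lower-to {r} {n} {x} {c} {d} {w} W twice y<r eq x≤c x≤d =
  subst (λ e → ∃[ w′ ] Redistributed r n w x e d w′) (m∸n+n≡m x≤c)
    (lower-by (c ∸ cnt w x n) W twice y<r
      (≤-trans (twice x (<-trans ≤-refl y<r)) x≤d)
      (≤-trans (forced≤lower w x n) x≤d)
      (c+d≡a+b⇒b≡[c∸a]+d eq x≤c))

redistribute : ∀ {r n x c d w} → RibbonWord r n w → Twice r n w → suc x < r →
               c + d ≡ cnt w x n + cnt w (suc x) n →
               (cnt w x n ≤ c × cnt w x n ≤ d) ⊎ (cnt w (suc x) n ≤ c × cnt w (suc x) n ≤ d) →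
               ∃[ w′ ] Redistributed r n w x c d w′
redistribute W twice y<r eq (inj₁ (x≤c , x≤d)) = lower-to W twice y<r eq x≤c x≤d
-- In the rotated word the image of `suc x` is the lower of the two letters, so `c` and `d` trade
-- places.
redistribute {r} {n} {x} {c} {d} {w} W twice y<r eq (inj₂ (y≤c , y≤d))
  with lower-to (rotate-word W) twice′ y′<r eq′ (subst (_≤ d) (sym cnt-x′) y≤d) (subst (_≤ c) (sym cnt-x′) y≤c)
  where
  x<r = <-trans ≤-refl y<r
  x′ = mirror r (suc x)
  1+x′ : suc x′ ≡ mirror r x
  1+x′ = mirror-suc y<r
  y′<r : suc x′ < r
  y′<r = subst (_< r) (sym 1+x′) (mirror-< x<r)
  twice′ : Twice r n (rotate r n w)
  twice′ v v<r = subst (2 ≤_) (sym (cnt-rotate W v v<r)) (twice (mirror r v) (mirror-< v<r))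
  cnt-x′ : cnt (rotate r n w) x′ n ≡ cnt w (suc x) n
  cnt-x′ = trans (cnt-rotate W x′ (mirror-< y<r)) (cong (λ v → cnt w v n) (mirror-involutive y<r))
  cnt-y′ : cnt (rotate r n w) (suc x′) n ≡ cnt w x n
  cnt-y′ = trans (cnt-rotate W (suc x′) y′<r)
                 (cong (λ v → cnt w v n) (trans (cong (mirror r) 1+x′) (mirror-involutive x<r)))
  eq′ : d + c ≡ cnt (rotate r n w) x′ n + cnt (rotate r n w) (suc x′) n
  eq′ = trans (+-comm d c) (trans eq (trans (+-comm (cnt w x n) _) (sym (cong₂ _+_ cnt-x′ cnt-y′))))
... | w₁ , R = rotate r n w₁ , record
  { same      = sameAsc-rotate W R.word R.same
  ; word      = rotate-word R.word
  ; cnt-lower = trans (cnt-rotate R.word x x<r)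
                  (trans (cong (λ v → cnt w₁ v n) (sym (mirror-suc y<r))) R.cnt-upper)
  ; cnt-upper = trans (cnt-rotate R.word (suc x) y<r) R.cnt-lower
  ; cnt-other = λ v v<r v≢x v≢y → trans (cnt-rotate R.word v v<r)
      (trans (R.cnt-other (mirror r v) (mirror-< v<r)
               (λ e → v≢y (mirror-inj v<r y<r e))
               (λ e → v≢x (mirror-inj v<r x<r (trans e (mirror-suc y<r)))))
        (trans (cnt-rotate W (mirror r v) (mirror-< v<r)) (cong (λ u → cnt w u n) (mirror-involutive v<r))))
  }
  where
  module R = Redistributed R
  x<r = <-trans ≤-refl y<r
  mirror-inj : ∀ {u v} → u < r → v < r → mirror r u ≡ mirror r v → u ≡ v
  mirror-inj u<r v<r e = trans (sym (mirror-involutive u<r)) (trans (cong (mirror r) e) (mirror-involutive v<r))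

-- Moves between contents

-- As the sum is fixed, the disjunction says that `c` and `d` both lie between the smaller and the
-- larger of `x` and `y`. Transpositions are included.
data Step : ℕ → List ℕ → List ℕ → Set where
  here  : ∀ {x y c d zs} → c + d ≡ x + y → (x ≤ c × x ≤ d) ⊎ (y ≤ c × y ≤ d) →
          Step 0 (x ∷ y ∷ zs) (c ∷ d ∷ zs)
  there : ∀ {k z xs ys} → Step k xs ys → Step (suc k) (z ∷ xs) (z ∷ ys)

infix 4 _⇝_
_⇝_ : List ℕ → List ℕ → Set
_⇝_ = Star (λ xs ys → ∃[ k ] Step k xs ys)

record Realizes (n : ℕ) (bs : List ℕ) (w : ℕ → ℕ) : Set where
  field
    word    : RibbonWord (length bs) n w
    content : ∀ v → v < length bs → cnt w v n ≡ nth bs v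

step-bound : ∀ {k bs as} → Step k bs as → suc k < length bs
step-bound (here _ _) = s≤s (s≤s z≤n)
step-bound (there s)  = s<s (step-bound s)

step-length : ∀ {k bs as} → Step k bs as → length bs ≡ length as
step-length (here _ _) = refl
step-length (there s)  = cong suc (step-length s)

step-sum : ∀ {k bs as} → Step k bs as → sum bs ≡ sum as
step-sum (here {x} {y} {c} {d} {zs} eq _) =
  trans (sym (+-assoc x y (sum zs))) (trans (cong (_+ sum zs) (sym eq)) (+-assoc c d (sum zs)))
step-sum (there {z = z} s) = cong (z +_) (step-sum s)

step-total : ∀ {k bs as} → Step k bs as → nth as k + nth as (suc k) ≡ nth bs k + nth bs (suc k)
step-total (here eq _) = eq
step-total (there s)   = step-total s

step-cond : ∀ {k bs as} → Step k bs as →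
  (nth bs k ≤ nth as k × nth bs k ≤ nth as (suc k)) ⊎
  (nth bs (suc k) ≤ nth as k × nth bs (suc k) ≤ nth as (suc k))
step-cond (here _ c) = c
step-cond (there s)  = step-cond s

step-other : ∀ {k bs as} → Step k bs as → ∀ v → v ≢ k → v ≢ suc k → nth bs v ≡ nth as v
step-other (here _ _) zero          v≢k v≢1+k = contradiction refl v≢k
step-other (here _ _) (suc zero)    v≢k v≢1+k = contradiction refl v≢1+k
step-other (here _ _) (suc (suc v)) v≢k v≢1+k = refl
step-other (there s)  zero          v≢k v≢1+k = refl
step-other (there s)  (suc v)       v≢k v≢1+k = step-other s v (v≢k ∘ cong suc) (v≢1+k ∘ cong suc)

step-twice : ∀ {k bs as} → Step k bs as → All (2 ≤_) bs → All (2 ≤_) as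
step-twice (here _ (inj₁ (x≤c , x≤d))) (2≤x ∷ _ ∷ ps) = ≤-trans 2≤x x≤c ∷ ≤-trans 2≤x x≤d ∷ ps
step-twice (here _ (inj₂ (y≤c , y≤d))) (_ ∷ 2≤y ∷ ps) = ≤-trans 2≤y y≤c ∷ ≤-trans 2≤y y≤d ∷ ps
step-twice (there s) (p ∷ ps) = p ∷ step-twice s ps

All-nth : ∀ {P : ℕ → Set} {bs} → All P bs → ∀ v → v < length bs → P (nth bs v)
All-nth (p ∷ ps) zero    v<n = p
All-nth (p ∷ ps) (suc v) v<n = All-nth ps v (s<s⁻¹ v<n)

step-realizes : ∀ {n k bs as w} → Step k bs as → All (2 ≤_) bs → Realizes n bs w →
                ∃[ w′ ] SameAsc n w w′ × Realizes n as w′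
step-realizes {n} {k} {bs} {as} {w} s twice B
  with redistribute {x = k} {c = nth as k} {d = nth as (suc k)} B.word
         (λ v v<r → subst (2 ≤_) (sym (B.content v v<r)) (All-nth twice v v<r)) 1+k<r
         (trans (step-total s) (sym (cong₂ _+_ cnt-k cnt-1+k)))
         (subst₂ (λ a b → (a ≤ nth as k × a ≤ nth as (suc k)) ⊎ (b ≤ nth as k × b ≤ nth as (suc k)))
           (sym cnt-k) (sym cnt-1+k) (step-cond s))
  where
  module B = Realizes B
  1+k<r = step-bound s
  cnt-k = B.content k (<-trans ≤-refl 1+k<r)
  cnt-1+k = B.content (suc k) 1+k<r
... | w′ , R = w′ , R.same , record
  { word    = subst (λ r → RibbonWord r n w′) (step-length s) R.word
  ; content = content′
  }
  where
  module B = Realizes B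
  module R = Redistributed R
  content′ : ∀ v → v < length as → cnt w′ v n ≡ nth as v
  content′ v v<r with v ≟ k | v ≟ suc k
  ... | yes refl | _ = R.cnt-lower
  ... | no _ | yes refl = R.cnt-upper
  ... | no v≢k | no v≢1+k = trans (R.cnt-other v v<r′ v≢k v≢1+k)
          (trans (B.content v v<r′) (step-other s v v≢k v≢1+k))
    where
    v<r′ = subst (v <_) (sym (step-length s)) v<r

⇝-realizes : ∀ {n bs as w} → bs ⇝ as → All (2 ≤_) bs → Realizes n bs w →
             ∃[ w′ ] SameAsc n w w′ × Realizes n as w′
⇝-realizes ε twice B = _ , (λ _ _ → id , id) , B
⇝-realizes {n} {w = w} ((k , s) ◅ ss) twice B with step-realizes s twice B
... | w₁ , same₁ , B₁ with ⇝-realizes ss (step-twice s twice) B₁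
...   | w₂ , same₂ , B₂ = w₂ , sameAsc-trans {n} {w} {w₁} {w₂} same₁ same₂ , B₂

⇝-sum : ∀ {bs as} → bs ⇝ as → sum bs ≡ sum as
⇝-sum ε              = refl
⇝-sum ((_ , s) ◅ ss) = trans (step-sum s) (⇝-sum ss)

∷-⇝ : ∀ z {bs as} → bs ⇝ as → z ∷ bs ⇝ z ∷ as
∷-⇝ z = gmap (z ∷_) (λ (k , s) → suc k , there s)

swap-⇝ : ∀ x y zs → x ∷ y ∷ zs ⇝ y ∷ x ∷ zs
swap-⇝ x y zs = (0 , here (+-comm y x) (cond (≤-total x y))) ◅ ε
  where
  cond : x ≤ y ⊎ y ≤ x → (x ≤ y × x ≤ x) ⊎ (y ≤ y × y ≤ x)
  cond (inj₁ x≤y) = inj₁ (x≤y , ≤-refl)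
  cond (inj₂ y≤x) = inj₂ (≤-refl , y≤x)

↭⇒⇝ : ∀ {bs as} → bs ↭ as → bs ⇝ as
↭⇒⇝ Perm.refl           = ε
↭⇒⇝ (Perm.prep x p)     = ∷-⇝ x (↭⇒⇝ p)
↭⇒⇝ (Perm.swap x y p)   = swap-⇝ x y _ ◅◅ ∷-⇝ y (∷-⇝ x (↭⇒⇝ p))
↭⇒⇝ (Perm.trans p q)    = ↭⇒⇝ p ◅◅ ↭⇒⇝ q

-- What remains of x ∷ ys once a first entry a has been produced from the first
-- two consecutive entries that enclose a.
pull : ℕ → ℕ → List ℕ → List ℕ
pull a x []       = []
pull a x (y ∷ ys) with a ≤? y
... | yes _ = x ∷ pull a y ys
... | no _  = (x + y ∸ a) ∷ ys

pull-length : ∀ a x ys → length (pull a x ys) ≡ length ys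
pull-length a x []       = refl
pull-length a x (y ∷ ys) with a ≤? y
... | yes _ = cong suc (pull-length a y ys)
... | no _  = refl

-- Entries that are at least `a` are passed by transpositions. At the first `y` below `a`, the pair
-- `x, y` becomes `a, x + y ∸ a`. If there is no such `y`, the bound on the sums, which survives
-- each passage because the entries of `as` are at most `a`, leaves `x = a` at the end.
pull-⇝ : ∀ a x ys as → a ≤ x → length as ≡ length ys → All (_≤ a) as →
         x + sum ys ≤ a + sum as → x ∷ ys ⇝ a ∷ pull a x ys
pull-⇝ a x [] [] a≤x len le sum≤
  rewrite ≤-antisym a≤x (subst₂ _≤_ (+-identityʳ x) (+-identityʳ a) sum≤) = ε
pull-⇝ a x (y ∷ ys) (a₂ ∷ as) a≤x len (a₂≤a ∷ le) sum≤ with a ≤? y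
... | yes a≤y = ∷-⇝ x (pull-⇝ a y ys as a≤y (suc-injective len) le
                  (+-cancelˡ-≤ a₂ _ _ (begin
                    a₂ + (y + sum ys) ≤⟨ +-monoˡ-≤ _ (≤-trans a₂≤a a≤x) ⟩
                    x + (y + sum ys)  ≤⟨ sum≤ ⟩
                    a + (a₂ + sum as) ≡⟨ +-assoc a a₂ _ ⟨
                    a + a₂ + sum as   ≡⟨ cong (_+ sum as) (+-comm a a₂) ⟩
                    a₂ + a + sum as   ≡⟨ +-assoc a₂ a _ ⟩
                    a₂ + (a + sum as) ∎)))
                ◅◅ swap-⇝ x a _
  where open ≤-Reasoning
... | no a≰y = (0 , here (m+[n∸m]≡n (≤-trans a≤x (m≤m+n x y)))
                      (inj₂ (<⇒≤ (≰⇒> a≰y) , (begin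
                        y            ≡⟨ m+n∸m≡n a y ⟨
                        a + y ∸ a    ≤⟨ ∸-monoˡ-≤ a (+-monoˡ-≤ y a≤x) ⟩
                        x + y ∸ a    ∎)))) ◅ ε
  where open ≤-Reasoning

-- The offsets `g` and `e` collect what has been passed in `as` and in the list. Up to the enclosing
-- pair the comparison is termwise, as `a` separates the two sides; from there on, `a` cancels in
-- the hypothesis.
pull-dominates : ∀ a x ys as g e → a ≤ x → length as ≡ length ys → All (_≤ a) as → g ≤ e →
  (∀ k → g + (a + sum (take k as)) ≤ e + (x + sum (take k ys))) →
  ∀ k → g + sum (take k as) ≤ e + sum (take k (pull a x ys))
pull-dominates a x [] [] g e a≤x len le g≤e dom zero    = +-monoˡ-≤ 0 g≤e
pull-dominates a x [] [] g e a≤x len le g≤e dom (suc k) = +-monoˡ-≤ 0 g≤e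
pull-dominates a x (y ∷ ys) (a₂ ∷ as) g e a≤x len (a₂≤a ∷ le) g≤e dom k with a ≤? y
pull-dominates a x (y ∷ ys) (a₂ ∷ as) g e a≤x len (a₂≤a ∷ le) g≤e dom zero | yes a≤y = +-monoˡ-≤ 0 g≤e
pull-dominates a x (y ∷ ys) (a₂ ∷ as) g e a≤x len (a₂≤a ∷ le) g≤e dom (suc k) | yes a≤y =
  subst₂ _≤_ (+-assoc g a₂ _) (+-assoc e x _)
    (pull-dominates a y ys as (g + a₂) (e + x) a≤y (suc-injective len) le
      (+-mono-≤ g≤e (≤-trans a₂≤a a≤x)) dom′ k)
  where
  open ≤-Reasoning
  dom′ : ∀ k → g + a₂ + (a + sum (take k as)) ≤ e + x + (y + sum (take k ys))
  dom′ k = begin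
    g + a₂ + (a + sum (take k as))   ≡⟨ +-assoc g a₂ _ ⟩
    g + (a₂ + (a + sum (take k as))) ≡⟨ cong (g +_) (+-assoc a₂ a _) ⟨
    g + (a₂ + a + sum (take k as))   ≡⟨ cong (λ s → g + (s + sum (take k as))) (+-comm a₂ a) ⟩
    g + (a + a₂ + sum (take k as))   ≡⟨ cong (g +_) (+-assoc a a₂ _) ⟩
    g + (a + (a₂ + sum (take k as))) ≤⟨ dom (suc k) ⟩
    e + (x + (y + sum (take k ys)))  ≡⟨ +-assoc e x _ ⟨
    e + x + (y + sum (take k ys))    ∎
pull-dominates a x (y ∷ ys) (a₂ ∷ as) g e a≤x len (a₂≤a ∷ le) g≤e dom zero | no a≰y = +-monoˡ-≤ 0 g≤e
pull-dominates a x (y ∷ ys) (a₂ ∷ as) g e a≤x len (a₂≤a ∷ le) g≤e dom (suc k) | no a≰y =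
  +-cancelˡ-≤ a _ _ (begin
    a + (g + σ)                        ≡⟨ +-assoc a g σ ⟨
    a + g + σ                          ≡⟨ cong (_+ σ) (+-comm a g) ⟩
    g + a + σ                          ≡⟨ +-assoc g a σ ⟩
    g + (a + σ)                        ≤⟨ dom (suc k) ⟩
    e + (x + (y + τ))                  ≡⟨ cong (e +_) (+-assoc x y τ) ⟨
    e + (x + y + τ)                    ≡⟨ cong (λ σ → e + (σ + τ)) (m+[n∸m]≡n (≤-trans a≤x (m≤m+n x y))) ⟨
    e + (a + (x + y ∸ a) + τ)          ≡⟨ cong (e +_) (+-assoc a _ τ) ⟩
    e + (a + ((x + y ∸ a) + τ))        ≡⟨ +-assoc e a _ ⟨
    e + a + ((x + y ∸ a) + τ)          ≡⟨ cong (_+ ((x + y ∸ a) + τ)) (+-comm e a) ⟩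
    a + e + ((x + y ∸ a) + τ)          ≡⟨ +-assoc a e _ ⟩
    a + (e + ((x + y ∸ a) + τ))        ∎)
  where
  open ≤-Reasoning
  σ = sum (take (suc k) (a₂ ∷ as))
  τ = sum (take k ys)

-- The entries of `as` are produced from left to right. As `as` decreases, each of them bounds the
-- later ones, which is the condition for `pull-⇝`.
dominance⇒⇝ : ∀ as bs → AllPairs _≥_ as → length as ≡ length bs → sum as ≡ sum bs →
              (∀ k → sum (take k as) ≤ sum (take k bs)) → bs ⇝ as
dominance⇒⇝ [] [] _ _ _ _ = ε
dominance⇒⇝ (a ∷ as) (x ∷ ys) (le ∷ dec) len sums dom =
  steps ◅◅ ∷-⇝ a (dominance⇒⇝ as (pull a x ys) dec
    (trans (suc-injective len) (sym (pull-length a x ys)))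
    (+-cancelˡ-≡ a _ _ (trans sums (⇝-sum steps)))
    (pull-dominates a x ys as 0 0 a≤x (suc-injective len) le ≤-refl (dom ∘ suc)))
  where
  a≤x : a ≤ x
  a≤x = subst₂ _≤_ (+-identityʳ a) (+-identityʳ x) (dom 1)
  steps = pull-⇝ a x ys as a≤x (suc-injective len) le (≤-reflexive (sym sums))

-- Skew shapes

∑<-const : ∀ n {f : ℕ → ℕ} c → (∀ p → p < n → f p ≡ c) → ∑< n f ≡ n * c
∑<-const zero    c f≡c = refl
∑<-const (suc n) c f≡c = cong₂ _+_ (f≡c 0 z<s) (∑<-const n c (λ p p<n → f≡c (suc p) (s<s p<n)))

∑<-zeros : ∀ n {f : ℕ → ℕ} → (∀ p → p < n → f p ≡ 0) → ∑< n f ≡ 0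
∑<-zeros n f≡0 = trans (∑<-const n 0 f≡0) (*-zeroʳ n)

∑<-prefix : ∀ {m n} {f : ℕ → ℕ} → m ≤ n → (∀ p → m ≤ p → p < n → f p ≡ 0) → ∑< n f ≡ ∑< m f
∑<-prefix {m} {n} {f} m≤n f≡0 = begin
  ∑< n f                                   ≡⟨ cong (λ k → ∑< k f) (m+[n∸m]≡n m≤n) ⟨
  ∑< (m + (n ∸ m)) f                       ≡⟨ ∑<-+ m (n ∸ m) f ⟩
  ∑< m f + ∑< (n ∸ m) (λ p → f (m + p))    ≡⟨ cong (∑< m f +_) (∑<-zeros (n ∸ m) λ p p<n∸m →
      f≡0 (m + p) (m≤m+n m p) (subst (m + p <_) (m+[n∸m]≡n m≤n) (+-monoʳ-< m p<n∸m))) ⟩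
  ∑< m f + 0                               ≡⟨ +-identityʳ _ ⟩
  ∑< m f                                   ∎
  where open ≡-Reasoning

∑<-interval : ∀ {m l u} {f : ℕ → ℕ} → u ≤ m → (∀ c → l ≤ c → c < u → f c ≡ 1) →
              (∀ c → c < l → f c ≡ 0) → (∀ c → u ≤ c → f c ≡ 0) → ∑< m f ≡ u ∸ l
∑<-interval {m} {l} {u} {f} u≤m one low high = trans (∑<-prefix u≤m (λ p u≤p _ → high p u≤p)) (main (≤-total l u))
  where
  open ≡-Reasoning
  main : l ≤ u ⊎ u ≤ l → ∑< u f ≡ u ∸ l
  main (inj₂ u≤l) = trans (∑<-zeros u λ p p<u → low p (<-≤-trans p<u u≤l)) (sym (m≤n⇒m∸n≡0 u≤l))
  main (inj₁ l≤u) = begin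
    ∑< u f                                ≡⟨ cong (λ k → ∑< k f) (m+[n∸m]≡n l≤u) ⟨
    ∑< (l + (u ∸ l)) f                    ≡⟨ ∑<-+ l (u ∸ l) f ⟩
    ∑< l f + ∑< (u ∸ l) (λ p → f (l + p)) ≡⟨ cong₂ _+_ (∑<-zeros l low) (∑<-const (u ∸ l) 1 λ p p<u∸l →
        one (l + p) (m≤m+n l p) (subst (l + p <_) (m+[n∸m]≡n l≤u) (+-monoʳ-< l p<u∸l))) ⟩
    (u ∸ l) * 1                           ≡⟨ *-identityʳ _ ⟩
    u ∸ l                                 ∎

length-filter-interval : ∀ {P : ℕ → Set} (P? : Decidable P) {m l u} → u ≤ m →
  (∀ c → P c → l ≤ c × c < u) → (∀ c → l ≤ c → c < u → P c) → length (filter P? (upTo m)) ≡ u ∸ l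
length-filter-interval {P} P? {m} {l} {u} u≤m to from =
  trans (count m id) (∑<-interval u≤m one low high)
  where
  ind : ∀ {c} → Dec (P c) → ℕ
  ind (yes _) = 1
  ind (no _)  = 0
  count : ∀ m (f : ℕ → ℕ) → length (filter P? (applyUpTo f m)) ≡ ∑< m (λ p → ind (P? (f p)))
  count zero    f = refl
  count (suc m) f with P? (f 0)
  ... | yes _ = cong suc (count m (f ∘ suc))
  ... | no _  = count m (f ∘ suc)
  one : ∀ c → l ≤ c → c < u → ind (P? c) ≡ 1
  one c l≤c c<u with P? c
  ... | yes _ = refl
  ... | no ¬p = contradiction (from c l≤c c<u) ¬p
  low : ∀ c → c < l → ind (P? c) ≡ 0
  low c c<l with P? c
  ... | yes p = contradiction (proj₁ (to c p)) (<⇒≱ c<l)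
  ... | no _  = refl
  high : ∀ c → u ≤ c → ind (P? c) ≡ 0
  high c u≤c with P? c
  ... | yes p = contradiction (proj₂ (to c p)) (≤⇒≯ u≤c)
  ... | no _  = refl

applyUpTo-cong : ∀ {X : Set} n {f g : ℕ → X} → (∀ i → i < n → f i ≡ g i) → applyUpTo f n ≡ applyUpTo g n
applyUpTo-cong zero    f≡g = refl
applyUpTo-cong (suc n) f≡g = cong₂ _∷_ (f≡g 0 z<s) (applyUpTo-cong n λ i i<n → f≡g (suc i) (s<s i<n))

m<n∸o⇒m+o<n : ∀ m {n} o → m < n ∸ o → m + o < n
m<n∸o⇒m+o<n m {n} o m<n∸o = subst (m + o <_) (m∸n+n≡m {n} {o} (<⇒≤ (m∸n≢0⇒n<m {n} {o} (m<n⇒n≢0 m<n∸o))))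
                              (+-monoˡ-< o m<n∸o)

nth-decreasing : ∀ {as} → Linked _≥_ as → ∀ i → nth as (suc i) ≤ nth as i
nth-decreasing []        i       = z≤n
nth-decreasing [-]       zero    = z≤n
nth-decreasing [-]       (suc i) = z≤n
nth-decreasing (p ∷ _)   zero    = p
nth-decreasing (_ ∷ ps)  (suc i) = nth-decreasing ps i

nth-antitone : ∀ {as} → Linked _≥_ as → ∀ {i j} → i ≤ j → nth as j ≤ nth as i
nth-antitone ps {j = zero}  z≤n = ≤-refl
nth-antitone ps {i} {suc j} i≤1+j with m≤n⇒m<n∨m≡n i≤1+j
... | inj₁ i<1+j = ≤-trans (nth-decreasing ps j) (nth-antitone ps (s≤s⁻¹ i<1+j))
... | inj₂ refl  = ≤-refl

-- The map `g` recovers from an element the `x` whose list it came from, which makes the lists for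
-- different `x` disjoint.
concatMap-unique : ∀ {X Y : Set} (f : X → List Y) (g : Y → X) xs →
  (∀ x → x ∈ xs → ∀ y → y ∈ f x → g y ≡ x) → (∀ x → x ∈ xs → Unique (f x)) →
  Unique xs → Unique (concatMap f xs)
concatMap-unique f g []       inv uniq []         = []
concatMap-unique f g (x ∷ xs) inv uniq (x∉ ∷ xs!) = Unique.++⁺ (uniq x (here refl))
  (concatMap-unique f g xs (λ x′ → inv x′ ∘ there) (λ x′ → uniq x′ ∘ there) xs!)
  λ {y} (y∈fx , y∈rest) → disjoint y y∈fx (∈-concatMap⁻ f y∈rest) x∉ (λ x′ → inv x′ ∘ there)
  where
  disjoint : ∀ y → y ∈ f x → ∀ {xs} → Any ((y ∈_) ∘ f) xs → All (x ≢_) xs →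
             (∀ x → x ∈ xs → ∀ y → y ∈ f x → g y ≡ x) → _
  disjoint y y∈fx {x′ ∷ _} (here y∈fx′) (x≢x′ ∷ _) inv′ =
    x≢x′ (trans (sym (inv x (here refl) y y∈fx)) (inv′ x′ (here refl) y y∈fx′))
  disjoint y y∈fx (there any) (_ ∷ x∉) inv′ = disjoint y y∈fx any x∉ (λ x′ → inv′ x′ ∘ there)

module Shape (A : SkewShape) where

  o ι len : ℕ → ℕ
  o = part (outer A)
  ι = part (inner A)
  len i = o i ∸ ι i

  r : ℕ
  r = numRows A

  o-antitone : ∀ {i j} → i ≤ j → o j ≤ o i
  o-antitone = nth-antitone (decreasing (outer A))

  ι-antitone : ∀ {i j} → i ≤ j → ι j ≤ ι i
  ι-antitone = nth-antitone (decreasing (inner A))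

  length-columns : ∀ i → length (columns A i) ≡ len i
  length-columns i = length-applyUpTo (ι i +_) (len i)

  ∈-columns⁻ : ∀ i {c} → c ∈ columns A i → ι i ≤ c × c < o i
  ∈-columns⁻ i c∈ with ∈-applyUpTo⁻ (ι i +_) c∈
  ... | j , j<len , refl = m≤m+n (ι i) j ,
        subst (ι i + j <_) (m+[n∸m]≡n (contained A i)) (+-monoʳ-< (ι i) j<len)

  ∈-columns⁺ : ∀ i {c} → ι i ≤ c → c < o i → c ∈ columns A i
  ∈-columns⁺ i {c} ι≤c c<o = subst (_∈ columns A i) (m+[n∸m]≡n ι≤c)
    (∈-applyUpTo⁺ (ι i +_) (∸-monoˡ-< c<o ι≤c))

  -- Both ends of the rows move weakly to the left on the way down, so the top row determines the
  -- left end of the common columns and the bottom row the right end.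
  overlaps-formula : ∀ k i → overlaps A (suc k) i ≡ o (i + k) ∸ ι i
  overlaps-formula k i = length-filter-interval
    (λ c → All.all? (λ j → _∈?_ _≟_ c (columns A (i + j))) (upTo (suc k)))
    (o-antitone z≤n)
    (λ c all → proj₁ (∈-columns⁻ i (subst (λ j → c ∈ columns A j) (+-identityʳ i) (All.lookup all (∈-upTo⁺ z<s))))
             , proj₂ (∈-columns⁻ (i + k) (All.lookup all (∈-upTo⁺ ≤-refl))))
    (λ c ι≤c c<o → All.tabulate λ {j} j∈ → ∈-columns⁺ (i + j)
       (≤-trans (ι-antitone (m≤m+n i j)) ι≤c)
       (<-≤-trans c<o (o-antitone (+-monoʳ-≤ i (s≤s⁻¹ (∈-upTo⁻ j∈))))))

  boxes-unique : Unique (boxes A)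
  boxes-unique = concatMap-unique (λ i → map (i ,_) (columns A i)) proj₁ (upTo r)
    (λ i _ b b∈ → let c , _ , eq = ∈-map⁻ (i ,_) b∈ in cong proj₁ eq)
    (λ i _ → Unique.map⁺ (cong proj₂) (Unique.applyUpTo⁺₁ (ι i +_) (len i)
               λ {j} {k} j<k _ eq → <⇒≢ j<k (+-cancelˡ-≡ (ι i) j k eq)))
    (Unique.upTo⁺ r)

  ∈-boxes⁻ : ∀ {b} → b ∈ boxes A → proj₁ b < r × ι (proj₁ b) ≤ proj₂ b × proj₂ b < o (proj₁ b)
  ∈-boxes⁻ b∈ = go (∈-concatMap⁻ (λ i → map (i ,_) (columns A i)) b∈) (All.all-upTo r)
    where
    go : ∀ {b is} → Any (λ i → b ∈ map (i ,_) (columns A i)) is → All (_< r) is →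
         proj₁ b < r × ι (proj₁ b) ≤ proj₂ b × proj₂ b < o (proj₁ b)
    go (here {i} b∈) (i<r ∷ _) with ∈-map⁻ (i ,_) b∈
    ... | c , c∈ , refl = i<r , ∈-columns⁻ i c∈
    go (there any) (_ ∷ is<r) = go any is<r

  ∈-boxes⁺ : ∀ {i c} → i < r → ι i ≤ c → c < o i → (i , c) ∈ boxes A
  ∈-boxes⁺ {i} {c} i<r ι≤c c<o = ∈-concatMap⁺ (λ i → map (i ,_) (columns A i)) (go (∈-upTo⁺ i<r))
    where
    go : ∀ {is} → i ∈ is → Any (λ i′ → (i , c) ∈ map (i′ ,_) (columns A i′)) is
    go (here refl) = here (∈-map⁺ (i ,_) (∈-columns⁺ i ι≤c c<o))
    go (there i∈)  = there (go i∈)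

  sum-boxes : ∀ (f : ℕ → ℕ) → sum (map (f ∘ proj₁) (boxes A)) ≡ ∑< r (λ i → len i * f i)
  sum-boxes f = go r id
    where
    row-sum : ∀ i cs → sum (map (f ∘ proj₁) (map (i ,_) cs)) ≡ length cs * f i
    row-sum i []       = refl
    row-sum i (c ∷ cs) = cong (f i +_) (row-sum i cs)
    go : ∀ m (g : ℕ → ℕ) →
         sum (map (f ∘ proj₁) (concatMap (λ i → map (i ,_) (columns A i)) (applyUpTo g m))) ≡
         ∑< m (λ i → len (g i) * f (g i))
    go zero    g = refl
    go (suc m) g = begin
      sum (map f′ (xs ++ ys))               ≡⟨ cong sum (map-++ f′ xs ys) ⟩
      sum (map f′ xs ++ map f′ ys)          ≡⟨ sum-++ (map f′ xs) (map f′ ys) ⟩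
      sum (map f′ xs) + sum (map f′ ys)     ≡⟨ cong₂ _+_ (trans (row-sum (g 0) (columns A (g 0)))
                                                            (cong (_* f (g 0)) (length-columns (g 0))))
                                                         (go m (g ∘ suc)) ⟩
      len (g 0) * f (g 0) + ∑< m (λ i → len (g (suc i)) * f (g (suc i))) ∎
      where
      open ≡-Reasoning
      f′ = f ∘ proj₁
      xs = map (g 0 ,_) (columns A (g 0))
      ys = concatMap (λ i → map (i ,_) (columns A i)) (applyUpTo (g ∘ suc) m)

  size-formula : size A ≡ ∑< r len
  size-formula = begin
    length (boxes A)                  ≡⟨ length-map (λ _ → 1) (boxes A) ⟨
    length (map (λ _ → 1) (boxes A))  ≡⟨ sum-ones (boxes A) ⟨
    sum (map (λ _ → 1) (boxes A))     ≡⟨ sum-boxes (λ _ → 1) ⟩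
    ∑< r (λ i → len i * 1)            ≡⟨ ∑<-cong r (λ i _ → *-identityʳ (len i)) ⟩
    ∑< r len                          ∎
    where
    open ≡-Reasoning
    sum-ones : ∀ {X : Set} (xs : List X) → sum (map (λ _ → 1) xs) ≡ length (map (λ _ → 1) xs)
    sum-ones []       = refl
    sum-ones (x ∷ xs) = cong suc (sum-ones xs)

  rowLengths : List ℕ
  rowLengths = applyUpTo len r

  module Ribbon (ribbon : IsRibbon A) (elongated : IsElongated A) where

    len≥2 : ∀ i → i < r → 2 ≤ len i
    len≥2 i i<r = subst (2 ≤_) (length-columns i) (elongated i i<r)

    -- The single common column is `ι i`: the first one of row `i` and the last one of row `suc i`.
    o-suc : ∀ i → suc i < r → o (suc i) ≡ suc (ι i)
    o-suc i 1+i<r = begin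
      o (suc i)                   ≡⟨ m+[n∸m]≡n {ι i} (<⇒≤ (m∸n≢0⇒n<m {o (suc i)} {ι i} λ eq → contradiction (trans (sym eq) diff) λ ())) ⟨
      ι i + (o (suc i) ∸ ι i)     ≡⟨ cong (ι i +_) diff ⟩
      ι i + 1                     ≡⟨ +-comm (ι i) 1 ⟩
      suc (ι i)                   ∎
      where
      open ≡-Reasoning
      diff : o (suc i) ∸ ι i ≡ 1
      diff = trans (cong (λ j → o j ∸ ι i) (+-comm 1 i))
                   (trans (sym (overlaps-formula 1 i)) (ribbon i 1+i<r))

    ι-len : ∀ i → i < r → suc (suc (ι i)) ≤ o i
    ι-len i i<r = begin
      2 + ι i          ≤⟨ +-monoˡ-≤ (ι i) (len≥2 i i<r) ⟩
      len i + ι i      ≡⟨ m∸n+n≡m (contained A i) ⟩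
      o i              ∎
      where open ≤-Reasoning

    -- Row `suc i` has at least two boxes, so the column it shares with the row below lies strictly
    -- left of the one it shares with row `i`.
    o-far : ∀ i j → suc (suc i) ≤ j → j < r → o j ≤ ι i
    o-far i j 2+i≤j j<r = begin
      o j             ≤⟨ o-antitone 2+i≤j ⟩
      o (suc (suc i)) ≡⟨ o-suc (suc i) 2+i<r ⟩
      suc (ι (suc i)) ≤⟨ s≤s⁻¹ (≤-trans (ι-len (suc i) (<-trans ≤-refl 2+i<r)) (≤-reflexive (o-suc i (<-trans ≤-refl 2+i<r)))) ⟩
      ι i             ∎
      where
      open ≤-Reasoning
      2+i<r = ≤-<-trans 2+i≤j j<r

    rows-1 : parts (rows 1 A) ↭ rowLengths
    rows-1 = Perm.trans (sort-↭ ≥-decTotalOrder _) (Perm.↭-reflexive (trans (cong (filter (0 <?_)) eq)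
               (filter-all (0 <?_) (All.applyUpTo⁺₁ len r λ i<r → ≤-trans (s≤s z≤n) (len≥2 _ i<r)))))
      where
      eq : map (overlaps A 1) (upTo r) ≡ rowLengths
      eq = trans (map-cong (λ i → trans (overlaps-formula 0 i) (cong (λ j → o j ∸ ι i) (+-identityʳ i))) (upTo r))
                 (map-upTo len r)

    rows-2 : parts (rows 2 A) ↭ applyUpTo (λ _ → 1) (r ∸ 1)
    rows-2 = Perm.trans (sort-↭ ≥-decTotalOrder _) (Perm.↭-reflexive (trans (cong (filter (0 <?_)) eq)
               (filter-all (0 <?_) (All.applyUpTo⁺₂ _ (r ∸ 1) λ _ → ≤-refl))))
      where
      eq : map (overlaps A 2) (upTo (r ∸ 1)) ≡ applyUpTo (λ _ → 1) (r ∸ 1)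
      eq = trans (map-upTo (overlaps A 2) (r ∸ 1)) (applyUpTo-cong (r ∸ 1) λ i i<r∸1 →
             ribbon i (subst (_< r) (+-comm i 1) (m<n∸o⇒m+o<n i 1 i<r∸1)))

    rows-3+ : ∀ k → parts (rows (3 + k) A) ≡ []
    rows-3+ k = ↭-empty-inv (Perm.trans (sort-↭ ≥-decTotalOrder _) (Perm.↭-reflexive
      (trans (cong (filter (0 <?_)) (map-upTo (overlaps A (3 + k)) (r ∸ (2 + k))))
        (filter-none (0 <?_) (All.applyUpTo⁺₁ (overlaps A (3 + k)) (r ∸ (2 + k)) λ {i} i< pos →
          <⇒≢ pos (sym (trans (overlaps-formula (2 + k) i) (m≤n⇒m∸n≡0
            (o-far i (i + (2 + k)) (subst (_≤ i + (2 + k)) (+-comm i 2) (+-monoʳ-≤ i (m≤m+n 2 k)))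
                   (m<n∸o⇒m+o<n i (2 + k) i<))))))))))

-- Tableaux and words

∑<-single : ∀ n {f : ℕ → ℕ} v → v < n → (∀ k → k < n → k ≢ v → f k ≡ 0) → ∑< n f ≡ f v
∑<-single n {f} v v<n f≡0 = begin
  ∑< n f               ≡⟨ +-identityʳ _ ⟨
  ∑< n f + 0           ≡⟨ ∑<-replace n {f} {λ _ → 0} v v<n f≡0 ⟩
  ∑< n (λ _ → 0) + f v ≡⟨ cong (_+ f v) (∑<-zero n) ⟩
  f v                  ∎
  where open ≡-Reasoning

∑Fin-toℕ : ∀ n (f : ℕ → ℕ) → ∑< n f ≡ ∑Fin {n} (f ∘ toℕ)
∑Fin-toℕ zero    f = refl
∑Fin-toℕ (suc n) f = cong (f 0 +_) (∑Fin-toℕ n (f ∘ suc))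

∑Fin-lookup : ∀ {X : Set} (h : X → ℕ) xs → ∑Fin (h ∘ lookup xs) ≡ sum (map h xs)
∑Fin-lookup h []       = refl
∑Fin-lookup h (x ∷ xs) = cong (h x +_) (∑Fin-lookup h xs)

-- If `j` were missed, punching it out would embed `Fin (suc n)` into `Fin n`.
fin-surjective : ∀ {n} (f : Fin n → Fin n) → Injective _≡_ _≡_ f → ∀ j → ∃[ i ] f i ≡ j
fin-surjective {suc n} f inj j with any? (λ i → f i Fin.≟ j)
... | yes found = found
... | no none = contradiction
  (injective⇒≤ {f = λ i → Fin.punchOut (avoids i)} (λ {i} {i′} eq → inj (punchOut-injective (avoids i) (avoids i′) eq))) 1+n≰n
  where
  avoids : ∀ i → j ≢ f i
  avoids i j≡fi = none (i , sym j≡fi)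

lookup-injective : ∀ {X : Set} {xs : List X} → Unique xs → ∀ i j → lookup xs i ≡ lookup xs j → i ≡ j
lookup-injective (_ ∷ _)  Fin.zero    Fin.zero    eq = refl
lookup-injective (x∉ ∷ _) Fin.zero    (Fin.suc j) eq = contradiction eq (All.lookup x∉ (∈-lookup j))
lookup-injective (x∉ ∷ _) (Fin.suc i) Fin.zero    eq = contradiction (sym eq) (All.lookup x∉ (∈-lookup i))
lookup-injective (_ ∷ u)  (Fin.suc i) (Fin.suc j) eq = cong Fin.suc (lookup-injective u i j eq)

-- This locates the entry of a box with `j` boxes to its left in row `v`.
occurrence : ∀ w v n j → j < cnt w v n → ∃[ e ] e < n × w e ≡ v × cnt w v e ≡ j
occurrence w v (suc n) j j< with j <? cnt w v n
... | yes j<cnt = let e , e<n , we , eq = occurrence w v n j j<cnt in e , m<n⇒m<1+n e<n , we , eq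
... | no j≮cnt with w n ≟ v
...   | yes wn≡v = n , ≤-refl , wn≡v , ≤-antisym (≮⇒≥ j≮cnt) (s≤s⁻¹ (begin
          suc j                 ≤⟨ j< ⟩
          cnt w v (suc n)       ≡⟨ ∑<-last n (λ p → δ (w p) v) ⟩
          cnt w v n + δ (w n) v ≡⟨ cong (cnt w v n +_) (δ-≡ wn≡v) ⟩
          cnt w v n + 1         ≡⟨ +-comm _ 1 ⟩
          suc (cnt w v n)       ∎))
  where open ≤-Reasoning
...   | no wn≢v = contradiction (begin
          suc j                 ≤⟨ j< ⟩
          cnt w v (suc n)       ≡⟨ ∑<-last n (λ p → δ (w p) v) ⟩
          cnt w v n + δ (w n) v ≡⟨ cong (cnt w v n +_) (δ-≢ wn≢v) ⟩
          cnt w v n + 0         ≡⟨ +-identityʳ _ ⟩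
          cnt w v n             ∎) j≮cnt
  where open ≤-Reasoning

cnt-mono : ∀ w v {m n} → m ≤ n → cnt w v m ≤ cnt w v n
cnt-mono w v {m} {n} m≤n = begin
  cnt w v m              ≤⟨ m≤m+n _ _ ⟩
  cnt w v m + _          ≡⟨ ∑<-+ m (n ∸ m) (λ p → δ (w p) v) ⟨
  cnt w v (m + (n ∸ m))  ≡⟨ cong (cnt w v) (m+[n∸m]≡n m≤n) ⟩
  cnt w v n              ∎
  where open ≤-Reasoning

cnt-strict : ∀ w v {m n} → w m ≡ v → m < n → cnt w v m < cnt w v n
cnt-strict w v {m} {n} wm≡v m<n = begin
  suc (cnt w v m)        ≡⟨ +-comm 1 _ ⟩
  cnt w v m + 1          ≡⟨ cong (cnt w v m +_) (δ-≡ wm≡v) ⟨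
  cnt w v m + δ (w m) v  ≡⟨ ∑<-last m (λ p → δ (w p) v) ⟨
  cnt w v (suc m)        ≤⟨ cnt-mono w v m<n ⟩
  cnt w v n              ∎
  where open ≤-Reasoning

filter-cong : ∀ {X : Set} {P Q : X → Set} (P? : Decidable P) (Q? : Decidable Q) xs →
  (∀ x → x ∈ xs → (P x → Q x) × (Q x → P x)) → filter P? xs ≡ filter Q? xs
filter-cong P? Q? []       P⇔Q = refl
filter-cong P? Q? (x ∷ xs) P⇔Q with P? x
... | yes Px = trans (cong (x ∷_) (filter-cong P? Q? xs (λ y → P⇔Q y ∘ there)))
                     (sym (filter-accept Q? (proj₁ (P⇔Q x (here refl)) Px)))
... | no ¬Px = trans (filter-cong P? Q? xs (λ y → P⇔Q y ∘ there))
                     (sym (filter-reject Q? (¬Px ∘ proj₂ (P⇔Q x (here refl)))))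

-- Entries count from 1 and positions from 0: the index `i` compares the rows of the entries `i` and
-- `i + 1`, to match `IsDescent`.
IsAsc : (ℕ → ℕ) → ℕ → Set
IsAsc w i = w (i ∸ 1) < w i

asc? : ∀ w → Decidable (IsAsc w)
asc? w i = w (i ∸ 1) <? w i

ascents : ℕ → (ℕ → ℕ) → List ℕ
ascents n w = filter (asc? w) (applyUpTo suc (n ∸ 1))

ascComp : ℕ → (ℕ → ℕ) → List ℕ
ascComp n w = fromSet n (ascents n w)

∈-interval⁻ : ∀ n {i} → i ∈ applyUpTo suc (n ∸ 1) → ∃[ e ] suc e < n × i ≡ suc e
∈-interval⁻ n i∈ with ∈-applyUpTo⁻ suc i∈
... | e , e<n∸1 , refl = e , subst (_< n) (+-comm e 1) (m<n∸o⇒m+o<n e 1 e<n∸1) , refl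

∈-interval⁺ : ∀ n {e} → suc e < n → suc e ∈ applyUpTo suc (n ∸ 1)
∈-interval⁺ (suc n) (s<s e<n) = ∈-applyUpTo⁺ suc e<n

∈-ascents⁺ : ∀ n w {e} → suc e < n → w e < w (suc e) → suc e ∈ ascents n w
∈-ascents⁺ n w {e} 1+e<n lt =
  ∈-filter⁺ {P = IsAsc w} (asc? w) {suc e} {applyUpTo suc (n ∸ 1)} (∈-interval⁺ n 1+e<n) lt

∈-ascents⁻ : ∀ n w {i} → i ∈ ascents n w → i ∈ applyUpTo suc (n ∸ 1) × IsAsc w i
∈-ascents⁻ n w {i} i∈ = ∈-filter⁻ {P = IsAsc w} (asc? w) {i} {applyUpTo suc (n ∸ 1)} i∈

ascents-cong : ∀ {n w w′} → SameAsc n w w′ → ascents n w ≡ ascents n w′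
ascents-cong {n} {w} {w′} same =
  filter-cong {P = IsAsc w} {Q = IsAsc w′} (asc? w) (asc? w′) (applyUpTo suc (n ∸ 1))
    λ i i∈ → pointwise (∈-interval⁻ n i∈)
  where
  pointwise : ∀ {i} → ∃[ e ] suc e < n × i ≡ suc e → (IsAsc w i → IsAsc w′ i) × (IsAsc w′ i → IsAsc w i)
  pointwise (e , 1+e<n , refl) = same e 1+e<n

ascents-cong⁻ : ∀ {n w w′} → ascents n w ≡ ascents n w′ → SameAsc n w w′
ascents-cong⁻ {n} {w} {w′} eq e 1+e<n =
    (λ lt → proj₂ (∈-ascents⁻ n w′ (subst (suc e ∈_) eq (∈-ascents⁺ n w 1+e<n lt))))
  , (λ lt → proj₂ (∈-ascents⁻ n w (subst (suc e ∈_) (sym eq) (∈-ascents⁺ n w′ 1+e<n lt))))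

ascent-range : ∀ n w {i} → i ∈ ascents n w → 0 < i × i < n
ascent-range n w i∈ with ∈-interval⁻ n (proj₁ (∈-ascents⁻ n w i∈))
... | e , 1+e<n , refl = z<s , 1+e<n

ascents-increasing : ∀ n w → AllPairs _<_ (0 ∷ ascents n w)
ascents-increasing n w =
  All.tabulate (λ {i} i∈ → proj₁ (ascent-range n w {i} i∈))
  ∷ AllPairs.filter⁺ {P = IsAsc w} (asc? w) (AllPairs.applyUpTo⁺₁ suc (n ∸ 1) λ i<j _ → s<s i<j)

-- In increasing lists the differences are not truncated, so each of them determines the next
-- element.
differences-injective : ∀ n d ds ds′ → AllPairs _<_ (d ∷ ds) → AllPairs _<_ (d ∷ ds′) →
  zipWith _∸_ (ds ++ [ n ]) (d ∷ ds) ≡ zipWith _∸_ (ds′ ++ [ n ]) (d ∷ ds′) → ds ≡ ds′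
differences-injective n d [] [] _ _ eq = refl
differences-injective n d [] (_ ∷ [])    _ _ ()
differences-injective n d [] (_ ∷ _ ∷ _) _ _ ()
differences-injective n d (_ ∷ [])    [] _ _ ()
differences-injective n d (_ ∷ _ ∷ _) [] _ _ ()
differences-injective n d (e ∷ ds) (e′ ∷ ds′) ((d<e ∷ _) ∷ inc) ((d<e′ ∷ _) ∷ inc′) eq
  with refl ← ∸-cancelʳ-≡ (<⇒≤ d<e) (<⇒≤ d<e′) (proj₁ (∷-injective eq)) =
  cong (e ∷_) (differences-injective n e ds ds′ inc inc′ (proj₂ (∷-injective eq)))

ascComp-injective : ∀ {n w w′} → ascComp n w ≡ ascComp n w′ → SameAsc n w w′
ascComp-injective {zero}  _  _ ()
ascComp-injective {suc n} {w} {w′} eq = ascents-cong⁻ {suc n} {w} {w′} (differences-injective (suc n) 0 (ascents (suc n) w) (ascents (suc n) w′)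
  (ascents-increasing (suc n) w) (ascents-increasing (suc n) w′) eq)

module Tableaux (A : SkewShape) (ribbon : IsRibbon A) (elongated : IsElongated A) where

  open Shape A
  open Ribbon ribbon elongated

  n : ℕ
  n = size A

  record RowWord (w : ℕ → ℕ) : Set where
    field
      word    : RibbonWord r n w
      content : ∀ v → v < r → cnt w v n ≡ len v

  box-∈ : ∀ p → (row A p , col A p) ∈ boxes A
  box-∈ p = ∈-lookup p

  row<r : ∀ p → row A p < r
  row<r p = proj₁ (∈-boxes⁻ (box-∈ p))

  ι≤col : ∀ p → ι (row A p) ≤ col A p
  ι≤col p = proj₁ (proj₂ (∈-boxes⁻ (box-∈ p)))

  col<o : ∀ p → col A p < o (row A p)
  col<o p = proj₂ (proj₂ (∈-boxes⁻ (box-∈ p)))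

  abstract
    box-at : ∀ {i c} → i < r → ι i ≤ c → c < o i → ∃[ p ] row A p ≡ i × col A p ≡ c
    box-at {i} {c} i<r ι≤c c<o = Any.index b∈ , cong proj₁ (sym found) , cong proj₂ (sym found)
      where
      b∈ : (i , c) ∈ boxes A
      b∈ = ∈-boxes⁺ i<r ι≤c c<o
      found : (i , c) ≡ lookup (boxes A) (Any.index b∈)
      found = Any.lookup-index b∈

  box-injective : ∀ p q → row A p ≡ row A q → col A p ≡ col A q → p ≡ q
  box-injective p q eq eq′ = lookup-injective boxes-unique p q (cong₂ _,_ eq eq′)

  Fits : Filling A → (ℕ → ℕ) → Set
  Fits T w = ∀ p → w (toℕ (Vec.lookup T p)) ≡ row A p

  module _ {T : Filling A} (syt : IsSYT A T) where

    private
      T-injective : Injective _≡_ _≡_ (Vec.lookup T)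
      T-injective {p} {q} eq = proj₁ syt p q (cong (suc ∘ toℕ) eq)

    T⁻¹ : Fin n → Fin n
    T⁻¹ e = proj₁ (fin-surjective (Vec.lookup T) T-injective e)

    T-T⁻¹ : ∀ e → Vec.lookup T (T⁻¹ e) ≡ e
    T-T⁻¹ e = proj₂ (fin-surjective (Vec.lookup T) T-injective e)

    T⁻¹-T : ∀ p → T⁻¹ (Vec.lookup T p) ≡ p
    T⁻¹-T p = T-injective (T-T⁻¹ _)

    comp-fits : ∀ {w} → Fits T w → comp A T ≡ ascComp n w
    comp-fits {w} fits = cong (fromSet n) (filter-cong {P = IsDescent A T} {Q = IsAsc w}
      (isDescent? A T) (asc? w) (applyUpTo suc (n ∸ 1)) λ i i∈ → pointwise (∈-interval⁻ n i∈))
      where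
      pointwise : ∀ {i} → ∃[ e ] suc e < n × i ≡ suc e →
                  (IsDescent A T i → IsAsc w i) × (IsAsc w i → IsDescent A T i)
      pointwise (e , 1+e<n , refl) = to , from
        where
        to : IsDescent A T (suc e) → w e < w (suc e)
        to (p , q , Tp , Tq , lt) = subst₂ _<_
          (trans (sym (fits p)) (cong w (suc-injective Tp)))
          (trans (sym (fits q)) (cong w (suc-injective Tq))) lt
        e<n = <-trans ≤-refl 1+e<n
        at : ∀ {k} (k<n : k < n) → toℕ (Vec.lookup T (T⁻¹ (fromℕ< k<n))) ≡ k
        at k<n = trans (cong toℕ (T-T⁻¹ _)) (toℕ-fromℕ< k<n)
        from : w e < w (suc e) → IsDescent A T (suc e)
        from lt = T⁻¹ (fromℕ< e<n) , T⁻¹ (fromℕ< 1+e<n) , cong suc (at e<n) , cong suc (at 1+e<n)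
                , subst₂ _<_ (trans (cong w (sym (at e<n))) (fits _)) (trans (cong w (sym (at 1+e<n))) (fits _)) lt

    rowOf : ℕ → ℕ
    rowOf e with e <? n
    ... | yes e<n = row A (T⁻¹ (fromℕ< e<n))
    -- An arbitrary value: the conditions on words concern positions below `n` only.
    ... | no _    = 0

    rowOf-toℕ : ∀ e → rowOf (toℕ e) ≡ row A (T⁻¹ e)
    rowOf-toℕ e with toℕ e <? n
    ... | yes e<n = cong (row A ∘ T⁻¹) (fromℕ<-toℕ e e<n)
    ... | no e≮n  = contradiction (toℕ<n e) e≮n

    rowOf-fits : Fits T rowOf
    rowOf-fits p = trans (rowOf-toℕ _) (cong (row A) (T⁻¹-T p))

    rowOf-word : RowWord rowOf
    rowOf-word = record
      { word = record { bounded = bounded′ ; linked = linked′ }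
      ; content = content′
      }
      where
      open ≡-Reasoning
      bounded′ : ∀ e → e < n → rowOf e < r
      bounded′ e e<n = subst (_< r) (trans (sym (rowOf-toℕ _)) (cong rowOf (toℕ-fromℕ< e<n))) (row<r (T⁻¹ (fromℕ< e<n)))
      linked′ : ∀ i → suc i < r → Before n rowOf i (suc i)
      linked′ i 1+i<r = at-boxes
        (box-at {i} {ι i} i<r ≤-refl (<-trans ≤-refl (ι-len i i<r)))
        (box-at {suc i} {ι i} 1+i<r (ι-antitone (n≤1+n i)) (≤-reflexive (sym (o-suc i 1+i<r))))
        where
        i<r : i < r
        i<r = <-trans ≤-refl 1+i<r
        at-boxes : ∃[ p ] row A p ≡ i × col A p ≡ ι i → ∃[ q ] row A q ≡ suc i × col A q ≡ ι i →
                   Before n rowOf i (suc i)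
        at-boxes (p , rp , cp) (q , rq , cq) = toℕ (Vec.lookup T p) , toℕ (Vec.lookup T q)
          , s<s⁻¹ (proj₂ (proj₂ syt) p q (trans cp (sym cq)) (subst₂ _<_ (sym rp) (sym rq) ≤-refl))
          , toℕ<n _ , trans (rowOf-fits p) rp , trans (rowOf-fits q) rq
      -- Reindexing along the bijection given by `T` replaces the count over entries by one over
      -- boxes.
      content′ : ∀ v → v < r → cnt rowOf v n ≡ len v
      content′ v v<r = begin
        cnt rowOf v n                           ≡⟨ ∑Fin-toℕ n (λ e → δ (rowOf e) v) ⟩
        ∑Fin {n} (λ e → δ (rowOf (toℕ e)) v)        ≡⟨ sum-permute {n} {n} (λ e → δ (rowOf (toℕ e)) v)
                                                     (permutation (Vec.lookup T) T⁻¹ T-T⁻¹ T⁻¹-T) ⟩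
        ∑Fin {n} (λ p → δ (rowOf (toℕ (Vec.lookup T p))) v) ≡⟨ sum-cong-≗ {n} (λ p → cong (λ i → δ i v) (rowOf-fits p)) ⟩
        ∑Fin {n} (λ p → δ (row A p) v)              ≡⟨ ∑Fin-lookup (λ b → δ (proj₁ b) v) (boxes A) ⟩
        sum (map (λ b → δ (proj₁ b) v) (boxes A)) ≡⟨ sum-boxes (λ i → δ i v) ⟩
        ∑< r (λ i → len i * δ i v)              ≡⟨ ∑<-single r v v<r (λ k _ k≢v →
                                                     trans (cong (len k *_) (δ-≢ k≢v)) (*-zeroʳ (len k))) ⟩
        len v * δ v v                           ≡⟨ cong (len v *_) (δ-refl v) ⟩
        len v * 1                               ≡⟨ *-identityʳ _ ⟩
        len v                                   ∎

  module _ {w : ℕ → ℕ} (W : RowWord w) where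

    private
      module W = RowWord W

      index : Fin n → ℕ
      index p = col A p ∸ ι (row A p)

      occ : ∀ p → ∃[ e ] e < n × w e ≡ row A p × cnt w (row A p) e ≡ index p
      occ p = occurrence w (row A p) n (index p)
        (subst (index p <_) (sym (W.content (row A p) (row<r p))) (∸-monoˡ-< (col<o p) (ι≤col p)))

      pos : Fin n → ℕ
      pos p = proj₁ (occ p)
      pos<n : ∀ p → pos p < n
      pos<n p = proj₁ (proj₂ (occ p))
      w-pos : ∀ p → w (pos p) ≡ row A p
      w-pos p = proj₁ (proj₂ (proj₂ (occ p)))
      cnt-pos′ : ∀ p → cnt w (row A p) (pos p) ≡ index p
      cnt-pos′ p = proj₂ (proj₂ (proj₂ (occ p)))

    -- Rows have to increase, so the boxes of row `i` must receive the occurrences of `i` in order;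
    -- the box with `j` boxes to its left gets the one preceded by `j` others.
    fill : Filling A
    fill = Vec.tabulate (λ p → fromℕ< (pos<n p))

    toℕ-fill : ∀ p → toℕ (Vec.lookup fill p) ≡ pos p
    toℕ-fill p = trans (cong toℕ (lookup∘tabulate _ p)) (toℕ-fromℕ< (pos<n p))

    fill-fits : Fits fill w
    fill-fits p = trans (cong w (toℕ-fill p)) (w-pos p)

    fill-syt : IsSYT A fill
    fill-syt = inj , rows< , cols<
      where
      inj : ∀ p q → entry A fill p ≡ entry A fill q → p ≡ q
      inj p q eq = box-injective p q row≡ (∸-cancelʳ-≡ (ι≤col p) (subst (λ i → ι i ≤ col A q) (sym row≡) (ι≤col q)) (begin
          col A p ∸ ι (row A p)      ≡⟨ cnt-pos′ p ⟨
          cnt w (row A p) (pos p)    ≡⟨ cong₂ (cnt w) row≡ pos≡ ⟩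
          cnt w (row A q) (pos q)    ≡⟨ cnt-pos′ q ⟩
          col A q ∸ ι (row A q)      ≡⟨ cong (λ i → col A q ∸ ι i) (sym row≡) ⟩
          col A q ∸ ι (row A p)      ∎))
        where
        open ≡-Reasoning
        pos≡ : pos p ≡ pos q
        pos≡ = trans (sym (toℕ-fill p)) (trans (suc-injective eq) (toℕ-fill q))
        row≡ : row A p ≡ row A q
        row≡ = trans (sym (w-pos p)) (trans (cong w pos≡) (w-pos q))
      lift : ∀ p q → pos p < pos q → entry A fill p < entry A fill q
      lift p q lt = s<s (subst₂ _<_ (sym (toℕ-fill p)) (sym (toℕ-fill q)) lt)
      rows< : ∀ p q → row A p ≡ row A q → col A p < col A q → entry A fill p < entry A fill q
      rows< p q row≡ col< = lift p q (≰⇒> λ q≤p → <⇒≱ (∸-monoˡ-< col< (ι≤col p)) (begin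
          col A q ∸ ι (row A p)      ≡⟨ cong (λ i → col A q ∸ ι i) row≡ ⟩
          col A q ∸ ι (row A q)      ≡⟨ cnt-pos′ q ⟨
          cnt w (row A q) (pos q)    ≤⟨ cnt-mono w (row A q) q≤p ⟩
          cnt w (row A q) (pos p)    ≡⟨ cong (λ i → cnt w i (pos p)) row≡ ⟨
          cnt w (row A p) (pos p)    ≡⟨ cnt-pos′ p ⟩
          col A p ∸ ι (row A p)      ∎))
        where open ≤-Reasoning
      -- By `o-far` the two rows are adjacent, so `p` is the first box of row `i` and `q` the last
      -- of row `suc i`. They hold the first `i` and the last `suc i` of the word, and the link lies
      -- between these.
      cols< : ∀ p q → col A p ≡ col A q → row A p < row A q → entry A fill p < entry A fill q
      cols< p q col≡ row< = lift p q (≤-<-trans p≤a (<-≤-trans (proj₁ (proj₂ (proj₂ link))) b≤q))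
        where
        open ≤-Reasoning
        i = row A p
        row-q : row A q ≡ suc i
        row-q with m≤n⇒m<n∨m≡n row<
        ... | inj₂ eq = sym eq
        ... | inj₁ far = contradiction (<-≤-trans (col<o q) (o-far i (row A q) far (row<r q)))
                           (≤⇒≯ (subst (ι i ≤_) col≡ (ι≤col p)) )
        1+i<r : suc i < r
        1+i<r = subst (_< r) row-q (row<r q)
        col-p : col A p ≡ ι i
        col-p = ≤-antisym (s≤s⁻¹ (subst₂ _<_ (sym col≡) (trans (cong o row-q) (o-suc i 1+i<r)) (col<o q))) (ι≤col p)
        link = W.word .linked i 1+i<r
        a = proj₁ link
        b = proj₁ (proj₂ link)
        b<n = proj₁ (proj₂ (proj₂ (proj₂ link)))
        wa = proj₁ (proj₂ (proj₂ (proj₂ (proj₂ link))))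
        wb = proj₂ (proj₂ (proj₂ (proj₂ (proj₂ link))))
        p≤a : pos p ≤ a
        p≤a = ≮⇒≥ λ a<p → contradiction (cnt-strict w i wa a<p)
                (subst (λ k → ¬ cnt w i a < k) (sym (trans (cnt-pos′ p) (m≤n⇒m∸n≡0 (≤-reflexive col-p)))) λ ())
        b≤q : b ≤ pos q
        b≤q = ≮⇒≥ λ q<b → <-irrefl refl (begin-strict
          suc (index q)              ≡⟨ cong suc (cnt-pos′ q) ⟨
          suc (cnt w (row A q) (pos q)) ≤⟨ cnt-strict w (row A q) (w-pos q) q<b ⟩
          cnt w (row A q) b          <⟨ cnt-strict w (row A q) (trans wb (sym row-q)) b<n ⟩
          cnt w (row A q) n          ≡⟨ W.content (row A q) (row<r q) ⟩
          o (row A q) ∸ ι (row A q)  ≡⟨ cong (λ k → k ∸ ι (row A q)) (trans (cong o row-q) (o-suc i 1+i<r)) ⟩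
          suc (ι i) ∸ ι (row A q)    ≡⟨ cong (λ k → suc k ∸ ι (row A q)) (trans (sym col-p) col≡) ⟩
          suc (col A q) ∸ ι (row A q) ≡⟨ +-∸-assoc 1 (ι≤col q) ⟩
          suc (index q)              ∎)

-- Compositions and quasisymmetric functions

_≟ᴸ_ : (α β : List ℕ) → Dec (α ≡ β)
_≟ᴸ_ = ≡-dec _≟_

extensions : List ℕ → List (List ℕ)
extensions α = (1 ∷ α) ∷ enlarge α

∈-compositions⁺ : ∀ n α → All (0 <_) α → sum α ≡ n → α ∈ compositions n
∈-compositions⁺ zero    []                _          eq = here refl
∈-compositions⁺ zero    (zero ∷ α)        (() ∷ _)   eq
∈-compositions⁺ zero    (suc a ∷ α)       _          ()
∈-compositions⁺ (suc n) []                _          ()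
∈-compositions⁺ (suc n) (zero ∷ α)        (() ∷ _)   eq
∈-compositions⁺ (suc n) (suc zero ∷ α)    (_ ∷ pos)  eq =
  ∈-concatMap⁺ extensions (Any.map (λ { refl → here refl }) (∈-compositions⁺ n α pos (suc-injective eq)))
∈-compositions⁺ (suc n) (suc (suc a) ∷ α) (_ ∷ pos)  eq =
  ∈-concatMap⁺ extensions (Any.map (λ { refl → there (here refl) })
    (∈-compositions⁺ n (suc a ∷ α) (z<s ∷ pos) (suc-injective eq)))

∈-compositions⁻ : ∀ n {α} → α ∈ compositions n → All (0 <_) α × sum α ≡ n
∈-compositions⁻ zero    (here refl) = [] , refl
∈-compositions⁻ (suc n) {α} α∈ = go (compositions n) (∈-compositions⁻ n) (∈-concatMap⁻ extensions α∈)
  where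
  go : ∀ βs → (∀ {β} → β ∈ βs → All (0 <_) β × sum β ≡ n) → Any (λ β → α ∈ extensions β) βs →
       All (0 <_) α × sum α ≡ suc n
  go (β ∷ _) prop (here (here refl)) = let pos , eq = prop (here refl) in z<s ∷ pos , cong suc eq
  go ((b ∷ β) ∷ _) prop (here (there (here refl))) with prop (here refl)
  ... | _ ∷ pos , eq = z<s ∷ pos , cong suc eq
  go (_ ∷ βs) prop (there any) = go βs (prop ∘ there) any

compositions-unique : ∀ n → Unique (compositions n)
compositions-unique zero    = [] ∷ []
compositions-unique (suc n) = concatMap-unique extensions shorten (compositions n) inverse distinct (compositions-unique n)
  where
  -- A common left inverse of both ways to extend a composition: a leading 1 is dropped, a larger
  -- first part is diminished.
  shorten : List ℕ → List ℕ
  shorten (suc (suc a) ∷ α) = suc a ∷ α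
  shorten (_ ∷ α)           = α
  shorten []                = []
  inverse : ∀ α → α ∈ compositions n → ∀ β → β ∈ extensions α → shorten β ≡ α
  inverse α _ _ (here refl) = refl
  inverse (a ∷ α) α∈ _ (there (here refl)) with ∈-compositions⁻ n α∈
  ... | z<s ∷ _ , _ = refl
  distinct : ∀ α → α ∈ compositions n → Unique (extensions α)
  distinct []      _ = [] ∷ []
  distinct (a ∷ α) _ = ((λ eq → 1+n≢n (cong length (∷-injectiveʳ eq))) ∷ []) ∷ ([] ∷ [])

S-positive : ∀ {α} → All (0 <_) α → All (0 <_) (S α)
S-positive []            = []
S-positive (_ ∷ [])      = []
S-positive {a ∷ _} (p ∷ q ∷ ps) = p ∷ All.map⁺ (All.map (λ _ → <-≤-trans p (m≤m+n a _)) (S-positive (q ∷ ps)))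

S-increasing : ∀ {α} → All (0 <_) α → AllPairs _<_ (S α)
S-increasing []       = []
S-increasing (_ ∷ []) = []
S-increasing {a ∷ _} (p ∷ q ∷ ps) =
  All.map⁺ (All.map (m<m+n a) (S-positive (q ∷ ps))) ∷
  AllPairs.map⁺ (AllPairs.map (+-monoʳ-< a) (S-increasing (q ∷ ps)))

S-injective : ∀ {α β} → All (0 <_) α → All (0 <_) β → sum α ≡ sum β → S α ≡ S β → α ≡ β
S-injective []           []           _    _  = refl
S-injective []           (z<s ∷ _)    ()   _
S-injective (z<s ∷ _)    []           ()   _
S-injective {a ∷ []} {b ∷ []} (_ ∷ []) (_ ∷ []) sums _ =
  cong [_] (trans (sym (+-identityʳ a)) (trans sums (+-identityʳ b)))
S-injective (_ ∷ [])     (_ ∷ _ ∷ _)  _    ()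
S-injective (_ ∷ _ ∷ _)  (_ ∷ [])     _    ()
S-injective {a ∷ _ ∷ _} {b ∷ β@(_ ∷ _)} (_ ∷ p ∷ ps) (_ ∷ q ∷ qs) sums eq =
  cong₂ _∷_ a≡b (S-injective (p ∷ ps) (q ∷ qs)
    (+-cancelˡ-≡ a _ _ (trans sums (cong (_+ sum β) (sym a≡b))))
    (map-injective (+-cancelˡ-≡ a _ _) (trans (∷-injectiveʳ eq) (cong (λ c → map (λ k → c + k) (S β)) (sym a≡b)))))
  where
  a≡b : a ≡ b
  a≡b = ∷-injectiveˡ eq

-- Read as sets, a proper subset is strictly smaller; this makes the induction in `F-independent`
-- descend.
increasing-⊆ : ∀ {xs ys} → AllPairs _<_ xs → AllPairs _<_ ys → xs ⊆ ys → length xs < length ys ⊎ xs ≡ ys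
increasing-⊆ {[]}     {[]}     _ _ _ = inj₂ refl
increasing-⊆ {[]}     {y ∷ ys} _ _ _ = inj₁ z<s
increasing-⊆ {x ∷ xs} {[]}     _ _ sub with () ← sub (here refl)
increasing-⊆ {x ∷ xs} {y ∷ ys} (x< ∷ inc) (y< ∷ inc′) sub with x ≟ y
... | yes refl with increasing-⊆ inc inc′ (λ z∈ → drop-head (All.lookup x< z∈) (sub (there z∈)))
  where
  drop-head : ∀ {z} → x < z → z ∈ x ∷ ys → z ∈ ys
  drop-head x<z (here refl) = contradiction refl (<⇒≢ x<z)
  drop-head x<z (there z∈)  = z∈
...   | inj₁ lt = inj₁ (s<s lt)
...   | inj₂ eq = inj₂ (cong (x ∷_) eq)
increasing-⊆ {x ∷ xs} {y ∷ ys} (x< ∷ inc) (y< ∷ inc′) sub | no x≢y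
  with increasing-⊆ (x< ∷ inc) inc′ sub′
  where
  y<x : y < x
  y<x with sub (here refl)
  ... | here x≡y  = contradiction x≡y x≢y
  ... | there x∈ = All.lookup y< x∈
  drop-head : ∀ {z} → y < z → z ∈ y ∷ ys → z ∈ ys
  drop-head y<z (here refl) = contradiction refl (<⇒≢ y<z)
  drop-head y<z (there z∈)  = z∈
  sub′ : x ∷ xs ⊆ ys
  sub′ (here refl) = drop-head y<x (sub (here refl))
  sub′ (there z∈)  = drop-head (<-trans y<x (All.lookup x< z∈)) (sub (there z∈))
... | inj₁ lt = inj₁ (<-trans lt ≤-refl)
... | inj₂ eq = inj₁ (s≤s (≤-reflexive (cong length eq)))

∑ℤ : ∀ {X : Set} → List X → (X → ℤ) → ℤ
∑ℤ xs f = foldr ℤ._+_ 0ℤ (map f xs)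

∑ℤ-cong : ∀ {X : Set} (xs : List X) {f g : X → ℤ} → (∀ x → x ∈ xs → f x ≡ g x) → ∑ℤ xs f ≡ ∑ℤ xs g
∑ℤ-cong []       f≡g = refl
∑ℤ-cong (x ∷ xs) f≡g = cong₂ ℤ._+_ (f≡g x (here refl)) (∑ℤ-cong xs (λ y → f≡g y ∘ there))

∑ℤ-zero : ∀ {X : Set} (xs : List X) {f : X → ℤ} → (∀ x → x ∈ xs → f x ≡ 0ℤ) → ∑ℤ xs f ≡ 0ℤ
∑ℤ-zero []       f≡0 = refl
∑ℤ-zero (x ∷ xs) f≡0 = cong₂ ℤ._+_ (f≡0 x (here refl)) (∑ℤ-zero xs (λ y → f≡0 y ∘ there))

∑ℤ-single : ∀ {X : Set} {xs : List X} {f : X → ℤ} {x} → Unique xs → x ∈ xs →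
            (∀ y → y ∈ xs → y ≢ x → f y ≡ 0ℤ) → ∑ℤ xs f ≡ f x
∑ℤ-single {xs = x ∷ xs} {f} (x∉ ∷ _) (here refl) f≡0 =
  trans (cong (ℤ._+_ (f x)) (∑ℤ-zero xs λ y y∈ → f≡0 y (there y∈) (All.lookup x∉ y∈ ∘ sym))) (ℤ.+-identityʳ (f x))
∑ℤ-single {xs = y ∷ xs} {f} (y∉ ∷ u) (there x∈) f≡0 =
  trans (cong₂ ℤ._+_ (f≡0 y (here refl) (All.lookup y∉ x∈)) (∑ℤ-single {f = f} u x∈ (λ z → f≡0 z ∘ there)))
        (ℤ.+-identityˡ _)

∑ℤ-+ : ∀ {X : Set} (xs : List X) (f g : X → ℤ) → ∑ℤ xs (λ x → f x ℤ.+ g x) ≡ ∑ℤ xs f ℤ.+ ∑ℤ xs g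
∑ℤ-+ []       f g = refl
∑ℤ-+ (x ∷ xs) f g = begin
  (f x ℤ.+ g x) ℤ.+ ∑ℤ xs (λ x → f x ℤ.+ g x)      ≡⟨ cong (ℤ._+_ (f x ℤ.+ g x)) (∑ℤ-+ xs f g) ⟩
  (f x ℤ.+ g x) ℤ.+ (∑ℤ xs f ℤ.+ ∑ℤ xs g)          ≡⟨ interchange (f x) (g x) (∑ℤ xs f) (∑ℤ xs g) ⟩
  (f x ℤ.+ ∑ℤ xs f) ℤ.+ (g x ℤ.+ ∑ℤ xs g)          ∎
  where
  open ≡-Reasoning

∑ℤ-cancel : ∀ {X : Set} {xs : List X} {f g : X → ℤ} {x} → Unique xs → x ∈ xs →
            (∀ y → y ∈ xs → y ≢ x → f y ≡ g y) → ∑ℤ xs f ≡ ∑ℤ xs g → f x ≡ g x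
∑ℤ-cancel {xs = x ∷ xs} {f} {g} (x∉ ∷ _) (here refl) f≡g sums =
  ∙-cancelʳ (∑ℤ xs g) (f x) (g x)
    (trans (cong (ℤ._+_ (f x)) (sym (∑ℤ-cong xs λ y y∈ → f≡g y (there y∈) (All.lookup x∉ y∈ ∘ sym)))) sums)
∑ℤ-cancel {xs = y ∷ xs} {f} {g} (y∉ ∷ u) (there x∈) f≡g sums =
  ∑ℤ-cancel {f = f} {g} u x∈ (λ z → f≡g z ∘ there)
    (∙-cancelˡ (g y) (∑ℤ xs f) (∑ℤ xs g)
      (trans (cong (ℤ._+ ∑ℤ xs f) (sym (f≡g y (here refl) (All.lookup y∉ x∈)))) sums))

-- Linear independence of the fundamental quasisymmetric functions

module _ (n : ℕ) where

  private
    C = compositions n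

    positive′ : ∀ {α} → α ∈ C → All (0 <_) α
    positive′ = proj₁ ∘ ∈-compositions⁻ n

    sum′ : ∀ {α} → α ∈ C → sum α ≡ n
    sum′ = proj₂ ∘ ∈-compositions⁻ n

  M-diagonal : ∀ {γ} → All (0 <_) γ → M γ γ ≡ 1ℤ
  M-diagonal {γ} pos = cong (if_then 1ℤ else 0ℤ) (dec-true (filter (0 <?_) γ ≟ᴸ γ) (filter-all (0 <?_) pos))

  M-off-diagonal : ∀ {γ δ} → All (0 <_) γ → δ ≢ γ → M δ γ ≡ 0ℤ
  M-off-diagonal {γ} {δ} pos δ≢γ = cong (if_then 1ℤ else 0ℤ)
    (dec-false (filter (0 <?_) γ ≟ᴸ δ) (λ eq → δ≢γ (trans (sym eq) (filter-all (0 <?_) pos))))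

  finer? : ∀ β → Decidable (λ γ → S β ⊆ S γ)
  finer? β γ = _⊆?_ _≟_ (S β) (S γ)

  F-diagonal : ∀ {γ} → γ ∈ C → F γ γ ≡ 1ℤ
  F-diagonal {γ} γ∈ = trans
    (∑ℤ-single {f = λ δ → M δ γ} (Unique.filter⁺ (finer? γ) (compositions-unique (sum γ)))
      (∈-filter⁺ (finer? γ) (subst (λ m → γ ∈ compositions m) (sym (sum′ γ∈)) γ∈) id)
      (λ δ _ → M-off-diagonal (positive′ γ∈)))
    (M-diagonal (positive′ γ∈))

  F-not-finer : ∀ {β γ} → γ ∈ C → ¬ (S β ⊆ S γ) → F β γ ≡ 0ℤ
  F-not-finer {β} {γ} γ∈ not = ∑ℤ-zero (filter (finer? β) (compositions (sum β))) λ δ δ∈ →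
    M-off-diagonal (positive′ γ∈) (λ { refl → not (proj₂ (∈-filter⁻ (finer? β) {xs = compositions (sum β)} δ∈)) })

  coarser-shorter : ∀ {β γ} → β ∈ C → γ ∈ C → β ≢ γ → S β ⊆ S γ → length (S β) < length (S γ)
  coarser-shorter β∈ γ∈ β≢γ sub with increasing-⊆ (S-increasing (positive′ β∈)) (S-increasing (positive′ γ∈)) sub
  ... | inj₁ lt = lt
  ... | inj₂ eq = contradiction (S-injective (positive′ β∈) (positive′ γ∈) (trans (sum′ β∈) (sym (sum′ γ∈))) eq) β≢γ

  -- Comparing coefficients at the monomial with exponents `γ` gives a unitriangular system: `F β γ`
  -- is 1 for `β = γ` and vanishes unless `S β ⊆ S γ`. The other `β` that contribute have smaller
  -- sets, so induction on the size of `S γ` applies.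
  F-independent : ∀ (c d : List ℕ → ℤ) → ∑ C (λ β → c β · F β) ≈ ∑ C (λ β → d β · F β) →
                  ∀ {γ} → γ ∈ C → c γ ≡ d γ
  F-independent c d eq {γ} = go γ (<-wellFounded _)
    where
    go : ∀ γ → Acc _<_ (length (S γ)) → γ ∈ C → c γ ≡ d γ
    go γ (acc rec) γ∈ = begin
      c γ                ≡⟨ ℤ.*-identityʳ (c γ) ⟨
      c γ ℤ.* 1ℤ         ≡⟨ cong (c γ ℤ.*_) (F-diagonal γ∈) ⟨
      c γ ℤ.* F γ γ      ≡⟨ ∑ℤ-cancel {f = λ β → c β ℤ.* F β γ} {λ β → d β ℤ.* F β γ}
                              (compositions-unique n) γ∈ others (eq γ) ⟩
      d γ ℤ.* F γ γ      ≡⟨ cong (d γ ℤ.*_) (F-diagonal γ∈) ⟩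
      d γ ℤ.* 1ℤ         ≡⟨ ℤ.*-identityʳ (d γ) ⟩
      d γ                ∎
      where
      open ≡-Reasoning
      others : ∀ β → β ∈ C → β ≢ γ → c β ℤ.* F β γ ≡ d β ℤ.* F β γ
      others β β∈ β≢γ with finer? β γ
      ... | yes sub = cong (ℤ._* F β γ) (go β (rec (coarser-shorter β∈ γ∈ β≢γ sub)) β∈)
      ... | no not = trans (cong (c β ℤ.*_) (F-not-finer {β} γ∈ not)) (trans (ℤ.*-zeroʳ (c β))
                       (sym (trans (cong (d β ℤ.*_) (F-not-finer {β} γ∈ not)) (ℤ.*-zeroʳ (d β)))))

  indicator : List ℕ → List ℕ → ℕ
  indicator α β = if does (α ≟ᴸ β) then 1 else 0

  module _ {X : Set} (φ : X → List ℕ) where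

    multiplicity : List X → List ℕ → ℕ
    multiplicity []       β = 0
    multiplicity (x ∷ xs) β = indicator (φ x) β + multiplicity xs β

    multiplicity-pos : ∀ {x xs} → x ∈ xs → 0 < multiplicity xs (φ x)
    multiplicity-pos {x} (here refl)
      rewrite dec-true (φ x ≟ᴸ φ x) refl = z<s
    multiplicity-pos (there x∈) = <-≤-trans (multiplicity-pos x∈) (m≤n+m _ _)

    multiplicity-pos⁻ : ∀ xs β → 0 < multiplicity xs β → ∃[ x ] x ∈ xs × φ x ≡ β
    multiplicity-pos⁻ (x ∷ xs) β pos = go (φ x ≟ᴸ β)
      where
      go : Dec (φ x ≡ β) → ∃[ y ] y ∈ x ∷ xs × φ y ≡ β
      go (yes eq) = x , here refl , eq
      go (no neq) = let y , y∈ , eq = multiplicity-pos⁻ xs β (subst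
                          (λ b → 0 < (if b then 1 else 0) + multiplicity xs β) (dec-false (φ x ≟ᴸ β) neq) pos)
                    in y , there y∈ , eq

    F-collect : ∀ xs → (∀ x → φ x ∈ C) →
                ∑ xs (λ x → F (φ x)) ≈ ∑ C (λ β → (ℤ.+ multiplicity xs β) · F β)
    F-collect []       φ∈ e = sym (∑ℤ-zero C (λ β _ → ℤ.*-zeroˡ (F β e)))
    F-collect (x ∷ xs) φ∈ e = sym (begin
      ∑ℤ C (λ β → ℤ.+ (indicator (φ x) β + multiplicity xs β) ℤ.* F β e)
        ≡⟨ ∑ℤ-cong C (λ β _ → trans (cong (ℤ._* F β e) (ℤ.pos-+ (indicator (φ x) β) (multiplicity xs β)))
                                     (ℤ.*-distribʳ-+ (F β e) (ℤ.+ indicator (φ x) β) (ℤ.+ multiplicity xs β))) ⟩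
      ∑ℤ C (λ β → ℤ.+ indicator (φ x) β ℤ.* F β e ℤ.+ ℤ.+ multiplicity xs β ℤ.* F β e)
        ≡⟨ ∑ℤ-+ C (λ β → ℤ.+ indicator (φ x) β ℤ.* F β e) (λ β → ℤ.+ multiplicity xs β ℤ.* F β e) ⟩
      ∑ℤ C (λ β → ℤ.+ indicator (φ x) β ℤ.* F β e) ℤ.+ ∑ℤ C (λ β → ℤ.+ multiplicity xs β ℤ.* F β e)
        ≡⟨ cong₂ ℤ._+_ (∑ℤ-single {f = λ β → ℤ.+ indicator (φ x) β ℤ.* F β e} (compositions-unique n) (φ∈ x) off)
                       (sym (F-collect xs φ∈ e)) ⟩
      ℤ.+ indicator (φ x) (φ x) ℤ.* F (φ x) e ℤ.+ ∑ℤ xs (λ y → F (φ y) e)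
        ≡⟨ cong (ℤ._+ ∑ℤ xs (λ y → F (φ y) e))
             (trans (cong (λ b → ℤ.+ (if b then 1 else 0) ℤ.* F (φ x) e) (dec-true (φ x ≟ᴸ φ x) refl))
                    (ℤ.*-identityˡ (F (φ x) e))) ⟩
      F (φ x) e ℤ.+ ∑ℤ xs (λ y → F (φ y) e) ∎)
      where
      open ≡-Reasoning
      off : ∀ β → β ∈ C → β ≢ φ x → ℤ.+ indicator (φ x) β ℤ.* F β e ≡ 0ℤ
      off β _ β≢ = trans (cong (λ b → ℤ.+ (if b then 1 else 0) ℤ.* F β e) (dec-false (φ x ≟ᴸ β) (β≢ ∘ sym)))
                         (ℤ.*-zeroˡ (F β e))

differences-∈ : ∀ n d ds → AllPairs _<_ (d ∷ ds) → All (_< n) (d ∷ ds) →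
  All (0 <_) (zipWith _∸_ (ds ++ [ n ]) (d ∷ ds)) × sum (zipWith _∸_ (ds ++ [ n ]) (d ∷ ds)) ≡ n ∸ d
differences-∈ n d []       _ (d<n ∷ _) = m<n⇒0<n∸m d<n ∷ [] , +-identityʳ _
differences-∈ n d (e ∷ ds) ((d<e ∷ _) ∷ inc) (_ ∷ e<n ∷ <n) with differences-∈ n e ds inc (e<n ∷ <n)
... | pos , eq = m<n⇒0<n∸m d<e ∷ pos , (begin
  (e ∸ d) + sum (zipWith _∸_ (ds ++ [ n ]) (e ∷ ds))  ≡⟨ cong (_+_ (e ∸ d)) eq ⟩
  (e ∸ d) + (n ∸ e)   ≡⟨ +-comm (e ∸ d) (n ∸ e) ⟩
  (n ∸ e) + (e ∸ d)   ≡⟨ +-∸-assoc (n ∸ e) (<⇒≤ d<e) ⟨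
  (n ∸ e) + e ∸ d     ≡⟨ cong (_∸ d) (m∸n+n≡m (<⇒≤ e<n)) ⟩
  n ∸ d               ∎)
  where open ≡-Reasoning

fromSet-∈ : ∀ n {P : ℕ → Set} (P? : Decidable P) → fromSet n (filter P? (applyUpTo suc (n ∸ 1))) ∈ compositions n
fromSet-∈ zero    P? = here refl
fromSet-∈ (suc n) P? with differences-∈ (suc n) 0 (filter P? (applyUpTo suc n))
  (All.filter⁺ P? (All.applyUpTo⁺₂ suc n (λ _ → z<s)) ∷ AllPairs.filter⁺ P? (AllPairs.applyUpTo⁺₁ suc n (λ i<j _ → s<s i<j)))
  (z<s ∷ All.filter⁺ P? (All.applyUpTo⁺₁ suc n s<s))
... | pos , eq = ∈-compositions⁺ (suc n) _ pos eq

∈-allVecs : ∀ {n} m (v : Vec (Fin n) m) → v ∈ allVecs (allFin n) m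
∈-allVecs zero    Vec.[]       = here refl
∈-allVecs (suc m) (x Vec.∷ v) = ∈-cartesianProductWith⁺ Vec._∷_ (∈-allFin x) (∈-allVecs m v)

-- The F-support in terms of tableaux

module _ (A : SkewShape) where

  private
    n = size A
    c = λ β → ℤ.+ multiplicity n (comp A) (SYTs A) β

    comp-∈ : ∀ T → comp A T ∈ compositions n
    comp-∈ T = fromSet-∈ n (isDescent? A T)

    s-expansion : s A ≈ ∑ (compositions n) (λ β → c β · F β)
    s-expansion = F-collect n (comp A) (SYTs A) comp-∈

  suppF⁺ : ∀ {T} → IsSYT A T → suppF A (comp A T)
  suppF⁺ {T} syt = comp-∈ T , c , s-expansion
    , ℤ.+<+ (multiplicity-pos n (comp A) (∈-filter⁺ (isSYT? A) (∈-allVecs n T) syt))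

  -- The given expansion of `s A` need not be the one that counts tableaux, but by independence its
  -- coefficient at `α` is that multiplicity, and a positive multiplicity exhibits a tableau.
  suppF⁻ : ∀ {α} → suppF A α → ∃[ T ] IsSYT A T × comp A T ≡ α
  suppF⁻ {α} (α∈ , d , expansion , pos) =
    let d≡c = F-independent n d c (λ e → trans (sym (expansion e)) (s-expansion e)) α∈
        T , T∈ , eq = multiplicity-pos⁻ n (comp A) (SYTs A) α (ℤ.drop‿+<+ (subst (0ℤ ℤ.<_) d≡c pos))
    in T , proj₂ (∈-filter⁻ (isSYT? A) {xs = allVecs (allFin n) n} T∈) , eq

-- Lists as words

tally : ℕ → List ℕ → ℕ
tally v xs = cnt (nth xs) v (length xs)

tally-++ : ∀ v xs ys → tally v (xs ++ ys) ≡ tally v xs + tally v ys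
tally-++ v []       ys = refl
tally-++ v (x ∷ xs) ys = trans (cong (δ x v +_) (tally-++ v xs ys)) (sym (+-assoc (δ x v) _ _))

nth-++ˡ : ∀ xs ys {p} → p < length xs → nth (xs ++ ys) p ≡ nth xs p
nth-++ˡ (x ∷ xs) ys {zero}  p< = refl
nth-++ˡ (x ∷ xs) ys {suc p} p< = nth-++ˡ xs ys (s<s⁻¹ p<)

nth-++ʳ : ∀ xs ys p → nth (xs ++ ys) (length xs + p) ≡ nth ys p
nth-++ʳ []       ys p = refl
nth-++ʳ (x ∷ xs) ys p = nth-++ʳ xs ys p

nth-applyUpTo : ∀ f n {i} → i < n → nth (applyUpTo f n) i ≡ f i
nth-applyUpTo f (suc n) {zero}  i<n = refl
nth-applyUpTo f (suc n) {suc i} i<n = nth-applyUpTo (f ∘ suc) n (s<s⁻¹ i<n)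

AllPairs-nth : ∀ {R : ℕ → ℕ → Set} {xs} → AllPairs R xs → ∀ p → suc p < length xs → R (nth xs p) (nth xs (suc p))
AllPairs-nth (rx ∷ rxs) zero    p< = All-nth rx 0 (s<s⁻¹ p<)
AllPairs-nth (rx ∷ rxs) (suc p) p< = AllPairs-nth rxs p (s<s⁻¹ p<)

-- Double counting: each position contributes to the count of exactly one letter.
cnt-total : ∀ {r m w} → (∀ p → p < m → w p < r) → ∑< r (λ v → cnt w v m) ≡ m
cnt-total {r} {m} {w} w<r = begin
  ∑< r (λ v → cnt w v m)                ≡⟨ ∑<-swap r m (λ v p → δ (w p) v) ⟩
  ∑< m (λ p → ∑< r (λ v → δ (w p) v))   ≡⟨ ∑<-const m 1 (λ p p<m → trans
      (∑<-single r (w p) (w<r p p<m) (λ v _ v≢ → δ-≢ (v≢ ∘ sym))) (δ-refl (w p))) ⟩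
  m * 1                                 ≡⟨ *-identityʳ m ⟩
  m                                     ∎
  where open ≡-Reasoning

increasing⇒cnt≤1 : ∀ {u} v k → (∀ q → suc q < k → u q < u (suc q)) → cnt u v k ≤ 1
increasing⇒cnt≤1 v zero inc = z≤n
increasing⇒cnt≤1 {u} v (suc k) inc with u 0 ≟ v
... | no neq = subst (λ d → d + cnt (u ∘ suc) v k ≤ 1) (sym (δ-≢ neq))
                 (increasing⇒cnt≤1 v k (λ q q< → inc (suc q) (s<s q<)))
... | yes eq = subst₂ (λ d s → d + s ≤ 1) (sym (δ-≡ eq))
                 (sym (∑<-zeros k λ q q<k → δ-≢ λ uq≡v → <-irrefl (trans eq (sym uq≡v)) (above q q<k))) ≤-refl
  where
  above : ∀ q → q < k → u 0 < u (suc q)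
  above zero    q<k = inc 0 (s<s q<k)
  above (suc q) q<k = <-trans (above q (<-trans ≤-refl q<k)) (inc (suc q) (s<s q<k))

tally-filter-∈ : ∀ {P : ℕ → Set} (P? : Decidable P) xs v → P v → tally v (filter P? xs) ≡ tally v xs
tally-filter-∈ P? []       v Pv = refl
tally-filter-∈ P? (x ∷ xs) v Pv with P? x
... | yes _  = cong (δ x v +_) (tally-filter-∈ P? xs v Pv)
... | no ¬Px = trans (tally-filter-∈ P? xs v Pv)
                     (cong (_+ tally v xs) (sym (δ-≢ {x} {v} (λ { refl → ¬Px Pv }))))

tally-filter-∉ : ∀ {P : ℕ → Set} (P? : Decidable P) xs v → ¬ P v → tally v (filter P? xs) ≡ 0
tally-filter-∉ P? []       v ¬Pv = refl
tally-filter-∉ P? (x ∷ xs) v ¬Pv with P? x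
... | yes Px = cong₂ _+_ (δ-≢ {x} {v} (λ { refl → ¬Pv Px })) (tally-filter-∉ P? xs v ¬Pv)
... | no _   = tally-filter-∉ P? xs v ¬Pv

tally-upTo≤1 : ∀ s v → tally v (upTo s) ≤ 1
tally-upTo≤1 s v = increasing⇒cnt≤1 {nth (upTo s)} v (length (upTo s))
  (AllPairs-nth (AllPairs.applyUpTo⁺₁ id s (λ i<j _ → i<j)))

tally-upTo : ∀ s v → v < s → tally v (upTo s) ≡ 1
tally-upTo s v v<s = ≤-antisym (tally-upTo≤1 s v)
  (cnt-pos⁻ (nth (upTo s)) v (length (upTo s)) v (subst (v <_) (sym (length-upTo s)) v<s) (nth-applyUpTo id s v<s))

-- The word of ascending blocks

module Layers (r : ℕ) (b : ℕ → ℕ) where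

  -- The block lengths are the parts of the partition conjugate to the row lengths.
  block : ℕ → List ℕ
  block j = filter (λ i → j <? b i) (upTo r)

  layers : ℕ → List ℕ
  layers zero    = []
  layers (suc t) = layers t ++ block t

  layers-bounded : ∀ t → All (_< r) (layers t)
  layers-bounded zero    = []
  layers-bounded (suc t) = All.++⁺ (layers-bounded t) (All.filter⁺ (λ i → t <? b i) (All.all-upTo r))

  tally-block : ∀ j v → v < r → tally v (block j) + (b v ⊓ j) ≡ b v ⊓ suc j
  tally-block j v v<r = go (j <? b v)
    where
    open ≡-Reasoning
    go : Dec (j < b v) → tally v (block j) + (b v ⊓ j) ≡ b v ⊓ suc j
    go (yes j<b) = begin
      tally v (block j) + (b v ⊓ j) ≡⟨ cong₂ _+_ (trans (tally-filter-∈ (λ i → j <? b i) (upTo r) v j<b) (tally-upTo r v v<r))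
                                                 (m≥n⇒m⊓n≡n (<⇒≤ j<b)) ⟩
      suc j                         ≡⟨ m≥n⇒m⊓n≡n j<b ⟨
      b v ⊓ suc j                   ∎
    go (no j≮b) = begin
      tally v (block j) + (b v ⊓ j) ≡⟨ cong₂ _+_ (tally-filter-∉ (λ i → j <? b i) (upTo r) v j≮b)
                                                 (m≤n⇒m⊓n≡m (≮⇒≥ j≮b)) ⟩
      b v                           ≡⟨ m≤n⇒m⊓n≡m (m≤n⇒m≤1+n (≮⇒≥ j≮b)) ⟨
      b v ⊓ suc j                   ∎

  tally-layers : ∀ t v → v < r → tally v (layers t) ≡ b v ⊓ t
  tally-layers zero    v v<r = sym (⊓-zeroʳ (b v))
  tally-layers (suc t) v v<r = begin
    tally v (layers t ++ block t)             ≡⟨ tally-++ v (layers t) (block t) ⟩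
    tally v (layers t) + tally v (block t)    ≡⟨ cong (_+ tally v (block t)) (tally-layers t v v<r) ⟩
    b v ⊓ t + tally v (block t)               ≡⟨ +-comm (b v ⊓ t) _ ⟩
    tally v (block t) + b v ⊓ t               ≡⟨ tally-block t v v<r ⟩
    b v ⊓ suc t                               ∎
    where open ≡-Reasoning

  length-layers : ∀ t → length (layers t) ≡ ∑< r (λ v → b v ⊓ t)
  length-layers t = trans (sym (cnt-total {r} {length (layers t)} {nth (layers t)} (All-nth (layers-bounded t))))
                          (∑<-cong r (tally-layers t))

  length-layers-mono : ∀ t s → length (layers t) ≤ length (layers (t + s))
  length-layers-mono t s = begin
    length (layers t)           ≡⟨ length-layers t ⟩
    ∑< r (λ v → b v ⊓ t)        ≤⟨ ∑<-mono r (λ v _ → ⊓-monoʳ-≤ (b v) (m≤m+n t s)) ⟩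
    ∑< r (λ v → b v ⊓ (t + s))  ≡⟨ length-layers (t + s) ⟨
    length (layers (t + s))     ∎
    where open ≤-Reasoning

  nth-layers : ∀ t s {p} → p < length (layers t) → nth (layers (t + s)) p ≡ nth (layers t) p
  nth-layers t zero    p< = cong (λ k → nth (layers k) _) (+-identityʳ t)
  nth-layers t (suc s) {p} p< rewrite +-suc t s =
    trans (nth-++ˡ (layers (t + s)) (block (t + s)) (<-≤-trans p< (length-layers-mono t s)))
          (nth-layers t s p<)

  block-ascends : ∀ t s q → suc q < length (block t) →
    nth (layers (suc t + s)) (length (layers t) + q) < nth (layers (suc t + s)) (suc (length (layers t) + q))
  block-ascends t s q 1+q< = subst₂ _<_ (sym (at q (<-trans ≤-refl 1+q<)))
      (trans (sym (at (suc q) 1+q<)) (cong (nth (layers (suc t + s))) (+-suc (length (layers t)) q)))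
      (AllPairs-nth (AllPairs.filter⁺ (λ i → t <? b i) (AllPairs.applyUpTo⁺₁ id r (λ i<j _ → i<j))) q 1+q<)
    where
    at : ∀ q → q < length (block t) → nth (layers (suc t + s)) (length (layers t) + q) ≡ nth (block t) q
    at q q< = trans (nth-layers (suc t) s (subst (length (layers t) + q <_) (sym (length-++ (layers t))) (+-monoʳ-< (length (layers t)) q<)))
                    (nth-++ʳ (layers t) (block t) q)

  -- Within a block `w` increases strictly and thus gains at most one `v`. Writing `m` as `t + s`
  -- keeps the whole word fixed during the induction on `t`.
  cnt≤layer : ∀ m {n w} → length (layers m) ≡ n → SameAsc n (nth (layers m)) w →
              ∀ v t s → t + s ≡ m → cnt w v (length (layers t)) ≤ t
  cnt≤layer m _   same v zero    s eq = z≤n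
  cnt≤layer m {n} {w} len≡ same v (suc t) s refl = begin
    cnt w v (length (layers t ++ block t))  ≡⟨ cong (cnt w v) (length-++ (layers t)) ⟩
    cnt w v (ℓ + length (block t))          ≡⟨ ∑<-+ ℓ (length (block t)) (λ p → δ (w p) v) ⟩
    cnt w v ℓ + cnt (λ q → w (ℓ + q)) v (length (block t))
      ≤⟨ +-mono-≤ (cnt≤layer m {n} {w} len≡ same v t (suc s) (+-suc t s))
                  (increasing⇒cnt≤1 v (length (block t)) ascends) ⟩
    t + 1                                   ≡⟨ +-comm t 1 ⟩
    suc t                                   ∎
    where
    open ≤-Reasoning
    ℓ = length (layers t)
    ascends : ∀ q → suc q < length (block t) → w (ℓ + q) < w (ℓ + suc q)
    ascends q 1+q< = subst (λ k → w (ℓ + q) < w k) (sym (+-suc ℓ q))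
      (proj₁ (same (ℓ + q) in-range) (block-ascends t s q 1+q<))
      where
      in-range : suc (ℓ + q) < n
      in-range = begin-strict
        suc (ℓ + q)               ≡⟨ +-suc ℓ q ⟨
        ℓ + suc q                 <⟨ +-monoʳ-< ℓ 1+q< ⟩
        ℓ + length (block t)      ≡⟨ length-++ (layers t) ⟨
        length (layers (suc t))   ≤⟨ length-layers-mono (suc t) s ⟩
        length (layers (suc t + s)) ≡⟨ len≡ ⟩
        n                         ∎

  module _ (b≥2 : ∀ i → i < r → 2 ≤ b i) (m : ℕ) (b≤m : ∀ i → i < r → b i ≤ suc m) where

    private
      L = layers (suc m)

    length-layers-full : length L ≡ ∑< r b
    length-layers-full = trans (length-layers (suc m)) (∑<-cong r (λ i i<r → m≤n⇒m⊓n≡m (b≤m i i<r)))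

    tally-layers-full : ∀ v → v < r → tally v L ≡ b v
    tally-layers-full v v<r = trans (tally-layers (suc m) v v<r) (m≤n⇒m⊓n≡m (b≤m v v<r))

    private
      block-0 : block 0 ≡ upTo r
      block-0 = filter-all (λ i → 0 <? b i) (All.applyUpTo⁺₁ id r (λ i<r → ≤-trans (s≤s z≤n) (b≥2 _ i<r)))

      length-1 : length (layers 1) ≡ r
      length-1 = trans (cong length block-0) (length-upTo r)

      starts : ∀ i → i < r → nth L i ≡ i
      starts i i<r = trans (nth-layers 1 m (subst (i <_) (sym length-1) i<r))
                       (trans (cong (λ xs → nth xs i) block-0) (nth-applyUpTo id r i<r))

    -- All row lengths are positive, so the first block is 0, ..., r - 1 and already contains every
    -- link.
    layers-word : RibbonWord r (length L) (nth L)
    layers-word = record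
      { bounded = All-nth (layers-bounded (suc m))
      ; linked  = λ i 1+i<r → i , suc i , ≤-refl
          , <-≤-trans 1+i<r (≤-trans (≤-reflexive (sym length-1)) (length-layers-mono 1 m))
          , starts i (<-trans ≤-refl 1+i<r) , starts (suc i) 1+i<r
      }

-- The word with a single ascent

module Stairs (s : ℕ) (b : ℕ → ℕ) (b≥2 : ∀ i → i < suc s → 2 ≤ b i) where

  r : ℕ
  r = suc s

  -- The word starts with the run 0, ..., s - 1. This is the number of copies of `v` that remain for
  -- the weakly decreasing part, whose first letter `s` completes the run.
  rest : ℕ → ℕ
  rest v = b v ∸ tally v (upTo s)

  stairs : ℕ → List ℕ
  stairs zero    = []
  stairs (suc k) = replicate (rest k) k ++ stairs k

  tally-replicate : ∀ m k v → tally v (replicate m k) ≡ m * δ k v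
  tally-replicate zero    k v = refl
  tally-replicate (suc m) k v = cong (δ k v +_) (tally-replicate m k v)

  stairs-bounded : ∀ k → All (_< k) (stairs k)
  stairs-bounded zero    = []
  stairs-bounded (suc k) = All.++⁺ (All.replicate⁺ (rest k) ≤-refl) (All.map m<n⇒m<1+n (stairs-bounded k))

  stairs-decreasing : ∀ k → AllPairs _≥_ (stairs k)
  stairs-decreasing zero    = []
  stairs-decreasing (suc k) = AllPairs.++⁺ (constant (rest k)) (stairs-decreasing k)
    (All.replicate⁺ (rest k) (All.map <⇒≤ (stairs-bounded k)))
    where
    constant : ∀ m → AllPairs _≥_ (replicate m k)
    constant zero    = []
    constant (suc m) = All.replicate⁺ m ≤-refl ∷ constant m

  tally-bounded : ∀ {v xs} → All (_< v) xs → tally v xs ≡ 0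
  tally-bounded []           = refl
  tally-bounded (x<v ∷ xs<v) = cong₂ _+_ (δ-≢ (<⇒≢ x<v)) (tally-bounded xs<v)

  tally-stairs : ∀ k v → v < k → tally v (stairs k) ≡ rest v
  tally-stairs (suc k) v v<1+k with v ≟ k
  ... | yes refl = begin
    tally v (replicate (rest v) v ++ stairs v)        ≡⟨ tally-++ v (replicate (rest v) v) (stairs v) ⟩
    tally v (replicate (rest v) v) + tally v (stairs v) ≡⟨ cong₂ _+_ (tally-replicate (rest v) v v) (tally-bounded (stairs-bounded v)) ⟩
    rest v * δ v v + 0                                ≡⟨ +-identityʳ _ ⟩
    rest v * δ v v                                    ≡⟨ cong (rest v *_) (δ-refl v) ⟩
    rest v * 1                                        ≡⟨ *-identityʳ _ ⟩
    rest v                                            ∎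
    where open ≡-Reasoning
  ... | no v≢k = begin
    tally v (replicate (rest k) k ++ stairs k)        ≡⟨ tally-++ v (replicate (rest k) k) (stairs k) ⟩
    tally v (replicate (rest k) k) + tally v (stairs k) ≡⟨ cong₂ _+_ (tally-replicate (rest k) k v) (tally-stairs k v (≤∧≢⇒< (s≤s⁻¹ v<1+k) v≢k)) ⟩
    rest k * δ k v + rest v                           ≡⟨ cong (λ d → rest k * d + rest v) (δ-≢ (v≢k ∘ sym)) ⟩
    rest k * 0 + rest v                               ≡⟨ cong (_+ rest v) (*-zeroʳ (rest k)) ⟩
    rest v                                            ∎
    where open ≡-Reasoning

  L : List ℕ
  L = upTo s ++ stairs r

  tally-L : ∀ v → v < r → tally v L ≡ b v
  tally-L v v<r = begin
    tally v (upTo s ++ stairs r)             ≡⟨ tally-++ v (upTo s) (stairs r) ⟩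
    tally v (upTo s) + tally v (stairs r)    ≡⟨ cong (tally v (upTo s) +_) (tally-stairs r v v<r) ⟩
    tally v (upTo s) + (b v ∸ tally v (upTo s)) ≡⟨ m+[n∸m]≡n (≤-trans (tally-upTo≤1 s v) (≤-trans (s≤s z≤n) (b≥2 v v<r))) ⟩
    b v                                      ∎
    where open ≡-Reasoning

  L-bounded : All (_< r) L
  L-bounded = All.++⁺ (All.map m<n⇒m<1+n (All.all-upTo s)) (stairs-bounded r)

  length-L : length L ≡ ∑< r b
  length-L = trans (sym (cnt-total {r} {length L} {nth L} (All-nth L-bounded))) (∑<-cong r tally-L)

  L-word : RibbonWord r (length L) (nth L)
  L-word = record
    { bounded = All-nth L-bounded
    ; linked  = linked′
    }
    where
    linked′ : ∀ i → suc i < r → Before (length L) (nth L) i (suc i)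
    -- The initial run takes at most one of the two or more copies of `suc i`; another one comes
    -- after the run, hence after the `i` at position `i`.
    linked′ i 1+i<r with cnt-pos (nth (stairs r)) (suc i) (length (stairs r))
      (subst (0 <_) (sym (tally-stairs r (suc i) 1+i<r)) (m<n⇒0<n∸m (≤-trans (s≤s (tally-upTo≤1 s (suc i))) (b≥2 (suc i) 1+i<r))))
    ... | q , q< , eq = i , s + q , ≤-trans (s<s⁻¹ 1+i<r) (m≤m+n s q)
          , subst (s + q <_) (sym (trans (length-++ (upTo s)) (cong (_+ length (stairs r)) (length-upTo s)))) (+-monoʳ-< s q<)
          , trans (nth-++ˡ (upTo s) (stairs r) (subst (i <_) (sym (length-upTo s)) (s<s⁻¹ 1+i<r))) (nth-applyUpTo id s (s<s⁻¹ 1+i<r))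
          , trans (cong (nth L) (cong (_+ q) (sym (length-upTo s)))) (trans (nth-++ʳ (upTo s) (stairs r) q) eq)

  L-descends : ∀ q → suc (s + q) < length L → nth L (suc (s + q)) ≤ nth L (s + q)
  L-descends q < = subst₂ _≤_ (sym (trans (cong (nth L) (sym (+-suc s q))) (at (suc q)))) (sym (at q))
    (AllPairs-nth (stairs-decreasing r) q (+-cancelˡ-< s _ _ (subst₂ _<_ (sym (+-suc s q))
      (trans (length-++ (upTo s)) (cong (_+ length (stairs r)) (length-upTo s))) <)))
    where
    at : ∀ q → nth L (s + q) ≡ nth (stairs r) q
    at q = trans (cong (nth L) (cong (_+ q) (sym (length-upTo s)))) (nth-++ʳ (upTo s) (stairs r) q)

-- From position `s` on the word decreases weakly, so the first letter of each link must stand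
-- before `s`. These letters are 0, ..., r - 2, at distinct positions.
rows≤ : ∀ {r n w s} → RibbonWord r n w → (∀ q → suc (s + q) < n → w (suc (s + q)) ≤ w (s + q)) → r ∸ 1 ≤ s
rows≤ {r} {n} {w} {s} W desc = injective⇒≤ {f = λ i → fromℕ< (early i)} λ {i} {j} eq →
  toℕ-injective (trans (sym (at i)) (trans (cong w (trans (sym (toℕ-fromℕ< (early i)))
    (trans (cong toℕ eq) (toℕ-fromℕ< (early j))))) (at j)))
  where
  link : (i : Fin (r ∸ 1)) → Before n w (toℕ i) (suc (toℕ i))
  link i = linked W (toℕ i) (subst (_< r) (+-comm (toℕ i) 1) (m<n∸o⇒m+o<n (toℕ i) 1 (toℕ<n i)))
  at : ∀ i → w (proj₁ (link i)) ≡ toℕ i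
  at i = let _ , _ , _ , _ , wp , _ = link i in wp
  flat : ∀ p k → s ≤ p → p + k < n → w (p + k) ≤ w p
  flat p zero    s≤p <n = ≤-reflexive (cong w (+-identityʳ p))
  flat p (suc k) s≤p <n = subst (λ j → w j ≤ w p) (sym (+-suc p k)) (≤-trans
    (subst (λ j → w (suc j) ≤ w j) eq (desc (p + k ∸ s) (subst (λ j → suc j < n) (sym eq) <n′)))
    (flat p k s≤p (<-trans ≤-refl <n′)))
    where
    <n′ : suc (p + k) < n
    <n′ = subst (_< n) (+-suc p k) <n
    eq : s + (p + k ∸ s) ≡ p + k
    eq = m+[n∸m]≡n (≤-trans s≤p (m≤m+n p k))
  early : ∀ i → proj₁ (link i) < s
  early i = let p , q , p<q , q<n , wp , wq = link i in ≰⇒> λ s≤p →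
    1+n≰n (subst₂ _≤_ (trans (cong w (m+[n∸m]≡n (<⇒≤ p<q))) wq) wp
      (flat p (q ∸ p) s≤p (subst (_< n) (sym (m+[n∸m]≡n (<⇒≤ p<q))) q<n)))

-- Dominance

sum-applyUpTo : ∀ f n → sum (applyUpTo f n) ≡ ∑< n f
sum-applyUpTo f zero    = refl
sum-applyUpTo f (suc n) = cong (f 0 +_) (sum-applyUpTo (f ∘ suc) n)

nth-≤ : ∀ {x xs} → All (_≤ x) xs → ∀ k → nth xs k ≤ x
nth-≤ []         k       = z≤n
nth-≤ (p ∷ _)    zero    = p
nth-≤ (_ ∷ ps)   (suc k) = nth-≤ ps k

sum-take-≤ : ∀ t k xs → sum (take k xs) ≤ k * t + sum (map (_∸ t) xs)
sum-take-≤ t zero    xs       = z≤n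
sum-take-≤ t (suc k) []       = z≤n
sum-take-≤ t (suc k) (x ∷ xs) = begin
  x + sum (take k xs)                            ≤⟨ +-mono-≤ (m≤n+m∸n x t) (sum-take-≤ t k xs) ⟩
  (t + (x ∸ t)) + (k * t + sum (map (_∸ t) xs))  ≡⟨ +-interchange t (x ∸ t) (k * t) _ ⟩
  (t + k * t) + ((x ∸ t) + sum (map (_∸ t) xs))  ∎
  where open ≤-Reasoning

sum-take-decreasing : ∀ k {xs} → AllPairs _≥_ xs →
  k * nth xs k + sum (map (_∸ nth xs k) xs) ≡ sum (take k xs)
sum-take-decreasing zero    []       = refl
sum-take-decreasing (suc k) []       = trans (+-identityʳ _) (*-zeroʳ k)
sum-take-decreasing zero {x ∷ xs} (le ∷ _) = cong₂ _+_ (n∸n≡0 x) (zeros le)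
  where
  zeros : ∀ {ys} → All (_≤ x) ys → sum (map (_∸ x) ys) ≡ 0
  zeros []       = refl
  zeros (p ∷ ps) = cong₂ _+_ (m≤n⇒m∸n≡0 p) (zeros ps)
sum-take-decreasing (suc k) {x ∷ xs} (le ∷ dec) = begin
  (t + k * t) + ((x ∸ t) + sum (map (_∸ t) xs))  ≡⟨ +-interchange t (k * t) (x ∸ t) _ ⟩
  (t + (x ∸ t)) + (k * t + sum (map (_∸ t) xs))  ≡⟨ cong₂ _+_ (m+[n∸m]≡n (nth-≤ le k)) (sum-take-decreasing k dec) ⟩
  x + sum (take k xs)                            ∎
  where
  open ≡-Reasoning
  t = nth xs k

-- For every `t`, the sum of `k` entries is at most `k * t` plus the total excess over `t`. A
-- decreasing list attains this bound when `t` is its entry with index `k`, so that entry of `ys` is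
-- the threshold to use.
thresholds⇒dominance : ∀ xs {ys} → AllPairs _≥_ ys →
  (∀ t → sum (map (_∸ t) xs) ≤ sum (map (_∸ t) ys)) → ∀ k → sum (take k xs) ≤ sum (take k ys)
thresholds⇒dominance xs {ys} dec le k = begin
  sum (take k xs)                    ≤⟨ sum-take-≤ t k xs ⟩
  k * t + sum (map (_∸ t) xs)        ≤⟨ +-monoʳ-≤ (k * t) (le t) ⟩
  k * t + sum (map (_∸ t) ys)        ≡⟨ sum-take-decreasing k dec ⟩
  sum (take k ys)                    ∎
  where
  open ≤-Reasoning
  t = nth ys k

sum-take-ones : ∀ k {xs} → All (_≡ 1) xs → sum (take k xs) ≡ k ⊓ length xs
sum-take-ones zero    _           = refl
sum-take-ones (suc k) []          = refl
sum-take-ones (suc k) (refl ∷ ps) = cong suc (sum-take-ones k ps)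

↭-ones : ∀ {xs m} → xs ↭ applyUpTo (λ _ → 1) m → All (_≡ 1) xs × length xs ≡ m
↭-ones {m = m} p = All-resp-↭ (↭-sym p) (All.applyUpTo⁺₂ _ m (λ _ → refl))
                 , trans (↭-length p) (length-applyUpTo _ m)

sum-take-< : ∀ k {xs} → All (0 <_) xs → k < length xs → sum (take k xs) < sum xs
sum-take-< zero    {x ∷ xs} (0<x ∷ _) _  = ≤-trans 0<x (m≤m+n x _)
sum-take-< (suc k) {x ∷ xs} (_ ∷ ps) k< = +-monoʳ-< x (sum-take-< k ps (s<s⁻¹ k<))

-- With equal sizes, this turns a lower bound on the truncated row lengths of A into an upper bound
-- on the excesses.
∑<-⊓-∸ : ∀ r b t → ∑< r (λ v → b v ⊓ t) + ∑< r (λ v → b v ∸ t) ≡ ∑< r b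
∑<-⊓-∸ r b t = trans (sym (∑<-distrib-+ r (λ v → b v ⊓ t) (λ v → b v ∸ t)))
  (∑<-cong r λ v _ → trans (cong (_+ (b v ∸ t)) (⊓-comm (b v) t)) (m⊓n+n∸m≡n t (b v)))

stairs-exists : ∀ r b n → (∀ i → i < r → 2 ≤ b i) → n ≡ ∑< r b →
  ∃[ w ] RibbonWord r n w × (∀ v → v < r → cnt w v n ≡ b v) ×
         (∀ q → suc ((r ∸ 1) + q) < n → w (suc ((r ∸ 1) + q)) ≤ w ((r ∸ 1) + q))
stairs-exists zero    b _ b≥2 refl = (λ _ → 0) , record { bounded = λ _ () ; linked = λ _ () } , (λ _ ()) , (λ _ ())
stairs-exists (suc s) b n b≥2 eq = nth L , subst (λ n → RibbonWord (suc s) n (nth L)) len L-word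
  , (λ v v<r → subst (λ n → cnt (nth L) v n ≡ b v) len (tally-L v v<r))
  , (λ q lt → L-descends q (subst (suc (s + q) <_) (sym len) lt))
  where
  open Stairs s b b≥2
  len : length L ≡ n
  len = trans length-L (sym eq)

layers-exist : ∀ r b n → (∀ i → i < r → 2 ≤ b i) → n ≡ ∑< r b →
  ∃[ w ] RibbonWord r n w × (∀ v → v < r → cnt w v n ≡ b v) ×
         (∀ w′ → SameAsc n w w′ → ∀ t → t ≤ n →
            ∑< r (λ v → b v ⊓ t) ≤ n × (∀ v → cnt w′ v (∑< r (λ v → b v ⊓ t)) ≤ t))
layers-exist r b n b≥2 eq = nth L , subst (λ n → RibbonWord r n (nth L)) len (layers-word b≥2 n b≤n)
  , (λ v v<r → subst (λ n → cnt (nth L) v n ≡ b v) len (tally-layers-full b≥2 n b≤n v v<r))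
  , λ w′ same t t≤n →
      (begin
        ∑< r (λ v → b v ⊓ t) ≤⟨ ∑<-mono r (λ v _ → m⊓n≤m (b v) t) ⟩
        ∑< r b               ≡⟨ eq ⟨
        n                    ∎)
      , λ v → subst (λ k → cnt w′ v k ≤ t) (length-layers t)
          (cnt≤layer (suc n) {n} {w′} len same v t (suc n ∸ t) (m+[n∸m]≡n (m≤n⇒m≤1+n t≤n)))
  where
  open Layers r b
  open ≤-Reasoning
  b≤n : ∀ i → i < r → b i ≤ suc n
  b≤n i i<r = m≤n⇒m≤1+n (subst (b i ≤_) (sym eq) (term≤∑< r b i i<r))
  -- No row is longer than `n`, so `suc n` blocks exhaust all letters.
  L = layers (suc n)
  len : length L ≡ n
  len = trans (length-layers-full b≥2 n b≤n) (sym eq)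

-- The two implications of the theorem

module _ (A B : SkewShape) (ribbonA : IsRibbon A) (elongatedA : IsElongated A)
         (ribbonB : IsRibbon B) (elongatedB : IsElongated B) (size≡ : size A ≡ size B) where

  private
    module A where
      open Shape A public
      open Ribbon ribbonA elongatedA public
      open Tableaux A ribbonA elongatedA public
    module B where
      open Shape B public
      open Ribbon ribbonB elongatedB public
      open Tableaux B ribbonB elongatedB public

    n : ℕ
    n = size B

    sumA : ∑< A.r A.len ≡ n
    sumA = trans (sym A.size-formula) size≡

    sumB : ∑< B.r B.len ≡ n
    sumB = sym B.size-formula

    module Forward (sub : suppF A ⊇ suppF B) where

      transfer : ∀ {w} → RibbonWord B.r n w → (∀ v → v < B.r → cnt w v n ≡ B.len v) →
                 ∃[ w′ ] SameAsc n w w′ × RibbonWord A.r n w′ × (∀ v → v < A.r → cnt w′ v n ≡ A.len v)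
      transfer {w} word content =
        let T , syt , comp≡ = suppF⁻ A {comp B (B.fill W)} (sub (suppF⁺ B {B.fill W} (B.fill-syt W)))
            w′ = A.rowOf {T} syt
            W′ = A.rowOf-word {T} syt
        in w′
          , ascComp-injective {n} {w} {w′} (begin
              ascComp n w           ≡⟨ B.comp-fits {B.fill W} (B.fill-syt W) {w} (B.fill-fits W) ⟨
              comp B (B.fill W)     ≡⟨ comp≡ ⟨
              comp A T              ≡⟨ A.comp-fits {T} syt {w′} (A.rowOf-fits {T} syt) ⟩
              ascComp (size A) w′   ≡⟨ cong (λ m → ascComp m w′) size≡ ⟩
              ascComp n w′          ∎)
          , subst (λ m → RibbonWord A.r m w′) size≡ (A.RowWord.word W′)
          , subst (λ m → ∀ v → v < A.r → cnt w′ v m ≡ A.len v) size≡ (A.RowWord.content W′)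
        where
        open ≡-Reasoning
        W : B.RowWord w
        W = record { word = word ; content = content }

      fewer-rows : A.r ∸ 1 ≤ B.r ∸ 1
      fewer-rows =
        let w , word , content , desc = stairs-exists B.r B.len n B.len≥2 (sym sumB)
            w′ , same , word′ , _ = transfer word content
        in rows≤ {w = w′} word′ λ q lt → ≮⇒≥ λ asc → ≤⇒≯ (desc q lt) (proj₂ (same _ lt) asc)

      -- Among the first `k` letters of `w′`, the letter `v` occurs at most `t` times because of the
      -- blocks, and at most `A.len v` times altogether. Adding over `v` gives the bound on `k`.
      min-sums : ∀ t → t ≤ n → ∑< B.r (λ v → B.len v ⊓ t) ≤ ∑< A.r (λ v → A.len v ⊓ t)
      min-sums t t≤n =
        let w , word , content , layered = layers-exist B.r B.len n B.len≥2 (sym sumB)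
            w′ , same , word′ , content′ = transfer word content
            k≤n , cnt≤t = layered w′ same t t≤n
            k = ∑< B.r (λ v → B.len v ⊓ t)
        in begin
          k                              ≡⟨ cnt-total {A.r} {k} {w′} (λ p p<k → bounded word′ p (<-≤-trans p<k k≤n)) ⟨
          ∑< A.r (λ v → cnt w′ v k)      ≤⟨ ∑<-mono A.r (λ v v<r → ⊓-glb
                                              (≤-trans (cnt-mono w′ v k≤n) (≤-reflexive (content′ v v<r))) (cnt≤t v)) ⟩
          ∑< A.r (λ v → A.len v ⊓ t)     ∎
        where open ≤-Reasoning

      thresholds : ∀ t → ∑< A.r (λ v → A.len v ∸ t) ≤ ∑< B.r (λ v → B.len v ∸ t)
      thresholds t with t ≤? n
      ... | yes t≤n = +-cancelˡ-≤ (∑< B.r (λ v → B.len v ⊓ t)) _ _ (begin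
          ∑< B.r (λ v → B.len v ⊓ t) + ∑< A.r (λ v → A.len v ∸ t) ≤⟨ +-monoˡ-≤ _ (min-sums t t≤n) ⟩
          ∑< A.r (λ v → A.len v ⊓ t) + ∑< A.r (λ v → A.len v ∸ t) ≡⟨ ∑<-⊓-∸ A.r A.len t ⟩
          ∑< A.r A.len                                            ≡⟨ trans sumA (sym sumB) ⟩
          ∑< B.r B.len                                            ≡⟨ ∑<-⊓-∸ B.r B.len t ⟨
          ∑< B.r (λ v → B.len v ⊓ t) + ∑< B.r (λ v → B.len v ∸ t) ∎)
        where open ≤-Reasoning
      ... | no t≰n = ≤-trans (≤-reflexive (∑<-zeros A.r λ v v<r → m≤n⇒m∸n≡0
                       (≤-trans (term≤∑< A.r A.len v v<r) (≤-trans (≤-reflexive sumA) (<⇒≤ (≰⇒> t≰n)))))) z≤n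

      excess : ∀ t {xs len r} → xs ↭ applyUpTo len r → sum (map (_∸ t) xs) ≡ ∑< r (λ v → len v ∸ t)
      excess t {xs} {len} {r} p = trans (sum-↭ (map⁺ (_∸ t) p))
        (trans (cong sum (map-applyUpTo len (_∸ t) r)) (sum-applyUpTo (λ v → len v ∸ t) r))

      dominated : ∀ k → 1 ≤ k → rows k A ⪯ rows k B
      dominated (suc zero) _ k _ _ = thresholds⇒dominance (parts (rows 1 A))
        (Linked⇒AllPairs (flip ≤-trans) (decreasing (rows 1 B)))
        (λ t → subst₂ _≤_ (sym (excess t A.rows-1)) (sym (excess t B.rows-1)) (thresholds t)) k
      dominated (suc (suc zero)) _ k _ _ = begin
        sum (take k (parts (rows 2 A)))   ≡⟨ sum-take-ones k (proj₁ (↭-ones A.rows-2)) ⟩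
        k ⊓ length (parts (rows 2 A))     ≤⟨ ⊓-monoʳ-≤ k (subst₂ _≤_ (sym (proj₂ (↭-ones A.rows-2))) (sym (proj₂ (↭-ones B.rows-2))) fewer-rows) ⟩
        k ⊓ length (parts (rows 2 B))     ≡⟨ sum-take-ones k (proj₁ (↭-ones B.rows-2)) ⟨
        sum (take k (parts (rows 2 B)))   ∎
        where
        open ≤-Reasoning
      dominated (suc (suc (suc j))) _ k 1≤k k≤ =
        contradiction (≤-trans 1≤k (subst (λ xs → k ≤ length xs) (A.rows-3+ j) k≤)) λ ()

    module Backward (dom : ∀ k → 1 ≤ k → rows k A ⪯ rows k B) where

      as bs : List ℕ
      as = parts (rows 1 A)
      bs = parts (rows 1 B)

      length-as : length as ≡ A.r
      length-as = trans (↭-length A.rows-1) (length-applyUpTo A.len A.r)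
      length-bs : length bs ≡ B.r
      length-bs = trans (↭-length B.rows-1) (length-applyUpTo B.len B.r)

      sum-as : sum as ≡ n
      sum-as = trans (sum-↭ A.rows-1) (trans (sum-applyUpTo A.len A.r) sumA)
      sum-bs : sum bs ≡ n
      sum-bs = trans (sum-↭ B.rows-1) (trans (sum-applyUpTo B.len B.r) sumB)

      dominance-at : ∀ k → k ≤ length as → sum (take k as) ≤ sum (take k bs)
      dominance-at zero    _  = z≤n
      dominance-at (suc k) k≤ = dom 1 ≤-refl (suc k) (s≤s z≤n) k≤

      -- Otherwise a proper prefix of `bs`, a list of positive parts, would sum to less than `n`,
      -- although it dominates all of `as`.
      rB≤rA : length bs ≤ length as
      rB≤rA = ≮⇒≥ λ lt → <⇒≱ (sum-take-< (length as) (positive (rows 1 B)) lt) (begin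
        sum bs                      ≡⟨ trans sum-bs (sym sum-as) ⟩
        sum as                      ≡⟨ cong sum (take-all (length as) as ≤-refl) ⟨
        sum (take (length as) as)   ≤⟨ dominance-at (length as) ≤-refl ⟩
        sum (take (length as) bs)   ∎)
        where open ≤-Reasoning

      rA∸1≤rB∸1 : A.r ∸ 1 ≤ B.r ∸ 1
      rA∸1≤rB∸1 with A.r ∸ 1 in eq
      ... | zero  = z≤n
      ... | suc m =
        let onesA , lenA = ↭-ones A.rows-2
            onesB , lenB = ↭-ones B.rows-2
        in begin
          suc m                                 ≡⟨ ⊓-idem (suc m) ⟨
          suc m ⊓ suc m                         ≡⟨ cong (suc m ⊓_) (trans lenA eq) ⟨
          suc m ⊓ length (parts (rows 2 A))     ≡⟨ sum-take-ones (suc m) onesA ⟨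
          sum (take (suc m) (parts (rows 2 A))) ≤⟨ dom 2 (s≤s z≤n) (suc m) (s≤s z≤n) (≤-reflexive (sym (trans lenA eq))) ⟩
          sum (take (suc m) (parts (rows 2 B))) ≡⟨ sum-take-ones (suc m) onesB ⟩
          suc m ⊓ length (parts (rows 2 B))     ≤⟨ m⊓n≤n (suc m) _ ⟩
          length (parts (rows 2 B))             ≡⟨ lenB ⟩
          B.r ∸ 1                               ∎
        where open ≤-Reasoning

      -- Truncated subtraction does not tell length 0 from length 1; the sums do, because the parts
      -- are positive.
      equal-lengths : ∀ {xs ys} → All (0 <_) xs → sum xs ≡ sum ys → length xs ∸ 1 ≤ length ys ∸ 1 →
                      length ys ≤ length xs → length xs ≡ length ys
      equal-lengths {[]}     {[]}     _         _  _  _  = refl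
      equal-lengths {[]}     {_ ∷ _}  _         _  _  ()
      equal-lengths {x ∷ xs} {[]}     (0<x ∷ _) eq _  _  =
        contradiction (≤-trans 0<x (m≤m+n x (sum xs))) (subst (λ k → ¬ 0 < k) (sym eq) λ ())
      equal-lengths {_ ∷ _}  {_ ∷ _}  _         _  le ge = cong suc (≤-antisym le (s≤s⁻¹ ge))

      lengths : length as ≡ length bs
      lengths = equal-lengths {as} {bs} (positive (rows 1 A)) (trans sum-as (sym sum-bs))
        (subst₂ (λ k l → k ∸ 1 ≤ l ∸ 1) (sym length-as) (sym length-bs) rA∸1≤rB∸1) rB≤rA

      -- The relation `⪯` stops at the length of `as`; beyond it both prefix sums equal `n`.
      dominance : ∀ k → sum (take k as) ≤ sum (take k bs)
      dominance k with k ≤? length as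
      ... | yes k≤ = dominance-at k k≤
      ... | no k≰ = ≤-reflexive (begin
          sum (take k as)  ≡⟨ cong sum (take-all k as (<⇒≤ (≰⇒> k≰))) ⟩
          sum as           ≡⟨ trans sum-as (sym sum-bs) ⟩
          sum bs           ≡⟨ cong sum (take-all k bs (subst (_≤ k) lengths (<⇒≤ (≰⇒> k≰)))) ⟨
          sum (take k bs)  ∎)
        where open ≡-Reasoning

      -- Dominance concerns the sorted lengths, so the rows of B are first sorted and the result is
      -- finally put in the order of A; both permutations are composed of moves.
      reachable : B.rowLengths ⇝ A.rowLengths
      reachable = ↭⇒⇝ (↭-sym B.rows-1)
        ◅◅ dominance⇒⇝ as bs (Linked⇒AllPairs (flip ≤-trans) (decreasing (rows 1 A))) lengths
             (trans sum-as (sym sum-bs)) dominance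
        ◅◅ ↭⇒⇝ A.rows-1

      realizes : ∀ {w} → B.RowWord w → Realizes n B.rowLengths w
      realizes {w} W = record
        { word    = subst (λ r → RibbonWord r n w) (sym (length-applyUpTo B.len B.r)) (B.RowWord.word W)
        ; content = λ v v< → let v<r = subst (v <_) (length-applyUpTo B.len B.r) v< in
                    trans (B.RowWord.content W v v<r) (sym (nth-applyUpTo B.len B.r v<r))
        }

      rowWord : ∀ {w} → Realizes n A.rowLengths w → A.RowWord w
      rowWord {w} R = record
        { word    = subst₂ (λ r m → RibbonWord r m w) (length-applyUpTo A.len A.r) (sym size≡) (Realizes.word R)
        ; content = λ v v<r → trans (cong (cnt w v) size≡) (trans
            (Realizes.content R v (subst (v <_) (sym (length-applyUpTo A.len A.r)) v<r))
            (nth-applyUpTo A.len A.r v<r))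
        }

      supports : suppF A ⊇ suppF B
      supports α∈ =
        let T , syt , comp≡ = suppF⁻ B α∈
            w = B.rowOf {T} syt
            w′ , same , R = ⇝-realizes reachable (All.applyUpTo⁺₁ B.len B.r (B.len≥2 _))
                              (realizes (B.rowOf-word {T} syt))
            W′ = rowWord R
        in subst (suppF A) (begin
          comp A (A.fill W′)   ≡⟨ A.comp-fits {A.fill W′} (A.fill-syt W′) {w′} (A.fill-fits W′) ⟩
          ascComp (size A) w′  ≡⟨ cong (λ m → ascComp m w′) size≡ ⟩
          ascComp n w′         ≡⟨ cong (fromSet n) (ascents-cong {n} {w} {w′} same) ⟨
          ascComp n w          ≡⟨ B.comp-fits {T} syt {w} (B.rowOf-fits {T} syt) ⟨
          comp B T             ≡⟨ comp≡ ⟩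
          _                    ∎) (suppF⁺ A {A.fill W′} (A.fill-syt W′))
        where open ≡-Reasoning

  equivalence : (suppF A ⊇ suppF B) ⇔ (∀ k → 1 ≤ k → rows k A ⪯ rows k B)
  equivalence = mk⇔ Forward.dominated (λ dom → Backward.supports dom)

theorem5p3 : (A B : SkewShape) → IsRibbon A → IsElongated A → IsRibbon B → IsElongated B →
    size A ≡ size B →
    (suppF A ⊇ suppF B) ⇔ (∀ k → 1 ≤ k → rows k A ⪯ rows k B)
theorem5p3 A B ribbonA elongatedA ribbonB elongatedB size≡ =
  equivalence A B ribbonA elongatedA ribbonB elongatedB size≡
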